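{- Let $B\in\{0,1,2,\ldots\}$ be a fixed constant. There exists an algorithm that, given as input (i) a directed graph $D$ with $n\ge 1$ vertices, whose number of edges is bounded from above by a (fixed) polynomial in $n$, together with an integer weight $w(e)\in\{0,1,\ldots,B\}$ for each edge $e$ of $D$, (ii) two vertices $s$ and $t$ of $D$, and (iii) a length $\ell\in\{0,1,\ldots,n-1\}$, counts, by total weight, the paths of length $\ell$ from $s$ to $t$ in $D$ (that is, it outputs, for each integer $w$, the number of paths of length $\ell$ from $s$ to $t$ in $D$ having total weight $w$) in time $$O^*\biggl(\exp\biggl(H\biggl(\frac{\ell}{2n}\biggr)\cdot n\biggr)\biggr).$$
   Context: $H$ is the binary entropy function $H(p)=-p\log p-(1-p)\log(1-p)$ for $0\le p\le 1$, with $\log$ the natural logarithm (and $0\log 0=0$). The digraph $D$ has vertex set $V$ with $|V|=n$ and edge set $E$, possibly with loops and parallel edges; each edge $e$ has a start vertex $e^-$ and an end vertex $e^+$. A path of length $\ell$ from $s$ to $t$ is a simple walk, i.e. a tuple $(v_0,e_1,v_1,e_2,v_2,\ldots,v_{\ell-1},e_\ell,v_\ell)$ with $v_0=s$, $v_\ell=t$, $v_0,v_1,\ldots,v_\ell\in V$ pairwise distinct, $e_1,\ldots,e_\ell\in E$, and $e_i^-=v_{i-1}$, $e_i^+=v_i$ for each $i=1,\ldots,\ell$. Its total weight is $\sum_{i=1}^{\ell}w(e_i)$ (zero when $\ell=0$). The notation $O^*(\cdot)$ suppresses a factor polynomial in $n$: a quantity is $O^*(T)$ if it is at most $p(n)\cdot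 T$ for some fixed polynomial $p$ (which may depend on $B$ and on the polynomial bounding the number of edges). -}

module Defs where

open import Data.Bool using (if_then_else_; _∧_)
open import Data.Fin as Fin using (Fin; toℕ; inject₁)
open import Data.Integer using (+_)
open import Data.List as List using (List; []; _∷_)
open import Data.List.Membership.Propositional using (_∈_)
import Data.List.Relation.Unary.Unique.Propositional as ListUnique
open import Data.Nat as ℕ using (ℕ; zero; suc; NonZero; _!; _≡ᵇ_; _<ᵇ_)
open import Data.Nat.Logarithm using (⌊log₂_⌋)
import Data.Nat.Properties as ℕₚ
open import Data.Product using (_×_; _,_; proj₁; proj₂; ∃-syntax)
open import Data.Rational as ℚ using (ℚ; 0ℚ; 1ℚ; _/_)
open import Algebra.Definitions.RawSemiring ℚ.+-*-rawSemiring using () renaming (_^_ to _^ℚ_)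
open import Data.Vec as Vec using (Vec)
import Data.Vec.Relation.Unary.Unique.Propositional as VecUnique
open import Function.Bundles using (_⇔_)
open import Relation.Binary.PropositionalEquality using (_≡_)

-- Edges are named by Fin size, so loops and parallel edges are allowed.
record Digraph (n : ℕ) : Set where
  field
    size  : ℕ
    start : Fin size → Fin n
    end   : Fin size → Fin n

  Edge : Set
  Edge = Fin size

  Weighting : Set
  Weighting = Edge → ℕ

open Digraph public

-- The tuple (v₀,e₁,v₁,…,e_ℓ,v_ℓ), stored as (v₀,…,v_ℓ) and (e₁,…,e_ℓ).
Walk : ∀ {n} → Digraph n → ℕ → Set
Walk {n} D ℓ = Vec (Fin n) (suc ℓ) × Vec (Edge D) ℓ

record IsPath {n} (D : Digraph n) (s t : Fin n) {ℓ} (π : Walk D ℓ) : Set where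
  vs = proj₁ π
  es = proj₂ π
  field
    source   : Vec.head vs ≡ s
    target   : Vec.last vs ≡ t
    distinct : VecUnique.Unique vs
    starts   : ∀ i → start D (Vec.lookup es i) ≡ Vec.lookup vs (inject₁ i)
    ends     : ∀ i → end D (Vec.lookup es i) ≡ Vec.lookup vs (Fin.suc i)

totalWeight : ∀ {n} (D : Digraph n) → Weighting D → ∀ {ℓ} → Walk D ℓ → ℕ
totalWeight D w (_ , es) = Vec.sum (Vec.map w es)

infix 4 _HasCardinality_

_HasCardinality_ : {A : Set} → (A → Set) → ℕ → Set
P HasCardinality c =
  ∃[ xs ] (ListUnique.Unique xs × (∀ x → x ∈ xs ⇔ P x) × List.length xs ≡ c)

-- Polynomials, used only as upper bounds; natural coefficients (constant
-- term first) suffice, since every real polynomial is dominated on ℕ by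
-- such a polynomial.

Polynomial : Set
Polynomial = List ℕ

eval : Polynomial → ℕ → ℕ
eval p x = List.foldr (λ a r → a ℕ.+ x ℕ.* r) 0 p

-- A rational sequence stands for the real number it converges to.
-- Convergence is not recorded in the type; it holds for log on (0,1], for H
-- on [0,1], and is preserved by _·_, _⊖_ and exp.

Approx : Set
Approx = ℕ → ℚ

fromℕ : ℕ → ℚ
fromℕ k = + k / 1

∑< : ℕ → (ℕ → ℚ) → ℚ
∑< zero    f = 0ℚ
∑< (suc m) f = ∑< m f ℚ.+ f m

infixr 7 _·_
infixl 6 _⊖_
infix  4 _≤ᴸ_

_·_ : ℚ → Approx → Approx
(q · a) m = q ℚ.* a m

_⊖_ : Approx → Approx → Approx
(a ⊖ b) m = a m ℚ.- b m

-- q is at most the limit of a.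
_≤ᴸ_ : ℚ → Approx → Set
q ≤ᴸ a = ∀ ε → 0ℚ ℚ.< ε → ∃[ N ] (∀ m → N ℕ.≤ m → q ℚ.≤ a m ℚ.+ ε)

-- The natural logarithm on (0,1]: log x = - ∑_{k≥1} (1-x)^k / k.
log : ℚ → Approx
log x m = ℚ.- ∑< m (λ k → (1ℚ ℚ.- x) ^ℚ suc k ℚ.* (+ 1 / suc k))

-- exp x = ∑_{k≥0} x^k / k!, truncated along with the approximation of x.
exp : Approx → Approx
exp x m = ∑< m (λ k → x m ^ℚ k ℚ.* (+ 1 / k !) {{k ℕₚ.!≢0}})

-- Each approximant of log 0 is a rational number, so the terms 0 · log 0
-- vanish, as the convention 0 log 0 = 0 demands.
H : ℚ → Approx
H p = (ℚ.- p) · log p ⊖ (1ℚ ℚ.- p) · log (1ℚ ℚ.- p)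

-- Structured programs for a random-access machine with
-- the logarithmic cost criterion. The memory consists of arrays of natural
-- numbers, indexed by ℕ; a program names its arrays by literals, so it uses
-- finitely many, and these could be interleaved into a single memory at the
-- cost of a constant factor.

Array : Set
Array = ℕ

Store : Set
Store = Array → ℕ → ℕ

_[_,_≔_] : Store → Array → ℕ → ℕ → Store
(σ [ a , i ≔ v ]) b j = if (a ≡ᵇ b) ∧ (i ≡ᵇ j) then v else σ b j

data Op : Set where
  add monus mul div : Op

apply : Op → ℕ → ℕ → ℕ
apply add   x y       = x ℕ.+ y
apply monus x y       = x ℕ.∸ y
apply mul   x y       = x ℕ.* y
apply div   x zero    = 0
apply div   x (suc y) = x ℕ./ suc y

data Expr : Set where
  lit  : ℕ → Expr
  read : Array → Expr → Expr
  op   : Op → Expr → Expr → Expr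

data Cmd : Set where
  skip   : Cmd
  write  : Array → Expr → Expr → Cmd
  _⨾_    : Cmd → Cmd → Cmd
  ifnz   : Expr → Cmd → Cmd → Cmd
  while  : Expr → Cmd → Cmd

infixr 5 _⨾_

-- The length of k in binary, where 0 has length 1.
bits : ℕ → ℕ
bits k = suc ⌊log₂ k ⌋

⟦_⟧ : Expr → Store → ℕ
⟦ lit k ⟧      σ = k
⟦ read a e ⟧   σ = σ a (⟦ e ⟧ σ)
⟦ op o e₁ e₂ ⟧ σ = apply o (⟦ e₁ ⟧ σ) (⟦ e₂ ⟧ σ)

cost : Expr → Store → ℕ
cost (lit k)      σ = bits k
cost (read a e)   σ = cost e σ ℕ.+ bits (⟦ e ⟧ σ) ℕ.+ bits (⟦ read a e ⟧ σ)
cost (op o e₁ e₂) σ = cost e₁ σ ℕ.+ cost e₂ σ ℕ.+ bits (⟦ e₁ ⟧ σ) ℕ.+ bits (⟦ e₂ ⟧ σ)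

-- ⟨ c , σ ⟩⇓⟨ τ , T ⟩: run from σ, the program c halts in τ after time T.
data ⟨_,_⟩⇓⟨_,_⟩ : Cmd → Store → Store → ℕ → Set where
  ⇓skip : ∀ {σ} → ⟨ skip , σ ⟩⇓⟨ σ , 1 ⟩
  ⇓write : ∀ {σ a e₁ e₂} →
    ⟨ write a e₁ e₂ , σ ⟩⇓⟨ σ [ a , ⟦ e₁ ⟧ σ ≔ ⟦ e₂ ⟧ σ ]
                          , suc (cost e₁ σ ℕ.+ cost e₂ σ ℕ.+ bits (⟦ e₁ ⟧ σ) ℕ.+ bits (⟦ e₂ ⟧ σ)) ⟩
  ⇓seq : ∀ {c d σ τ υ T U} →
    ⟨ c , σ ⟩⇓⟨ τ , T ⟩ → ⟨ d , τ ⟩⇓⟨ υ , U ⟩ → ⟨ c ⨾ d , σ ⟩⇓⟨ υ , T ℕ.+ U ⟩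
  ⇓then : ∀ {e c d σ τ T} → NonZero (⟦ e ⟧ σ) →
    ⟨ c , σ ⟩⇓⟨ τ , T ⟩ → ⟨ ifnz e c d , σ ⟩⇓⟨ τ , suc (cost e σ ℕ.+ T) ⟩
  ⇓else : ∀ {e c d σ τ T} → ⟦ e ⟧ σ ≡ 0 →
    ⟨ d , σ ⟩⇓⟨ τ , T ⟩ → ⟨ ifnz e c d , σ ⟩⇓⟨ τ , suc (cost e σ ℕ.+ T) ⟩
  ⇓loop : ∀ {e c σ τ υ T U} → NonZero (⟦ e ⟧ σ) →
    ⟨ c , σ ⟩⇓⟨ τ , T ⟩ → ⟨ while e c , τ ⟩⇓⟨ υ , U ⟩ →
    ⟨ while e c , σ ⟩⇓⟨ υ , suc (cost e σ ℕ.+ T ℕ.+ U) ⟩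
  ⇓exit : ∀ {e c σ} → ⟦ e ⟧ σ ≡ 0 → ⟨ while e c , σ ⟩⇓⟨ σ , suc (cost e σ) ⟩

contents : List ℕ → ℕ → ℕ
contents []       _       = 0
contents (x ∷ xs) zero    = x
contents (x ∷ xs) (suc i) = contents xs i

-- Array 0 holds n, the number of edges, s, t and ℓ; arrays 1, 2 and 3 hold
-- the starts, ends and weights of the edges. All other cells are 0.
input : ∀ {n} (D : Digraph n) → Weighting D → (s t : Fin n) → ℕ → Store
input {n} D w s t ℓ 0 = contents (n ∷ size D ∷ toℕ s ∷ toℕ t ∷ ℓ ∷ [])
input D w s t ℓ 1 = contents (List.tabulate (λ e → toℕ (start D e)))
input D w s t ℓ 2 = contents (List.tabulate (λ e → toℕ (end D e)))
input D w s t ℓ 3 = contents (List.tabulate w)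
input D w s t ℓ _ = contents []

-- The output is a finite list of numbers, indexed from 0, whose length is in
-- cell 0 of array 4 and whose entries are in array 5. Numbers beyond the end
-- of the list are understood to be 0.
output : Store → ℕ → ℕ
output σ k = if k <ᵇ σ 4 0 then σ 5 k else 0

{-# OPTIONS --safe #-}
module Submission where

-- A path of length ℓ from s to t consists of a path of length ⌊ℓ/2⌋ from s to
-- some vertex v and a path of length K = ⌈ℓ/2⌉ from v to t whose vertex sets,
-- v excluded, are disjoint. For families φ and ψ of sets with at most K
-- elements, the number of disjoint pairs is ∑ (-1)^|X| φ̂(X) ψ̂(X), where φ̂(X)
-- sums φ over the supersets of X; only the sets X with |X| ≤ K contribute. For
-- the half paths, the families are computed by a dynamic program over these Λ
-- small sets, and weights are recorded by evaluating generating functions at a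
-- power of 2 that exceeds the number of paths. This takes polynomially many
-- steps per small set.
--
-- With x = ℓ + 2 and y = 2n - ℓ + 2 one has Λ x^K y^(n-K) ≤ (x + y)^n by the
-- binomial theorem. Conversely, exp (a + h) ≥ (1 + h) exp a, and the two
-- logarithms in n H(ℓ/2n) dominate harmonic sums of which each term 1/j,
-- halved, contributes to the square of exp (n H(ℓ/2n)) a factor of at least
-- (j + 1)/j; these factors telescope to ((2n + 2)/x)^ℓ ((2n + 2)/y)^(2n-ℓ).
-- The two bounds differ by a polynomial factor.

-- The denominator 2n stems from the halving: a half path occupies about ℓ/2 of n vertices, and
-- since ℓ < n the sets of at most that size number about exp (n H(ℓ/2n)). Comparing the two
-- families pair by pair would square this; the signed sum needs one product for each set and middle
-- vertex.
--
-- Under the logarithmic cost criterion a step is cheap only if its operands are short. Hence every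
-- execution carries the invariant that all cells are at most 2 ^ `word`, with `word` polynomial in
-- n and the number of edges, and each write has to be bounded; time then amounts to counting steps.
--
-- Tables are addressed by bit masks. Such an index is exponential in n but has polynomially many
-- bits. Rows of sets with more than K elements are never written and keep their initial 0, which is
-- their correct value.
--
-- All numbers are natural, so even and odd sets are summed apart and subtracted once, where the
-- difference is known to be exact.
--
-- As logarithm and exponential are rational sequences, the lower bound is proved for truncated
-- series. The shift by 2 in x and y pays for discretisation and truncation; inequalities are
-- squared to avoid square roots.

-- Program logic: total correctness with a bound on time and on cell contents.

module Hoare where
  open import Defs
  open import Data.Bool using (Bool; true; false; _∧_; _∨_; not; T)
  open import Data.Empty using (⊥-elim)
  open import Data.List using (List; []; _∷_; _++_; length; [_])
  open import Data.List.Properties using (++-assoc; length-++; ++-identityʳ)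
  open import Data.Nat
  open import Data.Nat.DivMod using (m/n≤m)
  open import Data.Nat.Logarithm using (⌊log₂⌋-mono-≤; ⌊log₂[2^n]⌋≡n)
  open import Data.Nat.Properties
  open import Data.Nat.Tactic.RingSolver using (solve-∀)
  open import Data.Sum using (inj₁; inj₂)
  open import Data.Product using (_×_; _,_)
  open import Relation.Binary.PropositionalEquality hiding ([_])

  n≤2^n : ∀ n → n ≤ 2 ^ n
  n≤2^n zero = z≤n
  n≤2^n (suc n) = begin
    1 + n           ≤⟨ +-mono-≤ (m^n>0 2 n) (n≤2^n n) ⟩
    2 ^ n + 2 ^ n   ≡⟨ cong (2 ^ n +_) (sym (+-identityʳ _)) ⟩
    2 ^ suc n       ∎
    where open ≤-Reasoning

  bits-≤ : ∀ {v} k → v ≤ 2 ^ k → bits v ≤ suc k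
  bits-≤ k v≤ = s≤s (≤-trans (⌊log₂⌋-mono-≤ v≤) (≤-reflexive (⌊log₂[2^n]⌋≡n k)))

  -- The value of an expression is at most 2 ^ (deg e * M) when all cells are
  -- at most 2 ^ M.
  deg : Expr → ℕ
  deg (lit k)      = suc k
  deg (read a e)   = 1
  deg (op o e₁ e₂) = deg e₁ + deg e₂

  deg>0 : ∀ e → 0 < deg e
  deg>0 (lit k)      = z<s
  deg>0 (read a e)   = z<s
  deg>0 (op o e₁ e₂) = ≤-trans (deg>0 e₁) (m≤m+n _ _)

  -- Bounds the cost of an expression in units of M: by `deg`, an operand e has at most (`deg e` +
  -- 1) M bits.
  κᵉ : Expr → ℕ
  κᵉ (lit k)      = suc (suc k)
  κᵉ (read a e)   = κᵉ e + suc (deg e) + 2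
  κᵉ (op o e₁ e₂) = κᵉ e₁ + κᵉ e₂ + suc (deg e₁) + suc (deg e₂)

  -- The price of a single step, read off the program text. Each step of a run is charged the price
  -- of the whole command, so the number of loop rounds does not enter here.
  κ : Cmd → ℕ
  κ skip           = 1
  κ (write a e₁ e₂) = suc (κᵉ e₁ + κᵉ e₂ + suc (deg e₁) + suc (deg e₂))
  κ (c ⨾ d)        = κ c + κ d
  κ (ifnz e c d)   = suc (κᵉ e) + (κ c + κ d)
  κ (while e c)    = suc (κᵉ e) + κ c

  mods : Cmd → Array → Bool
  mods skip           b = false
  mods (write a e₁ e₂) b = a ≡ᵇ b
  mods (c ⨾ d)        b = mods c b ∨ mods d b
  mods (ifnz e c d)   b = mods c b ∨ mods d b
  mods (while e c)    b = mods c b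

  ∨-falseˡ : ∀ {a b} → a ∨ b ≡ false → a ≡ false
  ∨-falseˡ {false} _ = refl

  ∨-falseʳ : ∀ a {b} → a ∨ b ≡ false → b ≡ false
  ∨-falseʳ false p = p

  -- A record, so that `c`, `σ` and `τ` can be inferred from a proof; the bare function type
  -- mentions `c` only under `mods`.
  record Frame (c : Cmd) (σ τ : Store) : Set where
    constructor framed
    field
      unmodified : ∀ a → mods c a ≡ false → ∀ i → τ a i ≡ σ a i

  open Frame

  -- For a concrete command and array the side condition reduces to the unit type and is filled in
  -- silently.
  unchanged : ∀ {c σ τ} → Frame c σ τ → ∀ a {_ : T (not (mods c a))} i → τ a i ≡ σ a i
  unchanged {c} f a {p} i = unmodified f a (falsity (mods c a) p) i
    where
    falsity : ∀ b → T (not b) → b ≡ false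
    falsity false _ = refl

  keeps : ℕ → Cmd → Bool
  keeps zero    c = true
  keeps (suc k) c = not (mods c k) ∧ keeps k c

  unchanged-below : ∀ {c σ τ} → Frame c σ τ → ∀ k {_ : T (keeps k c)} → ∀ a → a < k → ∀ i → τ a i ≡ σ a i
  unchanged-below {c} f (suc k) {h} a (s≤s a≤k) i with mods c k in eq
  ... | false with m≤n⇒m<n∨m≡n a≤k
  ...   | inj₁ a<k  = unchanged-below f k {h} a a<k i
  ...   | inj₂ refl = unmodified f a eq i

  ≔-other : ∀ σ {a i v} b {j} → (a ≡ᵇ b) ≡ false → (σ [ a , i ≔ v ]) b j ≡ σ b j
  ≔-other σ b p rewrite p = refl

  ≡ᵇ-refl : ∀ n → (n ≡ᵇ n) ≡ true
  ≡ᵇ-refl zero    = refl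
  ≡ᵇ-refl (suc n) = ≡ᵇ-refl n

  ≢⇒≡ᵇ : ∀ {m n} → m ≢ n → (m ≡ᵇ n) ≡ false
  ≢⇒≡ᵇ {zero}  {zero}  p = ⊥-elim (p refl)
  ≢⇒≡ᵇ {zero}  {suc n} p = refl
  ≢⇒≡ᵇ {suc m} {zero}  p = refl
  ≢⇒≡ᵇ {suc m} {suc n} p = ≢⇒≡ᵇ (λ q → p (cong suc q))

  frame : ∀ {c σ τ T} → ⟨ c , σ ⟩⇓⟨ τ , T ⟩ → Frame c σ τ
  frame x = framed (go x)
    where
    go : ∀ {c σ τ T} → ⟨ c , σ ⟩⇓⟨ τ , T ⟩ → ∀ a → mods c a ≡ false → ∀ i → τ a i ≡ σ a i
    go ⇓skip a p i = refl
    go {σ = σ} (⇓write {a = b} {e₁}) a p i = ≔-other σ {a = b} {⟦ e₁ ⟧ σ} a p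
    go (⇓seq {c} x y) a p i = trans (go y a (∨-falseʳ (mods c a) p) i) (go x a (∨-falseˡ p) i)
    go (⇓then _ x) a p i = go x a (∨-falseˡ p) i
    go (⇓else {e} {c} _ x) a p i = go x a (∨-falseʳ (mods c a) p) i
    go (⇓loop _ x y) a p i = trans (go y a p i) (go x a p i)
    go (⇓exit _) a p i = refl

  for : Array → Expr → Cmd → Cmd
  for x e c = write x (lit 0) (lit 0)
    ⨾ while (op monus e (read x (lit 0))) (c ⨾ write x (lit 0) (op add (read x (lit 0)) (lit 1)))

  module Logic (M : ℕ) (M>0 : 0 < M) where

    Bnd : Store → Set
    Bnd σ = ∀ a i → σ a i ≤ 2 ^ M

    private
      *M : ∀ d → d ≤ d * M
      *M d = subst (_≤ d * M) (*-identityʳ d) (*-monoʳ-≤ d M>0)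

      -- Positive exponents are what addition asks for: 2 ^ a + 2 ^ b ≤ 2 ^ (a + b) once a and b are
      -- at least 1.
      apply-≤ : ∀ o {x y} a b → 0 < a → 0 < b → x ≤ 2 ^ a → y ≤ 2 ^ b → apply o x y ≤ 2 ^ (a + b)
      apply-≤ add {x} {y} (suc a) (suc b) _ _ p q = begin
        x + y                     ≤⟨ +-mono-≤ p q ⟩
        2 ^ suc a + 2 ^ suc b     ≤⟨ +-mono-≤ (^-monoʳ-≤ 2 (s≤s (m≤m+n a b))) (^-monoʳ-≤ 2 (s≤s (m≤n+m b a))) ⟩
        2 ^ suc (a + b) + 2 ^ suc (a + b) ≡⟨ cong (2 ^ suc (a + b) +_) (sym (+-identityʳ _)) ⟩
        2 ^ (suc (suc (a + b)))   ≡⟨ cong (λ z → 2 ^ suc z) (sym (+-suc a b)) ⟩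
        2 ^ (suc a + suc b)       ∎
        where open ≤-Reasoning
      apply-≤ monus {x} {y} a b _ _ p q = ≤-trans (m∸n≤m x y) (≤-trans p (^-monoʳ-≤ 2 (m≤m+n a b)))
      apply-≤ mul {x} {y} a b _ _ p q = ≤-trans (*-mono-≤ p q) (≤-reflexive (sym (^-distribˡ-+-* 2 a b)))
      apply-≤ div {x} {zero} a b _ _ p q = z≤n
      apply-≤ div {x} {suc y} a b _ _ p q = ≤-trans (m/n≤m x (suc y)) (≤-trans p (^-monoʳ-≤ 2 (m≤m+n a b)))

    ⟦⟧-≤ : ∀ e {σ} → Bnd σ → ⟦ e ⟧ σ ≤ 2 ^ (deg e * M)
    ⟦⟧-≤ (lit k) β = ≤-trans (n≤2^n k) (^-monoʳ-≤ 2 (≤-trans (n≤1+n k) (*M (suc k))))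
    ⟦⟧-≤ (read a e) β = ≤-trans (β a _) (^-monoʳ-≤ 2 (≤-reflexive (sym (*-identityˡ M))))
    ⟦⟧-≤ (op o e₁ e₂) {σ} β = subst (λ z → apply o (⟦ e₁ ⟧ σ) (⟦ e₂ ⟧ σ) ≤ 2 ^ z) (sym (*-distribʳ-+ M (deg e₁) (deg e₂)))
      (apply-≤ o _ _ (≤-trans (deg>0 e₁) (*M _)) (≤-trans (deg>0 e₂) (*M _)) (⟦⟧-≤ e₁ β) (⟦⟧-≤ e₂ β))

    bits⟦⟧-≤ : ∀ e {σ} → Bnd σ → bits (⟦ e ⟧ σ) ≤ suc (deg e) * M
    bits⟦⟧-≤ e β = ≤-trans (bits-≤ (deg e * M) (⟦⟧-≤ e β)) (+-monoˡ-≤ (deg e * M) M>0)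

    cost-≤ : ∀ e {σ} → Bnd σ → cost e σ ≤ κᵉ e * M
    cost-≤ (lit k) β = ≤-trans (bits-≤ k (n≤2^n k)) (≤-trans (n≤1+n (suc k)) (*M (suc (suc k))))
    cost-≤ (read a e) {σ} β = begin
      cost e σ + bits (⟦ e ⟧ σ) + bits (⟦ read a e ⟧ σ)
        ≤⟨ +-mono-≤ (+-mono-≤ (cost-≤ e β) (bits⟦⟧-≤ e β)) (bits⟦⟧-≤ (read a e) {σ} β) ⟩
      κᵉ e * M + suc (deg e) * M + 2 * M
        ≡⟨ sym (trans (*-distribʳ-+ M (κᵉ e + suc (deg e)) 2) (cong (_+ 2 * M) (*-distribʳ-+ M (κᵉ e) _))) ⟩
      (κᵉ e + suc (deg e) + 2) * M ∎
      where open ≤-Reasoning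
    cost-≤ (op o e₁ e₂) {σ} β = begin
      cost e₁ σ + cost e₂ σ + bits (⟦ e₁ ⟧ σ) + bits (⟦ e₂ ⟧ σ)
        ≤⟨ +-mono-≤ (+-mono-≤ (+-mono-≤ (cost-≤ e₁ β) (cost-≤ e₂ β)) (bits⟦⟧-≤ e₁ β)) (bits⟦⟧-≤ e₂ β) ⟩
      κᵉ e₁ * M + κᵉ e₂ * M + suc (deg e₁) * M + suc (deg e₂) * M
        ≡⟨ 4-distrib (κᵉ e₁) (κᵉ e₂) (suc (deg e₁)) (suc (deg e₂)) M ⟩
      κᵉ (op o e₁ e₂) * M ∎
      where
      open ≤-Reasoning
      4-distrib : ∀ a b c d m → a * m + b * m + c * m + d * m ≡ (a + b + c + d) * m
      4-distrib = solve-∀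

    -- `S` counts steps, each priced `κ c * M`. Keeping the two factors apart lets loops multiply
    -- `S` alone.
    record Run (c : Cmd) (σ : Store) (S : ℕ) (Q : Store → Set) : Set where
      constructor run
      field
        {final} : Store
        {time}  : ℕ
        exec    : ⟨ c , σ ⟩⇓⟨ final , time ⟩
        time-≤  : time ≤ S * (κ c * M)
        bnd     : Bnd final
        post    : Q final

    run-mono : ∀ {c σ S S′ Q} → S ≤ S′ → Run c σ S Q → Run c σ S′ Q
    run-mono {c} p (run x t b q) = run x (≤-trans t (*-monoˡ-≤ (κ c * M) p)) b q

    run-post : ∀ {c σ S Q R} → (∀ τ → Bnd τ → Frame c σ τ → Q τ → R τ) → Run c σ S Q → Run c σ S R
    run-post f (run x t b q) = run x t b (f _ b (frame x) q)

    run-skip : ∀ {σ Q} → Bnd σ → Q σ → Run skip σ 1 Q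
    run-skip β q = run ⇓skip (subst (1 ≤_) (sym (trans (*-identityˡ _) (*-identityˡ M))) M>0) β q

    ≔-bnd : ∀ {σ} a i v → Bnd σ → v ≤ 2 ^ M → Bnd (σ [ a , i ≔ v ])
    ≔-bnd {σ} a i v β p b j with (a ≡ᵇ b) ∧ (i ≡ᵇ j)
    ... | true  = p
    ... | false = β b j

    run-write : ∀ {a e₁ e₂ σ} {Q : Store → Set} → Bnd σ → ⟦ e₂ ⟧ σ ≤ 2 ^ M →
      Q (σ [ a , ⟦ e₁ ⟧ σ ≔ ⟦ e₂ ⟧ σ ]) → Run (write a e₁ e₂) σ 1 Q
    run-write {a} {e₁} {e₂} {σ} β p q = run ⇓write t≤ (≔-bnd {σ} a (⟦ e₁ ⟧ σ) _ β p) q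
      where
      open ≤-Reasoning
      t≤ : suc (cost e₁ σ + cost e₂ σ + bits (⟦ e₁ ⟧ σ) + bits (⟦ e₂ ⟧ σ)) ≤ 1 * (κ (write a e₁ e₂) * M)
      t≤ = begin
        suc (cost e₁ σ + cost e₂ σ + bits (⟦ e₁ ⟧ σ) + bits (⟦ e₂ ⟧ σ))
          ≤⟨ +-mono-≤ M>0 (cost-≤ (op add e₁ e₂) {σ} β) ⟩
        κ (write a e₁ e₂) * M       ≡⟨ sym (*-identityˡ _) ⟩
        1 * (κ (write a e₁ e₂) * M) ∎

    run-seq : ∀ {c d σ S U R Q} → Run c σ S R →
      (∀ τ → Bnd τ → Frame c σ τ → R τ → Run d τ U Q) → Run (c ⨾ d) σ (S + U) Q
    run-seq {c} {d} {σ} {S} {U} (run {τ} {t} x t≤ b r) k with k τ b (frame x) r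
    ... | run {υ} {u} y u≤ b′ q = run (⇓seq x y) bound b′ q
      where
      open ≤-Reasoning
      bound : t + u ≤ (S + U) * (κ (c ⨾ d) * M)
      bound = begin
        t + u ≤⟨ +-mono-≤ t≤ u≤ ⟩
        S * (κ c * M) + U * (κ d * M)
          ≤⟨ +-mono-≤ (*-monoʳ-≤ S (*-monoˡ-≤ M (m≤m+n (κ c) (κ d)))) (*-monoʳ-≤ U (*-monoˡ-≤ M (m≤n+m (κ d) (κ c)))) ⟩
        S * ((κ c + κ d) * M) + U * ((κ c + κ d) * M) ≡⟨ sym (*-distribʳ-+ ((κ c + κ d) * M) S U) ⟩
        (S + U) * (κ (c ⨾ d) * M) ∎

    private
      guard-≤ : ∀ e {c σ t S k} → Bnd σ → t ≤ S * (k * M) → suc (κᵉ e) ≤ c → k ≤ c → suc (cost e σ + t) ≤ suc S * (c * M)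
      guard-≤ e {c} {σ} {t} {S} {k} β p q r = +-mono-≤ {x = suc (cost e σ)}
        (≤-trans (+-mono-≤ M>0 (cost-≤ e β)) (*-monoˡ-≤ M q))
        (≤-trans p (*-monoʳ-≤ S (*-monoˡ-≤ M r)))

    run-then : ∀ {e c d σ S Q} → Bnd σ → NonZero (⟦ e ⟧ σ) → Run c σ S Q → Run (ifnz e c d) σ (suc S) Q
    run-then {e} {c} {d} {S = S} β p (run x t b q) = run (⇓then p x)
      (guard-≤ e {S = S} β t (m≤m+n (suc (κᵉ e)) _) (≤-trans (m≤m+n (κ c) (κ d)) (m≤n+m _ (suc (κᵉ e))))) b q

    run-else : ∀ {e c d σ S Q} → Bnd σ → ⟦ e ⟧ σ ≡ 0 → Run d σ S Q → Run (ifnz e c d) σ (suc S) Q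
    run-else {e} {c} {d} {S = S} β p (run x t b q) = run (⇓else p x)
      (guard-≤ e {S = S} β t (m≤m+n (suc (κᵉ e)) _) (≤-trans (m≤n+m (κ d) (κ c)) (m≤n+m _ (suc (κᵉ e))))) b q

    run-exit : ∀ {e c σ} {Q : Store → Set} → Bnd σ → ⟦ e ⟧ σ ≡ 0 → Q σ → Run (while e c) σ 1 Q
    run-exit {e} {c} {σ} β p q = run (⇓exit p) bound β q
      where
      open ≤-Reasoning
      bound : suc (cost e σ) ≤ 1 * (κ (while e c) * M)
      bound = begin
        suc (cost e σ)           ≤⟨ +-mono-≤ M>0 (cost-≤ e {σ} β) ⟩
        suc (κᵉ e) * M           ≤⟨ *-monoˡ-≤ M (m≤m+n (suc (κᵉ e)) (κ c)) ⟩
        κ (while e c) * M        ≡⟨ *-identityˡ _ ⟨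
        1 * (κ (while e c) * M)  ∎

    run-loop : ∀ {e c σ S U R Q} → Bnd σ → NonZero (⟦ e ⟧ σ) → Run c σ S R →
      (∀ τ → Bnd τ → Frame c σ τ → R τ → Run (while e c) τ U Q) → Run (while e c) σ (suc S + U) Q
    run-loop {e} {c} {σ} {S} {U} {R} {Q} β p (run {τ} {t} x t≤ b r) k = go (k τ b (frame x) r)
      where
      go : Run (while e c) τ U Q → Run (while e c) σ (suc S + U) Q
      go (run {υ} {u} y u≤ b′ q) = run (⇓loop p x y) bound b′ q
        where
        open ≤-Reasoning
        K = κ (while e c) * M
        bound : suc (cost e σ + t + u) ≤ (suc S + U) * K
        bound = begin
          suc (cost e σ + t) + u ≤⟨ +-mono-≤ (guard-≤ e {κ (while e c)} {σ} {t} {S} {κ c} β t≤ (m≤m+n (suc (κᵉ e)) (κ c)) (m≤n+m (κ c) (suc (κᵉ e)))) u≤ ⟩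
          suc S * K + U * K      ≡⟨ *-distribʳ-+ K (suc S) U ⟨
          (suc S + U) * K        ∎

    -- `Ls` is a ghost list: the counter holds the length of the prefix dealt with so far, and the
    -- invariant speaks of that prefix. The body has to establish it for the store after the counter
    -- is raised. A round costs two extra steps, for the guard and the increment; the final 2 are
    -- the initial write and the last test.
    run-for : ∀ {x e c σ S} {A : Set} (Ls : List A) (I : List A → Store → Set) →
      mods c x ≡ false →
      (∀ τ → Frame (for x e c) σ τ → ⟦ e ⟧ τ ≡ length Ls) →
      Bnd σ → length Ls ≤ 2 ^ M →
      I [] (σ [ x , 0 ≔ 0 ]) →
      (∀ xs a ys τ → Ls ≡ xs ++ a ∷ ys → Bnd τ → Frame (for x e c) σ τ → τ x 0 ≡ length xs → I xs τ →
         Run c τ S (λ τ′ → I (xs ++ [ a ]) (τ′ [ x , 0 ≔ suc (length xs) ]))) →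
      Run (for x e c) σ (length Ls * (S + 2) + 2) (I Ls)
    run-for {x} {e} {c} {σ} {S} {A} Ls I c∌x lim β Ls≤ I₀ body =
      run-mono (≤-reflexive (steps₀ (length Ls * (S + 2))))
        (run-seq {c = write x (lit 0) (lit 0)} {σ = σ} {R = λ τ → τ x 0 ≡ 0 × I [] τ}
          (run-write {a = x} {e₁ = lit 0} {e₂ = lit 0} β z≤n (cell 0 σ , I₀))
          λ τ β′ fr (p , i) → loop [] Ls τ refl (framed λ a m j → unmodified fr a (∨-falseˡ m) j) p β′ i)
      where
      steps₀ : ∀ k → 1 + (k + 1) ≡ k + 2
      steps₀ = solve-∀

      steps₁ : ∀ S k → suc (S + 1) + (k + 1) ≡ S + 2 + k + 1
      steps₁ = solve-∀

      cell : ∀ v (τ : Store) → (τ [ x , 0 ≔ v ]) x 0 ≡ v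
      cell v τ rewrite ≡ᵇ-refl x = refl

      guard : Expr
      guard = op monus e (read x (lit 0))

      incr : Cmd
      incr = write x (lit 0) (op add (read x (lit 0)) (lit 1))

      loop : ∀ xs ys τ → Ls ≡ xs ++ ys → Frame (for x e c) σ τ → τ x 0 ≡ length xs → Bnd τ → I xs τ →
        Run (while guard (c ⨾ incr)) τ (length ys * (S + 2) + 1) (I Ls)
      loop xs [] τ eq fr p β i = run-exit β stop (subst (λ z → I z τ) (sym eq′) i)
        where
        eq′ : Ls ≡ xs
        eq′ = trans eq (++-identityʳ xs)
        stop : ⟦ e ⟧ τ ∸ τ x 0 ≡ 0
        stop = trans (cong₂ _∸_ (lim τ fr) (trans p (cong length (sym eq′)))) (n∸n≡0 (length Ls))
      loop xs (a ∷ ys) τ eq fr p β i =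
        run-mono (≤-reflexive (steps₁ S (length ys * (S + 2))))
          (run-loop {guard} {c ⨾ incr} {τ} {S + 1} {length ys * (S + 2) + 1}
            {λ τ′ → τ′ x 0 ≡ length (xs ++ [ a ]) × I (xs ++ [ a ]) τ′} β go
            (run-seq {c} {incr} {τ} {S} {1} {λ τ′ → τ′ x 0 ≡ length xs × I (xs ++ [ a ]) (τ′ [ x , 0 ≔ suc (length xs) ])}
              (run-post (λ τ′ _ f q → trans (unmodified f x c∌x 0) p , q) (body xs a ys τ eq β fr p i))
              (λ τ′ β′ _ (q , i′) → run-write {x} {lit 0} {op add (read x (lit 0)) (lit 1)} {τ′} β′
                (≤-trans (≤-reflexive (next τ′ q)) (≤-trans lt Ls≤))
                (trans (cell _ τ′) (trans (next τ′ q) (sym len))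
                , subst (λ v → I (xs ++ [ a ]) (τ′ [ x , 0 ≔ v ])) (sym (next τ′ q)) i′)))
            λ τ′ β′ f (q , i′) → loop (xs ++ [ a ]) ys τ′ (trans eq (sym (++-assoc xs [ a ] ys)))
              (framed λ b m j → trans (unmodified f b (∨-falseʳ (x ≡ᵇ b) m) j) (unmodified fr b m j)) q β′ i′)
        where
        len : length (xs ++ [ a ]) ≡ suc (length xs)
        len = trans (length-++ xs) (+-comm (length xs) 1)
        next : ∀ (τ′ : Store) → τ′ x 0 ≡ length xs → τ′ x 0 + 1 ≡ suc (length xs)
        next τ′ q = trans (+-comm (τ′ x 0) 1) (cong suc q)
        lenLs : length Ls ≡ length xs + suc (length ys)
        lenLs = trans (cong length eq) (length-++ xs)
        lt : suc (length xs) ≤ length Ls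
        lt = subst (suc (length xs) ≤_) (sym lenLs) (subst (_≤ length xs + suc (length ys)) (+-comm (length xs) 1) (+-monoʳ-≤ (length xs) (s≤s z≤n)))
        go : NonZero (⟦ e ⟧ τ ∸ τ x 0)
        go = >-nonZero (subst (0 <_) (cong₂ _∸_ (sym (lim τ fr)) (sym p))
          (subst (0 <_) (sym (trans (cong (_∸ length xs) lenLs) (m+n∸m≡n (length xs) _))) z<s))

-- Integer inequalities behind the comparison of Λ with the entropy.

module Counting where
  open import Data.Nat
  open import Data.Nat.Properties
  open import Data.Nat.Tactic.RingSolver using (solve-∀)
  open import Relation.Binary.PropositionalEquality

  -- The first two terms of the binomial expansion; the induction step drops (m + 1) k² i^m.
  bernoulli : ∀ i k m → i ^ suc m + suc m * k * i ^ m ≤ (i + k) ^ suc m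
  bernoulli i k zero = ≤-reflexive (identity i k)
    where
    identity : ∀ i k → i * 1 + 1 * k * 1 ≡ (i + k) * 1
    identity = solve-∀
  bernoulli i k (suc m) = ≤-trans (≤-trans (m≤m+n _ _) (≤-reflexive (identity i k m (i ^ m))))
    (*-monoʳ-≤ (i + k) (bernoulli i k m))
    where
    identity : ∀ i k m I → i * (i * I) + suc (suc m) * k * (i * I) + suc m * k * k * I
      ≡ (i + k) * (i * I + suc m * k * I)
    identity = solve-∀

  -- For i ≤ m + 1 the second Bernoulli term is at least k i^(m+1). In other words (i/(i+k))^(m+1) ≤
  -- 1/(k+1), which controls the tail of a truncated geometric series.
  pow-gap : ∀ i k m → i ≤ suc m → i ^ suc m * suc k ≤ (i + k) ^ suc m
  pow-gap i k m p = ≤-trans (≤-reflexive (identity i k (i ^ m)))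
    (≤-trans (+-monoʳ-≤ (i ^ suc m) (*-monoˡ-≤ (i ^ m) (*-monoˡ-≤ k p))) (bernoulli i k m))
    where
    identity : ∀ i k I → i * I * suc k ≡ i * I + i * k * I
    identity = solve-∀

  -- The polynomial loss. Its square consists of (n + 1)² for passing from 2n + 4 to 2n + 2 and (2n
  -- + 2)² for rounding ℓ/2.
  slack : ℕ → ℕ
  slack n = 2 * suc n * suc n

  -- Says (1 + 1/(n+1))^n ≤ n + 1. It reconciles x + y = 2n + 4 from the binomial theorem with the
  -- 2n + 2 to which the harmonic sums telescope.
  [2+n]^n≤[1+n]^[1+n] : ∀ n → (2 + n) ^ n ≤ suc n ^ n * suc n
  [2+n]^n≤[1+n]^[1+n] n = ≤-trans go (≤-reflexive (*-comm (suc n) (suc n ^ n)))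
    where
    -- Bernoulli's inequality (1 - 1/(n+2))^k ≥ 1 - k/(n+2), with denominators cleared.
    linear : ∀ k → (2 + n) ^ k * (2 + n) ≤ suc n ^ k * (2 + n) + k * (2 + n) ^ k
    linear zero = m≤m+n _ _
    linear (suc k) = begin
      (2 + n) * P * (2 + n)     ≡⟨ e₁ n P ⟩
      P * (2 + n) * suc n + P * (2 + n) ≤⟨ +-monoˡ-≤ _ (*-monoˡ-≤ (suc n) (linear k)) ⟩
      (Q * (2 + n) + k * P) * suc n + P * (2 + n) ≤⟨ m≤m+n _ (k * P) ⟩
      (Q * (2 + n) + k * P) * suc n + P * (2 + n) + k * P ≡⟨ e₂ n k P Q ⟩
      suc n * Q * (2 + n) + suc k * ((2 + n) * P) ∎
      where
      open ≤-Reasoning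
      P = (2 + n) ^ k
      Q = suc n ^ k
      e₁ : ∀ n P → (2 + n) * P * (2 + n) ≡ P * (2 + n) * suc n + P * (2 + n)
      e₁ = solve-∀
      e₂ : ∀ n k P Q → (Q * (2 + n) + k * P) * suc n + P * (2 + n) + k * P
        ≡ suc n * Q * (2 + n) + suc k * ((2 + n) * P)
      e₂ = solve-∀
    go : (2 + n) ^ n ≤ suc n * suc n ^ n
    -- For k = n, `linear` leaves 2 P ≤ (n + 2) Q after removal of n P, and n + 2 ≤ 2 (n + 1).
    go = *-cancelʳ-≤ _ _ 2 (+-cancelʳ-≤ (n * P) _ _ (begin
      P * 2 + n * P          ≡⟨ e₁ n P ⟩
      P * (2 + n)              ≤⟨ linear n ⟩
      Q * (2 + n) + n * P  ≤⟨ +-monoˡ-≤ (n * P) (m≤m+n _ (n * Q)) ⟩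
      Q * (2 + n) + n * Q + n * P ≡⟨ e₂ n P Q ⟩
      suc n * Q * 2 + n * P ∎))
      where
      open ≤-Reasoning
      P = (2 + n) ^ n
      Q = suc n ^ n
      e₁ : ∀ n P → P * 2 + n * P ≡ P * (2 + n)
      e₁ = solve-∀
      e₂ : ∀ n P Q → Q * (2 + n) + n * Q + n * P ≡ suc n * Q * 2 + n * P
      e₂ = solve-∀

  square-^ : ∀ x k → x ^ k * x ^ k ≡ x ^ (k + k)
  square-^ x k = sym (^-distribˡ-+-* x k k)

  module _ (n ℓ j K Λ : ℕ) (ℓ+j : ℓ + j ≡ 2 * n) (K≤n : K ≤ n) (ℓ≤2K : ℓ ≤ K + K) (2K≤1+ℓ : K + K ≤ suc ℓ)
    (Λ≤ : Λ * ((2 + ℓ) ^ K * (2 + j) ^ (n ∸ K)) ≤ ((2 + ℓ) + (2 + j)) ^ n) where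

    private
      x = 2 + ℓ
      y = 2 + j
      A = (2 + 2 * n) ^ ℓ * (2 + 2 * n) ^ j
      B = x ^ ℓ * y ^ j

    -- The square of Λ ≤ `slack n` · √(A/B). Squaring `Λ≤` turns the exponents K and n - K into ℓ
    -- and j up to rounding.
    counting-bound : (Λ * Λ) * B ≤ (slack n * slack n) * A
    counting-bound = begin
      Λ * Λ * (x ^ ℓ * y ^ j)
        ≤⟨ *-monoʳ-≤ (Λ * Λ) (*-mono-≤ (^-monoʳ-≤ x ℓ≤2K) (^-monoʳ-≤ y j≤)) ⟩
      Λ * Λ * (x ^ (K + K) * (y * y ^ (d + d)))
        ≡⟨ cong₂ (λ a b → Λ * Λ * (a * (y * b))) (sym (square-^ x K)) (sym (square-^ y d)) ⟩
      Λ * Λ * (X * X * (y * (Y * Y)))          ≡⟨ e₁ Λ X Y y ⟩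
      (Λ * (X * Y)) * (Λ * (X * Y)) * y        ≤⟨ *-mono-≤ (*-mono-≤ Λ≤ Λ≤) y≤ ⟩
      (x + y) ^ n * (x + y) ^ n * N₂           ≤⟨ *-monoˡ-≤ N₂ (*-mono-≤ sum≤ sum≤) ⟩
      (N₂ ^ n * suc n) * (N₂ ^ n * suc n) * N₂ ≡⟨ e₂ (N₂ ^ n) (suc n) N₂ ⟩
      -- A second factor `N₂` is given away to make the constant a perfect square.
      suc n * suc n * N₂ * (N₂ ^ n * N₂ ^ n)   ≤⟨ *-monoˡ-≤ _ (*-monoʳ-≤ (suc n * suc n) (m≤m*n N₂ N₂)) ⟩
      suc n * suc n * (N₂ * N₂) * (N₂ ^ n * N₂ ^ n)
        ≡⟨ cong₂ _*_ (e₃ (suc n)) (trans (square-^ N₂ n) (trans (cong (N₂ ^_) (sym (trans ℓ+j (cong (n +_) (+-identityʳ n)))))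
             (trans (^-distribˡ-+-* N₂ ℓ j) (cong (λ z → z ^ ℓ * z ^ j) (e₄ n))))) ⟩
      slack n * slack n * A ∎
      where
      open ≤-Reasoning
      d = n ∸ K
      X = x ^ K
      Y = y ^ d
      N₂ = 2 * suc n
      e₁ : ∀ Λ X Y y → Λ * Λ * (X * X * (y * (Y * Y))) ≡ (Λ * (X * Y)) * (Λ * (X * Y)) * y
      e₁ = solve-∀
      e₂ : ∀ P s N → (P * s) * (P * s) * N ≡ s * s * N * (P * P)
      e₂ = solve-∀
      e₃ : ∀ s → s * s * (2 * s * (2 * s)) ≡ 2 * s * s * (2 * s * s)
      e₃ = solve-∀
      e₄ : ∀ n → 2 * suc n ≡ 2 + 2 * n
      e₄ = solve-∀
      e₅ : ∀ K d → suc (d + d) + (K + K) ≡ suc (2 * (K + d))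
      e₅ = solve-∀
      -- Here d = ⌊j/2⌋, so an odd j leaves one factor y over.
      j≤ : j ≤ suc (d + d)
      j≤ = +-cancelʳ-≤ (K + K) j (suc (d + d)) (begin
        j + (K + K)  ≤⟨ +-monoʳ-≤ j 2K≤1+ℓ ⟩
        j + suc ℓ      ≡⟨ trans (+-suc j ℓ) (cong suc (trans (+-comm j ℓ) ℓ+j)) ⟩
        suc (2 * n)    ≡⟨ cong (λ z → suc (2 * z)) (sym (m+[n∸m]≡n K≤n)) ⟩
        suc (2 * (K + d)) ≡⟨ sym (e₅ K d) ⟩
        suc (d + d) + (K + K) ∎)
      y≤ : y ≤ N₂
      y≤ = ≤-trans (+-monoʳ-≤ 2 (≤-trans (m≤n+m j ℓ) (≤-reflexive ℓ+j))) (≤-reflexive (sym (e₄ n)))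
      e₆ : ∀ n → 2 * (2 + n) ≡ 4 + 2 * n
      e₆ = solve-∀
      e₇ : ∀ ℓ j → 2 + ℓ + (2 + j) ≡ 4 + (ℓ + j)
      e₇ = solve-∀
      ^-distrib : ∀ a b k → (a * b) ^ k ≡ a ^ k * b ^ k
      ^-distrib a b zero = refl
      ^-distrib a b (suc k) = trans (cong (a * b *_) (^-distrib a b k)) ([m*n]*[o*p]≡[m*o]*[n*p] a b (a ^ k) (b ^ k))
      sum≤ : (x + y) ^ n ≤ N₂ ^ n * suc n
      sum≤ = begin
        (x + y) ^ n        ≡⟨ cong (_^ n) (trans (e₇ ℓ j) (trans (cong (4 +_) ℓ+j) (sym (e₆ n)))) ⟩
        (2 * (2 + n)) ^ n ≡⟨ ^-distrib 2 (2 + n) n ⟩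
        2 ^ n * (2 + n) ^ n ≤⟨ *-monoʳ-≤ (2 ^ n) ([2+n]^n≤[1+n]^[1+n] n) ⟩
        2 ^ n * (suc n ^ n * suc n) ≡⟨ sym (*-assoc (2 ^ n) _ (suc n)) ⟩
        2 ^ n * suc n ^ n * suc n   ≡⟨ cong (_* suc n) (sym (^-distrib 2 (suc n) n)) ⟩
        N₂ ^ n * suc n     ∎

-- Lower bounds for truncated logarithms and exponentials.

module Analysis where
  open import Defs
  open Counting using (pow-gap; slack; counting-bound)
  open import Data.Empty using (⊥-elim)
  open import Data.Integer as ℤ using (+_)
  import Data.Integer.Properties as ℤₚ
  open import Data.Nat as ℕ using (ℕ; zero; suc; NonZero; _!)
  import Data.Nat.Properties as ℕₚ
  open import Data.Nat.Tactic.RingSolver using (solve-∀)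
  open import Data.Product using (_,_)
  open import Data.Rational hiding (NonZero)
  open import Algebra.Definitions.RawSemiring +-*-rawSemiring using () renaming (_^_ to _^ℚ_)
  open import Data.Rational.Properties
  open import Data.Rational.Solver using (module +-*-Solver)
  open import Data.Rational.Unnormalised as ℚᵘ using (mkℚᵘ; *≡*)
  import Data.Rational.Unnormalised.Properties as ℚᵘₚ
  open import Relation.Binary.PropositionalEquality
  open import Relation.Nullary using (yes; no)
  open +-*-Solver using (solve; _:=_; _:+_; _:*_; _:-_; :-_; con)

  -- Normalised fractions are stuck on variables, so the equation is verified on unnormalised ones;
  -- the next lemmas proceed likewise.
  fromℕ-+ : ∀ a b → fromℕ (a ℕ.+ b) ≡ fromℕ a + fromℕ b
  fromℕ-+ a b = toℚᵘ-injective (ℚᵘₚ.≃-trans (toℚᵘ-fromℚᵘ (mkℚᵘ (+ (a ℕ.+ b)) 0))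
    (ℚᵘₚ.≃-trans (*≡* (cong (ℤ._* + 1) (cong₂ ℤ._+_ (sym (ℤₚ.*-identityʳ (+ a))) (sym (ℤₚ.*-identityʳ (+ b))))))
    (ℚᵘₚ.≃-trans (ℚᵘₚ.+-cong (ℚᵘₚ.≃-sym (toℚᵘ-fromℚᵘ (mkℚᵘ (+ a) 0))) (ℚᵘₚ.≃-sym (toℚᵘ-fromℚᵘ (mkℚᵘ (+ b) 0))))
    (ℚᵘₚ.≃-sym (toℚᵘ-homo-+ (fromℕ a) (fromℕ b))))))

  fromℕ-* : ∀ a b → fromℕ (a ℕ.* b) ≡ fromℕ a * fromℕ b
  fromℕ-* a b = toℚᵘ-injective (ℚᵘₚ.≃-trans (toℚᵘ-fromℚᵘ (mkℚᵘ (+ (a ℕ.* b)) 0))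
    (ℚᵘₚ.≃-trans (*≡* (cong (ℤ._* + 1) (ℤₚ.pos-* a b)))
    (ℚᵘₚ.≃-trans (ℚᵘₚ.*-cong (ℚᵘₚ.≃-sym (toℚᵘ-fromℚᵘ (mkℚᵘ (+ a) 0))) (ℚᵘₚ.≃-sym (toℚᵘ-fromℚᵘ (mkℚᵘ (+ b) 0))))
    (ℚᵘₚ.≃-sym (toℚᵘ-homo-* (fromℕ a) (fromℕ b))))))

  /-as-* : ∀ a d .{{_ : NonZero d}} → + a / d ≡ fromℕ a * (+ 1 / d)
  /-as-* a (suc d) = toℚᵘ-injective (ℚᵘₚ.≃-trans (toℚᵘ-fromℚᵘ (mkℚᵘ (+ a) d))
    (ℚᵘₚ.≃-trans (*≡* (cong₂ ℤ._*_ (sym (ℤₚ.*-identityʳ (+ a))) (cong +_ (ℕₚ.+-identityʳ (suc d)))))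
    (ℚᵘₚ.≃-trans (ℚᵘₚ.*-cong (ℚᵘₚ.≃-sym (toℚᵘ-fromℚᵘ (mkℚᵘ (+ a) 0))) (ℚᵘₚ.≃-sym (toℚᵘ-fromℚᵘ (mkℚᵘ (+ 1) d))))
    (ℚᵘₚ.≃-sym (toℚᵘ-homo-* (fromℕ a) (+ 1 / suc d))))))

  n/n≡1 : ∀ d .{{_ : NonZero d}} → + d / d ≡ 1ℚ
  n/n≡1 (suc d) = toℚᵘ-injective (ℚᵘₚ.≃-trans (toℚᵘ-fromℚᵘ (mkℚᵘ (+ suc d) d))
    (*≡* (ℤₚ.*-comm (+ suc d) (+ 1))))

  *-inverse : ∀ d .{{_ : NonZero d}} → fromℕ d * (+ 1 / d) ≡ 1ℚ
  *-inverse d = trans (sym (/-as-* d d)) (n/n≡1 d)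

  0≤/ : ∀ a d .{{_ : NonZero d}} → 0ℚ ≤ + a / d
  0≤/ a d = nonNegative⁻¹ (+ a / d) {{normalize-nonNeg a d}}

  0≤fromℕ : ∀ a → 0ℚ ≤ fromℕ a
  0≤fromℕ a = 0≤/ a 1

  0<fromℕ : ∀ a .{{_ : NonZero a}} → Positive (fromℕ a)
  0<fromℕ (suc a) = normalize-pos (suc a) 1

  0≤+ : ∀ {p q} → 0ℚ ≤ p → 0ℚ ≤ q → 0ℚ ≤ p + q
  0≤+ {p} {q} a b = subst (_≤ p + q) (+-identityʳ 0ℚ) (+-mono-≤ a b)

  ≤+ : ∀ p {q} → 0ℚ ≤ q → p ≤ p + q
  ≤+ p {q} b = subst (_≤ p + q) (+-identityʳ p) (+-monoʳ-≤ p b)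

  *-monoˡ : ∀ {r p q} → 0ℚ ≤ r → p ≤ q → r * p ≤ r * q
  *-monoˡ {r} h = *-monoˡ-≤-nonNeg r {{nonNegative h}}

  *-monoʳ : ∀ {r p q} → 0ℚ ≤ r → p ≤ q → p * r ≤ q * r
  *-monoʳ {r} h = *-monoʳ-≤-nonNeg r {{nonNegative h}}

  *-mono : ∀ {p q r s} → 0ℚ ≤ p → 0ℚ ≤ r → p ≤ q → r ≤ s → p * r ≤ q * s
  *-mono p≥0 r≥0 a b = ≤-trans (*-monoʳ r≥0 a) (*-monoˡ (≤-trans p≥0 a) b)

  0≤* : ∀ {p q} → 0ℚ ≤ p → 0ℚ ≤ q → 0ℚ ≤ p * q
  0≤* {p} {q} a b = subst (_≤ p * q) (*-zeroʳ p) (*-monoˡ a b)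

  fromℕ-mono : ∀ {a b} → a ℕ.≤ b → fromℕ a ≤ fromℕ b
  fromℕ-mono {a} {b} p = subst (fromℕ a ≤_) (trans (sym (fromℕ-+ a (b ℕ.∸ a))) (cong fromℕ (ℕₚ.m+[n∸m]≡n p)))
    (≤+ (fromℕ a) (0≤fromℕ (b ℕ.∸ a)))

  square-cancel-≤ : ∀ {p q} → 0ℚ ≤ p → 0ℚ ≤ q → p * p ≤ q * q → p ≤ q
  square-cancel-≤ {p} {q} p≥0 q≥0 h with p ≤? q
  ... | yes p≤q = p≤q
  ... | no p≰q = ⊥-elim (<-irrefl refl (<-≤-trans (≤-<-trans (*-monoˡ q≥0 (<⇒≤ q<p)) (*-monoˡ-<-pos p {{positive (≤-<-trans q≥0 q<p)}} q<p)) h))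
    where
    q<p : q < p
    q<p = ≰⇒> p≰q

  0≤^ : ∀ {x} k → 0ℚ ≤ x → 0ℚ ≤ x ^ℚ k
  0≤^ zero    p = 0≤fromℕ 1
  0≤^ (suc k) p = 0≤* p (0≤^ k p)

  ^-mono : ∀ {x y} k → 0ℚ ≤ x → x ≤ y → x ^ℚ k ≤ y ^ℚ k
  ^-mono zero    x≥0 p = ≤-refl
  ^-mono (suc k) x≥0 p = *-mono x≥0 (0≤^ k x≥0) p (^-mono k x≥0 p)

  -- Applied term by term to the series of both exp and log.
  bernoulli : ∀ {x h} k → 0ℚ ≤ x → 0ℚ ≤ h → x ^ℚ suc k + fromℕ (suc k) * h * x ^ℚ k ≤ (x + h) ^ℚ suc k
  bernoulli {x} {h} zero p q = ≤-reflexive (solve 2 (λ x h → x :* con 1ℚ :+ con 1ℚ :* h :* con 1ℚ := (x :+ h) :* con 1ℚ) refl x h)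
  bernoulli {x} {h} (suc k) p q = begin
    x * X + fromℕ (suc (suc k)) * h * X     ≡⟨ cong (λ z → x * X + z * h * X) (fromℕ-+ 1 (suc k)) ⟩
    x * X + (1ℚ + c) * h * X                ≤⟨ ≤+ _ (0≤* (0≤* (0≤* (0≤fromℕ (suc k)) q) q) (0≤^ k p)) ⟩
    x * X + (1ℚ + c) * h * X + c * h * h * x ^ℚ k
      ≡⟨ solve 4 (λ x h c y → x :* (x :* y) :+ (con 1ℚ :+ c) :* h :* (x :* y) :+ c :* h :* h :* y
                   := (x :+ h) :* (x :* y :+ c :* h :* y)) refl x h c (x ^ℚ k) ⟩
    (x + h) * (X + c * h * x ^ℚ k)          ≤⟨ *-monoˡ (0≤+ p q) (bernoulli k p q) ⟩
    (x + h) * (x + h) ^ℚ suc k              ∎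
    where
    open ≤-Reasoning
    X = x ^ℚ suc k
    c = fromℕ (suc k)

  ∑<-mono : ∀ m {f g} → (∀ k → f k ≤ g k) → ∑< m f ≤ ∑< m g
  ∑<-mono zero    p = ≤-refl
  ∑<-mono (suc m) p = +-mono-≤ (∑<-mono m p) (p m)

  ∑<-monoˡ : ∀ {m f} d → (∀ k → 0ℚ ≤ f k) → ∑< m f ≤ ∑< (d ℕ.+ m) f
  ∑<-monoˡ zero    p = ≤-refl
  ∑<-monoˡ (suc d) p = ≤-trans (∑<-monoˡ d p) (≤+ _ (p _))

  0≤∑< : ∀ m {f} → (∀ k → 0ℚ ≤ f k) → 0ℚ ≤ ∑< m f
  0≤∑< zero    p = ≤-refl
  0≤∑< (suc m) p = 0≤+ (0≤∑< m p) (p m)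

  inv! : ℕ → ℚ
  inv! k = (+ 1 / k !) {{k ℕₚ.!≢0}}

  0≤inv! : ∀ k → 0ℚ ≤ inv! k
  0≤inv! k = 0≤/ 1 (k !) {{k ℕₚ.!≢0}}

  inv!-suc : ∀ k → fromℕ (suc k) * inv! (suc k) ≡ inv! k
  inv!-suc k = *-cancelˡ-pos (begin
    f * (s * i)       ≡⟨ solve 3 (λ f s i → f :* (s :* i) := s :* f :* i) refl f s i ⟩
    s * f * i         ≡⟨ cong (_* i) (sym (fromℕ-* (suc k) (k !))) ⟩
    fromℕ (suc k !) * i ≡⟨ *-inverse (suc k !) {{suc k ℕₚ.!≢0}} ⟩
    1ℚ                ≡⟨ sym (*-inverse (k !) {{k ℕₚ.!≢0}}) ⟩
    f * inv! k        ∎)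
    where
    open ≡-Reasoning
    f = fromℕ (k !)
    s = fromℕ (suc k)
    i = inv! (suc k)
    *-cancelˡ-pos : ∀ {p q} → f * p ≡ f * q → p ≡ q
    *-cancelˡ-pos e = ≤-antisym (*-cancelˡ-≤-pos f {{0<fromℕ (k !) {{k ℕₚ.!≢0}}}} (≤-reflexive e))
      (*-cancelˡ-≤-pos f {{0<fromℕ (k !) {{k ℕₚ.!≢0}}}} (≤-reflexive (sym e)))

  exp< : ℕ → ℚ → ℚ
  exp< m x = ∑< m (λ k → x ^ℚ k * inv! k)

  0≤exp< : ∀ m {x} → 0ℚ ≤ x → 0ℚ ≤ exp< m x
  0≤exp< m p = 0≤∑< m (λ k → 0≤* (0≤^ k p) (0≤inv! k))

  exp<-mono : ∀ m {x y} → 0ℚ ≤ x → x ≤ y → exp< m x ≤ exp< m y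
  exp<-mono m p q = ∑<-mono m (λ k → *-monoʳ (0≤inv! k) (^-mono k p q))

  -- The product h · x^k/k! is charged to degree k + 1 on the right, hence the longer truncation
  -- there.
  exp<-step : ∀ m {x h} → 0ℚ ≤ x → 0ℚ ≤ h → (1ℚ + h) * exp< m x ≤ exp< (suc m) (x + h)
  exp<-step m {x} {h} p q = ≤-trans (≤-trans (≤-reflexive (solve 2 (λ h e → (con 1ℚ :+ h) :* e := e :+ h :* e) refl h (exp< m x)))
    (+-monoˡ-≤ (h * exp< m x) (∑<-monoˡ {m} 1 (λ k → 0≤* (0≤^ k p) (0≤inv! k))))) (go m)
    where
    open ≤-Reasoning
    go : ∀ m → exp< (suc m) x + h * exp< m x ≤ exp< (suc m) (x + h)
    go zero = ≤-reflexive (solve 2 (λ h o → con 0ℚ :+ o :+ h :* con 0ℚ := con 0ℚ :+ o) refl h (1ℚ * inv! 0))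
    go (suc m) = begin
      -- Writing 1/m! as (m + 1)/(m + 1)! makes Bernoulli's inequality in degree m + 1 applicable.
      E′ + X * i + h * (E + x ^ℚ m * inv! m) ≡⟨ cong (λ z → E′ + X * i + h * (E + x ^ℚ m * z)) (sym (inv!-suc m)) ⟩
      E′ + X * i + h * (E + x ^ℚ m * (c * i))
        ≡⟨ solve 7 (λ e′ X i h e y c → e′ :+ X :* i :+ h :* (e :+ y :* (c :* i))
              := (e′ :+ h :* e) :+ (X :+ c :* h :* y) :* i) refl E′ X i h E (x ^ℚ m) c ⟩
      (E′ + h * E) + (X + c * h * x ^ℚ m) * i ≤⟨ +-mono-≤ (go m) (*-monoʳ (0≤inv! (suc m)) (bernoulli m p q)) ⟩
      exp< (suc m) (x + h) + (x + h) ^ℚ suc m * i ∎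
      where
      E′ = exp< (suc m) x
      E  = exp< m x
      X  = x ^ℚ suc m
      i  = inv! (suc m)
      c  = fromℕ (suc m)

  geometric : ∀ m {z y} → z + y ≡ 1ℚ → y * ∑< m (z ^ℚ_) + z ^ℚ m ≡ 1ℚ
  geometric zero {z} {y} e = solve 1 (λ y → y :* con 0ℚ :+ con 1ℚ := con 1ℚ) refl y
  geometric (suc m) {z} {y} e = begin
    y * (G + Z) + z * Z ≡⟨ solve 4 (λ y g Z z → y :* (g :+ Z) :+ z :* Z := y :* g :+ (z :+ y) :* Z) refl y G Z z ⟩
    y * G + (z + y) * Z ≡⟨ cong (λ s → y * G + s * Z) e ⟩
    y * G + 1ℚ * Z      ≡⟨ cong (λ s → y * G + s) (*-identityˡ Z) ⟩
    y * G + Z           ≡⟨ geometric m {z} {y} e ⟩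
    1ℚ                  ∎
    where
    open ≡-Reasoning
    G = ∑< m (z ^ℚ_)
    Z = z ^ℚ m

  -- The truncated series of - log (1 - z).
  log< : ℕ → ℚ → ℚ
  log< m z = ∑< m (λ k → z ^ℚ suc k * (+ 1 / suc k))

  0≤log< : ∀ m {z} → 0ℚ ≤ z → 0ℚ ≤ log< m z
  0≤log< m p = 0≤∑< m (λ k → 0≤* (0≤^ (suc k) p) (0≤/ 1 (suc k)))

  -- Convexity: the function lies above its tangent at z, and its derivative is the geometric
  -- series.
  log<-step : ∀ m {z h} → 0ℚ ≤ z → 0ℚ ≤ h → log< m z + h * ∑< m (z ^ℚ_) ≤ log< m (z + h)
  log<-step zero {z} {h} p q = ≤-reflexive (solve 1 (λ h → con 0ℚ :+ h :* con 0ℚ := con 0ℚ) refl h)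
  log<-step (suc m) {z} {h} p q = begin
    L + Z * i + h * (G + z ^ℚ m)
      ≡⟨ cong (λ s → L + Z * i + h * (G + s)) (sym (trans (cong (_* z ^ℚ m) (*-inverse (suc m))) (*-identityˡ _))) ⟩
    L + Z * i + h * (G + c * i * z ^ℚ m)
      ≡⟨ solve 7 (λ L Z i h G c y → L :+ Z :* i :+ h :* (G :+ c :* i :* y) := (L :+ h :* G) :+ (Z :+ c :* h :* y) :* i)
           refl L Z i h G c (z ^ℚ m) ⟩
    (L + h * G) + (Z + c * h * z ^ℚ m) * i
      ≤⟨ +-mono-≤ (log<-step m p q) (*-monoʳ (0≤/ 1 (suc m)) (bernoulli m p q)) ⟩
    log< m (z + h) + (z + h) ^ℚ suc m * i ∎
    where
    open ≤-Reasoning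
    L = log< m z
    Z = z ^ℚ suc m
    G = ∑< m (z ^ℚ_)
    i = + 1 / suc m
    c = fromℕ (suc m)

  fromℕ-^ : ∀ a m → fromℕ (a ℕ.^ m) ≡ fromℕ a ^ℚ m
  fromℕ-^ a zero    = refl
  fromℕ-^ a (suc m) = trans (fromℕ-* a (a ℕ.^ m)) (cong (fromℕ a *_) (fromℕ-^ a m))

  ^-distrib-* : ∀ x y m → (x * y) ^ℚ m ≡ x ^ℚ m * y ^ℚ m
  ^-distrib-* x y zero    = refl
  ^-distrib-* x y (suc m) = trans (cong (x * y *_) (^-distrib-* x y m))
    (solve 4 (λ x y X Y → x :* y :* (X :* Y) := x :* X :* (y :* Y)) refl x y (x ^ℚ m) (y ^ℚ m))

  1^ : ∀ m → 1ℚ ^ℚ m ≡ 1ℚ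
  1^ zero    = refl
  1^ (suc m) = trans (*-identityˡ _) (1^ m)

  -- The sum of 1/j over k + 2 ≤ j ≤ k + i + 1, a discrete substitute for log ((k + i + 2)/(k + 2)).
  harmonic : ℕ → ℕ → ℚ
  harmonic zero    k = 0ℚ
  harmonic (suc i) k = harmonic i (suc k) + + 1 / suc (suc k)

  module _ (R : ℕ) .{{_ : NonZero R}} where

    private
      r : ℚ
      r = + 1 / R

      0≤r : 0ℚ ≤ r
      0≤r = 0≤/ 1 R

    fractions-sum : ∀ i k → i ℕ.+ k ≡ R → fromℕ i * r + fromℕ k * r ≡ 1ℚ
    fractions-sum i k e = trans (sym (*-distribʳ-+ r (fromℕ i) (fromℕ k)))
      (trans (cong (_* r) (trans (sym (fromℕ-+ i k)) (cong fromℕ e))) (*-inverse R))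

    -- For z = i/R the right-hand side equals (1 - z^m)/(k + 1). By `pow-gap`, z^m ≤ 1/(k + 2), and
    -- then the quotient is at least 1/(k + 2). Weakening 1/(k + 1) to 1/(k + 2) thus pays for the
    -- truncation.
    increment : ∀ m i k → i ℕ.+ suc k ≡ R → R ℕ.≤ m → + 1 / suc (suc k) ≤ r * ∑< m ((fromℕ i * r) ^ℚ_)
    increment zero i k e p = ⊥-elim (ℕₚ.<⇒≱ (ℕ.s≤s ℕ.z≤n) (subst (ℕ._≤ 0) (trans (sym e) (ℕₚ.+-suc i k)) p))
    increment m@(suc m′) i k e p = *-cancelˡ-≤-pos K₁ {{0<fromℕ (suc k)}} (*-cancelˡ-≤-pos K₂ {{0<fromℕ (suc (suc k))}} (begin
      K₂ * (K₁ * j)              ≡⟨ solve 3 (λ a b c → a :* (b :* c) := b :* (a :* c)) refl K₂ K₁ j ⟩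
      K₁ * (K₂ * j)              ≡⟨ cong (K₁ *_) (*-inverse (suc (suc k))) ⟩
      K₁ * 1ℚ                    ≡⟨ solve 2 (λ K w → K :* con 1ℚ := (w :+ K) :- w) refl K₁ w ⟩
      (w + K₁) - w               ≤⟨ +-monoˡ-≤ (- w) (+-monoˡ-≤ K₁ w≤1) ⟩
      (1ℚ + K₁) - w              ≡⟨ cong (_- w) (sym (fromℕ-+ 1 (suc k))) ⟩
      K₂ - w                     ≡⟨ cong (_- w) (trans (sym (*-identityʳ K₂)) (cong (K₂ *_) (sym (geometric m {z} {K₁ * r} (fractions-sum i (suc k) e))))) ⟩
      K₂ * (K₁ * r * g + z ^ℚ m) - w ≡⟨ solve 5 (λ a b r g Z → a :* (b :* r :* g :+ Z) :- a :* Z := a :* (b :* (r :* g))) refl K₂ K₁ r g (z ^ℚ m) ⟩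
      K₂ * (K₁ * (r * g))        ∎))
      where
      open ≤-Reasoning
      K₁ = fromℕ (suc k)
      K₂ = fromℕ (suc (suc k))
      j = + 1 / suc (suc k)
      z = fromℕ i * r
      g = ∑< m (z ^ℚ_)
      w = K₂ * z ^ℚ m
      w≤1 : w ≤ 1ℚ
      w≤1 = begin
        K₂ * z ^ℚ m                ≡⟨ cong (K₂ *_) (^-distrib-* (fromℕ i) r m) ⟩
        K₂ * (fromℕ i ^ℚ m * r ^ℚ m) ≡⟨ solve 3 (λ a b c → a :* (b :* c) := b :* a :* c) refl K₂ (fromℕ i ^ℚ m) (r ^ℚ m) ⟩
        fromℕ i ^ℚ m * K₂ * r ^ℚ m ≡⟨ cong (λ s → s * K₂ * r ^ℚ m) (sym (fromℕ-^ i m)) ⟩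
        fromℕ (i ℕ.^ m) * K₂ * r ^ℚ m ≡⟨ cong (_* r ^ℚ m) (sym (fromℕ-* (i ℕ.^ m) (suc (suc k)))) ⟩
        fromℕ (i ℕ.^ m ℕ.* suc (suc k)) * r ^ℚ m
          ≤⟨ *-monoʳ (0≤^ m 0≤r) (fromℕ-mono (pow-gap i (suc k) m′ (ℕₚ.≤-trans (ℕₚ.m≤m+n i (suc k)) (ℕₚ.≤-trans (ℕₚ.≤-reflexive e) p)))) ⟩
        fromℕ ((i ℕ.+ suc k) ℕ.^ m) * r ^ℚ m ≡⟨ cong (λ s → fromℕ (s ℕ.^ m) * r ^ℚ m) e ⟩
        fromℕ (R ℕ.^ m) * r ^ℚ m   ≡⟨ cong (_* r ^ℚ m) (fromℕ-^ R m) ⟩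
        fromℕ R ^ℚ m * r ^ℚ m      ≡⟨ sym (^-distrib-* (fromℕ R) r m) ⟩
        (fromℕ R * r) ^ℚ m         ≡⟨ cong (_^ℚ m) (*-inverse R) ⟩
        1ℚ ^ℚ m                    ≡⟨ 1^ m ⟩
        1ℚ                         ∎

    -- The argument climbs from 0 to i/R in steps of 1/R, and each step gains at least one harmonic
    -- term.
    harmonic≤log< : ∀ m i k → i ℕ.+ k ≡ R → R ℕ.≤ m → harmonic i k ≤ log< m (fromℕ i * r)
    harmonic≤log< m zero k e p = 0≤log< m (0≤* (0≤fromℕ 0) 0≤r)
    harmonic≤log< m (suc i) k e p = begin
      harmonic i (suc k) + + 1 / suc (suc k)
        ≤⟨ +-mono-≤ (harmonic≤log< m i (suc k) e′ p) (increment m i k e′ p) ⟩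
      log< m z + r * ∑< m (z ^ℚ_)  ≤⟨ log<-step m (0≤* (0≤fromℕ i) 0≤r) 0≤r ⟩
      log< m (z + r)               ≡⟨ cong (log< m) (trans (solve 2 (λ i r → i :* r :+ r := (con 1ℚ :+ i) :* r) refl (fromℕ i) r)
                                        (cong (_* r) (sym (fromℕ-+ 1 i)))) ⟩
      log< m (fromℕ (suc i) * r)   ∎
      where
      open ≤-Reasoning
      z = fromℕ i * r
      e′ : i ℕ.+ suc k ≡ R
      e′ = trans (ℕₚ.+-suc i k) e

  -- exp y is at least the square root of a / b.
  record √_/_≤exp_ (a b : ℕ) (y : ℚ) : Set where
    constructor root
    field
      y≥0   : 0ℚ ≤ y
      from  : ℕ
      bound : ∀ m → from ℕ.≤ m → fromℕ a ≤ fromℕ b * (exp< m y * exp< m y)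

  √-start : √ 1 / 1 ≤exp 0ℚ
  -- The threshold is 1 because the empty truncation of exp 0 is 0.
  √-start = root ≤-refl 1 λ { (suc m) _ → subst (λ e → fromℕ 1 ≤ fromℕ 1 * (e * e)) (sym (exp0 m)) ≤-refl }
    where
    exp0 : ∀ m → exp< (suc m) 0ℚ ≡ 1ℚ
    exp0 zero    = refl
    exp0 (suc m) = trans (cong (λ s → s + 0ℚ * 0ℚ ^ℚ m * inv! (suc m)) (exp0 m))
      (solve 2 (λ a b → con 1ℚ :+ con 0ℚ :* a :* b := con 1ℚ) refl (0ℚ ^ℚ m) (inv! (suc m)))

  √-scale : ∀ {a b y} c → √ a / b ≤exp y → √ a ℕ.* c / b ℕ.* c ≤exp y
  √-scale {a} {b} {y} c (root p N q) = root p N λ m N≤m → subst₂ _≤_ (sym (fromℕ-* a c))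
    (trans (solve 3 (λ b e c → b :* e :* c := b :* c :* e) refl (fromℕ b) (exp< m y * exp< m y) (fromℕ c)) (cong (_* (exp< m y * exp< m y)) (sym (fromℕ-* b c))))
    (*-monoʳ (0≤fromℕ c) (q m N≤m))

  -- (1 + h / 2)² ≥ 1 + h.
  √-step : ∀ {a b y} k → √ a / b ℕ.* suc (suc (suc k)) ≤exp y →
    √ a / b ℕ.* suc (suc k) ≤exp (y + ½ * (+ 1 / suc (suc k)))
  √-step {a} {b} {y} k (root p N q) = root (0≤+ p h≥0) (suc N) λ { (suc m) (ℕ.s≤s N≤m) → begin
      fromℕ a                     ≤⟨ q m N≤m ⟩
      fromℕ (b ℕ.* suc (suc (suc k))) * (E m * E m)
        ≡⟨ cong (_* (E m * E m)) (trans (fromℕ-* b (suc (suc (suc k)))) (cong (fromℕ b *_) (trans (fromℕ-+ 1 (suc (suc k))) (cong (λ s → s + K) (sym 2hK))))) ⟩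
      fromℕ b * ((h + h) * K + K) * (E m * E m)
        ≤⟨ ≤+ _ (0≤* (0≤* (0≤fromℕ b) (0≤fromℕ (suc (suc k)))) (0≤* (0≤* h≥0 h≥0) (0≤* (0≤exp< m p) (0≤exp< m p)))) ⟩
      fromℕ b * ((h + h) * K + K) * (E m * E m) + fromℕ b * K * (h * h * (E m * E m))
        ≡⟨ solve 4 (λ b h K e → b :* ((h :+ h) :* K :+ K) :* (e :* e) :+ b :* K :* (h :* h :* (e :* e))
              := b :* K :* ((con 1ℚ :+ h) :* e :* ((con 1ℚ :+ h) :* e))) refl (fromℕ b) h K (E m) ⟩
      fromℕ b * K * ((1ℚ + h) * E m * ((1ℚ + h) * E m))
        ≤⟨ *-monoˡ (0≤* (0≤fromℕ b) (0≤fromℕ (suc (suc k)))) (*-mono (E′≥0 m) (E′≥0 m) (exp<-step m p h≥0) (exp<-step m p h≥0)) ⟩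
      fromℕ b * K * (exp< (suc m) (y + h) * exp< (suc m) (y + h))
        ≡⟨ cong (_* (exp< (suc m) (y + h) * exp< (suc m) (y + h))) (sym (fromℕ-* b (suc (suc k)))) ⟩
      fromℕ (b ℕ.* suc (suc k)) * (exp< (suc m) (y + h) * exp< (suc m) (y + h)) ∎ }
    where
    open ≤-Reasoning
    K = fromℕ (suc (suc k))
    i = + 1 / suc (suc k)
    h = ½ * i
    E = λ m → exp< m y
    h≥0 : 0ℚ ≤ h
    h≥0 = 0≤* (0≤/ 1 2) (0≤/ 1 (suc (suc k)))
    E′≥0 : ∀ m → 0ℚ ≤ (1ℚ + h) * E m
    E′≥0 m = 0≤* (0≤+ (0≤fromℕ 1) h≥0) (0≤exp< m p)
    2hK : (h + h) * K ≡ 1ℚ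
    2hK = trans (solve 2 (λ i K → (con ½ :* i :+ con ½ :* i) :* K := K :* i) refl i K) (*-inverse (suc (suc k)))

  -- The factors (j + 1)/j for k + 2 ≤ j ≤ R + 1 telescope to (R + 2)/(k + 2).
  √-block : ∀ {a b y} R i k → i ℕ.+ k ≡ R → √ a / b ℕ.* suc (suc R) ≤exp y →
    √ a / b ℕ.* suc (suc k) ≤exp (y + ½ * harmonic i k)
  √-block {a} {b} {y} R zero k refl g = subst (√ a / _ ≤exp_) (sym (trans (cong (λ s → y + s) (*-zeroʳ ½)) (+-identityʳ y))) g
  √-block {a} {b} {y} R (suc i) k e g = subst (√ a / _ ≤exp_)
    (solve 3 (λ y h j → (y :+ con ½ :* h) :+ con ½ :* j := y :+ con ½ :* (h :+ j)) refl y (harmonic i (suc k)) _)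
    (√-step {a} {b} k (√-block {b = b} R i (suc k) (trans (ℕₚ.+-suc i k) e) g))

  -- Repeats the block, for c will be the coefficient ℓ or 2n - ℓ that a logarithm has in 2n
  -- H(ℓ/2n).
  √-blocks : ∀ {a b y} R i k → i ℕ.+ k ≡ R → ∀ c → √ a / b ≤exp y →
    √ a ℕ.* suc (suc R) ℕ.^ c / b ℕ.* suc (suc k) ℕ.^ c ≤exp (y + fromℕ c * (½ * harmonic i k))
  √-blocks {a} {b} {y} R i k e zero g = subst₂ (λ a b → √ a / b ≤exp (y + 0ℚ * (½ * harmonic i k))) (sym (ℕₚ.*-identityʳ a)) (sym (ℕₚ.*-identityʳ b))
    (subst (√ a / b ≤exp_) (solve 2 (λ y h → y := y :+ con 0ℚ :* h) refl y (½ * harmonic i k)) g)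
  √-blocks {a} {b} {y} R i k e (suc c) g = subst₂ (λ a b → √ a / b ≤exp (y + fromℕ (suc c) * (½ * harmonic i k))) (shuffle a (suc (suc R) ℕ.^ c) (suc (suc R))) (shuffle b (suc (suc k) ℕ.^ c) (suc (suc k)))
    (subst (√ a ℕ.* suc (suc R) ℕ.^ c ℕ.* suc (suc R) / b ℕ.* suc (suc k) ℕ.^ c ℕ.* suc (suc k) ≤exp_)
      (trans (solve 3 (λ y c h → y :+ c :* h :+ h := y :+ (con 1ℚ :+ c) :* h) refl y (fromℕ c) (½ * harmonic i k))
        (cong (λ z → y + z * (½ * harmonic i k)) (sym (fromℕ-+ 1 c))))
      (√-block {b = b ℕ.* suc (suc k) ℕ.^ c} R i k e (√-scale (suc (suc R)) (√-blocks R i k e c g))))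
    where
    shuffle : ∀ a p q → a ℕ.* p ℕ.* q ≡ a ℕ.* (q ℕ.* p)
    shuffle = solve-∀

  module _ (n ℓ j K Λ : ℕ) (ℓ+j : ℓ ℕ.+ j ≡ 2 ℕ.* n) (K≤n : K ℕ.≤ n) (ℓ≤2K : ℓ ℕ.≤ K ℕ.+ K) (2K≤1+ℓ : K ℕ.+ K ℕ.≤ suc ℓ)
    (Λ≤ : Λ ℕ.* ((2 ℕ.+ ℓ) ℕ.^ K ℕ.* (2 ℕ.+ j) ℕ.^ (n ℕ.∸ K)) ℕ.≤ ((2 ℕ.+ ℓ) ℕ.+ (2 ℕ.+ j)) ℕ.^ n) where

    private
      x = 2 ℕ.+ ℓ
      y = 2 ℕ.+ j
      A = (2 ℕ.+ 2 ℕ.* n) ℕ.^ ℓ ℕ.* (2 ℕ.+ 2 ℕ.* n) ℕ.^ j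
      B = x ℕ.^ ℓ ℕ.* y ℕ.^ j

    module _ .{{_ : NonZero n}} where

      private instance
        2n≢0 : NonZero (2 ℕ.* n)
        2n≢0 = ℕₚ.m*n≢0 2 n

      private
        r = + 1 / (2 ℕ.* n)
        p = + ℓ / (2 ℕ.* n)

        -- This is n H(ℓ/2n) with harmonic sums in place of the logarithms; the leading 0 comes from
        -- `√-start`.
        Y₀ = 0ℚ + fromℕ ℓ * (½ * harmonic j ℓ) + fromℕ j * (½ * harmonic ℓ j)

        lower : √ 1 ℕ.* (2 ℕ.+ 2 ℕ.* n) ℕ.^ ℓ ℕ.* (2 ℕ.+ 2 ℕ.* n) ℕ.^ j / 1 ℕ.* x ℕ.^ ℓ ℕ.* y ℕ.^ j ≤exp Y₀
        lower = √-blocks (2 ℕ.* n) ℓ j ℓ+j j (√-blocks (2 ℕ.* n) j ℓ (trans (ℕₚ.+-comm j ℓ) ℓ+j) ℓ √-start)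

        p≡ : p ≡ fromℕ ℓ * r
        p≡ = /-as-* ℓ (2 ℕ.* n)

        1-p≡ : 1ℚ - p ≡ fromℕ j * r
        1-p≡ = trans (cong₂ (λ a b → a - b) (sym (fractions-sum (2 ℕ.* n) ℓ j ℓ+j)) p≡)
          (solve 2 (λ a b → a :+ b :- a := b) refl (fromℕ ℓ * r) (fromℕ j * r))

        nr≡½ : fromℕ n * r ≡ ½
        nr≡½ = begin
          fromℕ n * r                   ≡⟨ solve 2 (λ n r → n :* r := con ½ :* (con (fromℕ 2) :* n :* r)) refl (fromℕ n) r ⟩
          ½ * (fromℕ 2 * fromℕ n * r)   ≡⟨ cong (λ z → ½ * (z * r)) (sym (fromℕ-* 2 n)) ⟩
          ½ * (fromℕ (2 ℕ.* n) * r)     ≡⟨ cong (½ *_) (*-inverse (2 ℕ.* n)) ⟩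
          ½ * 1ℚ                        ≡⟨⟩
          ½                             ∎
          where open ≡-Reasoning

        -- Since p = ℓ/2n and 1 - p = j/2n, the factor n turns the coefficients of the logarithms
        -- into ℓ/2 and j/2.
        exponent : ∀ m → (fromℕ n · H p) m ≡ fromℕ ℓ * (½ * log< m (fromℕ j * r)) + fromℕ j * (½ * log< m (fromℕ ℓ * r))
        exponent m = begin
          N * ((- p) * (- log< m (1ℚ - p)) - (1ℚ - p) * (- log< m (1ℚ - (1ℚ - p))))
            ≡⟨ cong₂ (λ a b → N * ((- p) * (- log< m a) - (1ℚ - p) * (- log< m b))) 1-p≡
                 (trans (solve 1 (λ p → con 1ℚ :- (con 1ℚ :- p) := p) refl p) p≡) ⟩
          N * ((- p) * (- u) - (1ℚ - p) * (- w)) ≡⟨ cong₂ (λ a b → N * ((- a) * (- u) - b * (- w))) p≡ 1-p≡ ⟩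
          N * ((- (fromℕ ℓ * r)) * (- u) - fromℕ j * r * (- w))
            ≡⟨ solve 6 (λ N l j r u w → N :* ((:- (l :* r)) :* (:- u) :- j :* r :* (:- w))
                 := l :* ((N :* r) :* u) :+ j :* ((N :* r) :* w)) refl N (fromℕ ℓ) (fromℕ j) r u w ⟩
          fromℕ ℓ * ((N * r) * u) + fromℕ j * ((N * r) * w)
            ≡⟨ cong (λ z → fromℕ ℓ * (z * u) + fromℕ j * (z * w)) nr≡½ ⟩
          fromℕ ℓ * (½ * u) + fromℕ j * (½ * w) ∎
          where
          open ≡-Reasoning
          N = fromℕ n
          u = log< m (fromℕ j * r)
          w = log< m (fromℕ ℓ * r)

        Y₀≤ : ∀ m → 2 ℕ.* n ℕ.≤ m → Y₀ ≤ (fromℕ n · H p) m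
        Y₀≤ m 2n≤m = subst (Y₀ ≤_) (sym (exponent m)) (+-mono-≤
          (≤-trans (≤-reflexive (+-identityˡ _)) (*-monoˡ (0≤fromℕ ℓ) (*-monoˡ (0≤/ 1 2)
            (harmonic≤log< (2 ℕ.* n) m j ℓ (trans (ℕₚ.+-comm j ℓ) ℓ+j) 2n≤m))))
          (*-monoˡ (0≤fromℕ j) (*-monoˡ (0≤/ 1 2) (harmonic≤log< (2 ℕ.* n) m ℓ j ℓ+j 2n≤m))))

      -- Combining Λ² B ≤ slack² A with A ≤ B exp² and cancelling B and the square gives Λ ≤ slack ·
      -- exp.
      entropy-bound : ∀ time P → time ℕ.≤ P ℕ.* Λ →
        fromℕ time ≤ᴸ fromℕ (P ℕ.* slack n) · exp (fromℕ n · H (+ ℓ / (2 ℕ.* n)))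
      -- The truncation has to be long enough both for the exponential (`from`) and for the two
      -- logarithms (2n).
      entropy-bound time P t≤ ε ε>0 = √_/_≤exp_.from lower ℕ.+ 2 ℕ.* n , λ m N≤m →
        ≤-trans (main m (ℕₚ.≤-trans (ℕₚ.m≤m+n (√_/_≤exp_.from lower) (2 ℕ.* n)) N≤m) (ℕₚ.≤-trans (ℕₚ.m≤n+m (2 ℕ.* n) (√_/_≤exp_.from lower)) N≤m)) (≤+ _ (<⇒≤ ε>0))
        where
        open ≤-Reasoning
        module _ (m : ℕ) (N≤m : √_/_≤exp_.from lower ℕ.≤ m) (2n≤m : 2 ℕ.* n ℕ.≤ m) where
          Y = (fromℕ n · H p) m
          E = exp< m Y
          S = fromℕ (slack n)
          L = fromℕ Λ
          b = fromℕ B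
          E≥0 : 0ℚ ≤ E
          E≥0 = 0≤exp< m (≤-trans (√_/_≤exp_.y≥0 lower) (Y₀≤ m 2n≤m))
          A≤ : fromℕ A ≤ b * (E * E)
          A≤ = begin
            fromℕ A ≡⟨ cong fromℕ (cong (ℕ._* (2 ℕ.+ 2 ℕ.* n) ℕ.^ j) (sym (ℕₚ.*-identityˡ ((2 ℕ.+ 2 ℕ.* n) ℕ.^ ℓ)))) ⟩
            fromℕ (1 ℕ.* (2 ℕ.+ 2 ℕ.* n) ℕ.^ ℓ ℕ.* (2 ℕ.+ 2 ℕ.* n) ℕ.^ j) ≤⟨ √_/_≤exp_.bound lower m N≤m ⟩
            fromℕ (1 ℕ.* x ℕ.^ ℓ ℕ.* y ℕ.^ j) * (exp< m Y₀ * exp< m Y₀)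
              ≡⟨ cong (λ z → fromℕ z * (exp< m Y₀ * exp< m Y₀)) (cong (ℕ._* y ℕ.^ j) (ℕₚ.*-identityˡ (x ℕ.^ ℓ))) ⟩
            b * (exp< m Y₀ * exp< m Y₀) ≤⟨ *-monoˡ (0≤fromℕ B) (*-mono e₀ e₀ le le) ⟩
            b * (E * E) ∎
            where
            e₀ = 0≤exp< m (√_/_≤exp_.y≥0 lower)
            le = exp<-mono m (√_/_≤exp_.y≥0 lower) (Y₀≤ m 2n≤m)
          B>0 : NonZero B
          B>0 = ℕₚ.m*n≢0 (x ℕ.^ ℓ) (y ℕ.^ j) {{ℕₚ.m^n≢0 x ℓ}} {{ℕₚ.m^n≢0 y j}}
          Λ≤SE : L ≤ S * E
          Λ≤SE = square-cancel-≤ (0≤fromℕ Λ) (0≤* (0≤fromℕ (slack n)) E≥0) (*-cancelˡ-≤-pos b {{0<fromℕ B {{B>0}}}} (begin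
            b * (L * L)         ≡⟨ trans (*-comm b (L * L)) (trans (cong (_* b) (sym (fromℕ-* Λ Λ))) (sym (fromℕ-* (Λ ℕ.* Λ) B))) ⟩
            fromℕ (Λ ℕ.* Λ ℕ.* B) ≤⟨ fromℕ-mono (counting-bound n ℓ j K Λ ℓ+j K≤n ℓ≤2K 2K≤1+ℓ Λ≤) ⟩
            fromℕ (slack n ℕ.* slack n ℕ.* A) ≡⟨ trans (fromℕ-* (slack n ℕ.* slack n) A) (cong (_* fromℕ A) (fromℕ-* (slack n) (slack n))) ⟩
            S * S * fromℕ A     ≤⟨ *-monoˡ (0≤* (0≤fromℕ (slack n)) (0≤fromℕ (slack n))) A≤ ⟩
            S * S * (b * (E * E)) ≡⟨ solve 3 (λ S b E → S :* S :* (b :* (E :* E)) := b :* ((S :* E) :* (S :* E))) refl S b E ⟩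
            b * ((S * E) * (S * E)) ∎))
          main : fromℕ time ≤ fromℕ (P ℕ.* slack n) * E
          main = begin
            fromℕ time          ≤⟨ fromℕ-mono t≤ ⟩
            fromℕ (P ℕ.* Λ)     ≡⟨ fromℕ-* P Λ ⟩
            fromℕ P * L         ≤⟨ *-monoˡ (0≤fromℕ P) Λ≤SE ⟩
            fromℕ P * (S * E)   ≡⟨ sym (*-assoc (fromℕ P) S E) ⟩
            fromℕ P * S * E     ≡⟨ cong (_* E) (sym (fromℕ-* P (slack n))) ⟩
            fromℕ (P ℕ.* slack n) * E ∎

-- Finite sums and sets of vertices.

module Combinatorics where
  open import Data.Bool using (Bool; true; false; not; _∧_; _∨_; _xor_)
  open import Data.Fin using (Fin; zero; suc; toℕ)
  open import Data.List using (List; []; _∷_; _++_; length; map; concatMap; filterᵇ; allFin; tabulate)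
  open import Data.List.Properties using (length-tabulate; map-tabulate)
  open import Data.Nat
  open import Data.Nat.ListAction using (sum)
  open import Data.Nat.Properties
  open import Data.Nat.Tactic.RingSolver using (solve-∀)
  open import Data.Vec as Vec using (Vec; []; _∷_; lookup; _[_]≔_)
  open import Function using (_∘_; id)
  open import Relation.Binary.PropositionalEquality
  open ≡-Reasoning

  private variable
    A B : Set
    n : ℕ

  ∑ : List A → (A → ℕ) → ℕ
  ∑ xs f = sum (map f xs)

  ∑-cong : ∀ (xs : List A) {f g : A → ℕ} → (∀ x → f x ≡ g x) → ∑ xs f ≡ ∑ xs g
  ∑-cong []       p = refl
  ∑-cong (x ∷ xs) p = cong₂ _+_ (p x) (∑-cong xs p)

  ∑-zero : ∀ (xs : List A) {f : A → ℕ} → (∀ x → f x ≡ 0) → ∑ xs f ≡ 0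
  ∑-zero []       p = refl
  ∑-zero (x ∷ xs) p = cong₂ _+_ (p x) (∑-zero xs p)

  ∑-+ : ∀ (xs : List A) (f g : A → ℕ) → ∑ xs (λ x → f x + g x) ≡ ∑ xs f + ∑ xs g
  ∑-+ []       f g = refl
  ∑-+ (x ∷ xs) f g = trans (cong (f x + g x +_) (∑-+ xs f g)) (shuffle (f x) (g x) _ _)
    where
    shuffle : ∀ a b c d → a + b + (c + d) ≡ a + c + (b + d)
    shuffle = solve-∀

  ∑-*ˡ : ∀ (xs : List A) c (f : A → ℕ) → ∑ xs (λ x → c * f x) ≡ c * ∑ xs f
  ∑-*ˡ []       c f = sym (*-zeroʳ c)
  ∑-*ˡ (x ∷ xs) c f = trans (cong (c * f x +_) (∑-*ˡ xs c f)) (sym (*-distribˡ-+ c (f x) (∑ xs f)))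

  ∑-*ʳ : ∀ (xs : List A) c (f : A → ℕ) → ∑ xs (λ x → f x * c) ≡ ∑ xs f * c
  ∑-*ʳ xs c f = trans (∑-cong xs (λ x → *-comm (f x) c)) (trans (∑-*ˡ xs c f) (*-comm c (∑ xs f)))

  ∑-swap : ∀ (xs : List A) (ys : List B) (f : A → B → ℕ) → ∑ xs (λ x → ∑ ys (f x)) ≡ ∑ ys (λ y → ∑ xs (λ x → f x y))
  ∑-swap []       ys f = sym (∑-zero ys (λ _ → refl))
  ∑-swap (x ∷ xs) ys f = trans (cong (∑ ys (f x) +_) (∑-swap xs ys f)) (sym (∑-+ ys (f x) _))

  ∑-++ : ∀ (xs ys : List A) (f : A → ℕ) → ∑ (xs ++ ys) f ≡ ∑ xs f + ∑ ys f
  ∑-++ []       ys f = refl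
  ∑-++ (x ∷ xs) ys f = trans (cong (f x +_) (∑-++ xs ys f)) (sym (+-assoc (f x) _ _))

  ∑-map : ∀ (xs : List A) (h : A → B) (f : B → ℕ) → ∑ (map h xs) f ≡ ∑ xs (f ∘ h)
  ∑-map []       h f = refl
  ∑-map (x ∷ xs) h f = cong (f (h x) +_) (∑-map xs h f)

  ∑-concatMap : ∀ (xs : List A) (h : A → List B) (f : B → ℕ) → ∑ (concatMap h xs) f ≡ ∑ xs (λ x → ∑ (h x) f)
  ∑-concatMap []       h f = refl
  ∑-concatMap (x ∷ xs) h f = trans (∑-++ (h x) (concatMap h xs) f) (cong (∑ (h x) f +_) (∑-concatMap xs h f))

  ∑-const-≤ : ∀ (xs : List A) {f : A → ℕ} {b} → (∀ x → f x ≤ b) → ∑ xs f ≤ length xs * b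
  ∑-const-≤ []       p = z≤n
  ∑-const-≤ (x ∷ xs) p = +-mono-≤ (p x) (∑-const-≤ xs p)

  length-∑ : ∀ (xs : List A) → length xs ≡ ∑ xs (λ _ → 1)
  length-∑ []       = refl
  length-∑ (x ∷ xs) = cong suc (length-∑ xs)

  -- Iverson bracket: conditions enter the sums as factors, just as they do in the program.
  ⌞_⌟ : Bool → ℕ
  ⌞ false ⌟ = 0
  ⌞ true  ⌟ = 1

  ⌞∧⌟ : ∀ a b → ⌞ a ∧ b ⌟ ≡ ⌞ a ⌟ * ⌞ b ⌟
  ⌞∧⌟ false b = refl
  ⌞∧⌟ true  b = sym (+-identityʳ _)

  ⌞⌟≤1 : ∀ b → ⌞ b ⌟ ≤ 1
  ⌞⌟≤1 false = z≤n
  ⌞⌟≤1 true  = ≤-refl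

  ⌞⌟*-≤ : ∀ b k → ⌞ b ⌟ * k ≤ k
  ⌞⌟*-≤ b k = ≤-trans (*-monoˡ-≤ k (⌞⌟≤1 b)) (≤-reflexive (*-identityˡ k))

  not-∨ : ∀ a b → not (a ∨ b) ≡ not a ∧ not b
  not-∨ false b = refl
  not-∨ true  b = refl

  ∑-filterᵇ : ∀ (p : A → Bool) xs (f : A → ℕ) → (∀ x → p x ≡ false → f x ≡ 0) → ∑ (filterᵇ p xs) f ≡ ∑ xs f
  ∑-filterᵇ p []       f z = refl
  ∑-filterᵇ p (x ∷ xs) f z with p x in eq
  ... | true  = cong (f x +_) (∑-filterᵇ p xs f z)
  ... | false = trans (∑-filterᵇ p xs f z) (cong (_+ ∑ xs f) (sym (z x eq)))

  infix 4 _==_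
  _==_ : Fin n → Fin n → Bool
  u == v = toℕ u ≡ᵇ toℕ v

  ==-sym : ∀ (u v : Fin n) → (u == v) ≡ (v == u)
  ==-sym zero    zero    = refl
  ==-sym zero    (suc v) = refl
  ==-sym (suc u) zero    = refl
  ==-sym (suc u) (suc v) = ==-sym u v

  ==-sound : ∀ (u v : Fin n) → (u == v) ≡ true → u ≡ v
  ==-sound zero    zero    p = refl
  ==-sound (suc u) (suc v) p = cong suc (==-sound u v p)

  ==-refl : ∀ (u : Fin n) → (u == u) ≡ true
  ==-refl zero    = refl
  ==-refl (suc u) = ==-refl u

  ∑-allFin-suc : ∀ n (f : Fin (suc n) → ℕ) → ∑ (allFin (suc n)) f ≡ f zero + ∑ (allFin n) (f ∘ suc)
  ∑-allFin-suc n f = cong (λ xs → f zero + sum xs) (trans (map-tabulate suc f) (sym (map-tabulate id (f ∘ suc))))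

  ∑-δ : ∀ (u : Fin n) (h : Fin n → ℕ) → ∑ (allFin n) (λ v → ⌞ u == v ⌟ * h v) ≡ h u
  ∑-δ {suc n} zero h = trans (∑-allFin-suc n (λ v → ⌞ zero == v ⌟ * h v))
    (trans (cong₂ _+_ (*-identityˡ (h zero)) (∑-zero (allFin n) (λ _ → refl))) (+-identityʳ _))
  ∑-δ {suc n} (suc u) h = trans (∑-allFin-suc n (λ v → ⌞ suc u == v ⌟ * h v)) (∑-δ u (h ∘ suc))

  ∑-δ′ : ∀ (u : Fin n) (h : Fin n → ℕ) → ∑ (allFin n) (λ v → ⌞ v == u ⌟ * h v) ≡ h u
  ∑-δ′ u h = trans (∑-cong (allFin _) (λ v → cong (λ b → ⌞ b ⌟ * h v) (==-sym v u))) (∑-δ u h)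

  Subset : ℕ → Set
  Subset = Vec Bool

  subsets : ∀ n → List (Subset n)
  subsets zero    = [] ∷ []
  subsets (suc n) = map (false ∷_) (subsets n) ++ map (true ∷_) (subsets n)

  ∑-subsets-suc : ∀ n (f : Subset (suc n) → ℕ) →
    ∑ (subsets (suc n)) f ≡ ∑ (subsets n) (f ∘ (false ∷_)) + ∑ (subsets n) (f ∘ (true ∷_))
  ∑-subsets-suc n f = trans (∑-++ (map (false ∷_) (subsets n)) _ f) (cong₂ _+_ (∑-map (subsets n) _ f) (∑-map (subsets n) _ f))

  insert delete : Fin n → Subset n → Subset n
  insert u X = X [ u ]≔ true
  delete u X = X [ u ]≔ false

  ∅ : ∀ {n} → Subset n
  ∅ = Vec.replicate _ false

  card : Subset n → ℕ
  card []      = 0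
  card (b ∷ X) = ⌞ b ⌟ + card X

  empty : Subset n → Bool
  empty []      = true
  empty (b ∷ X) = not b ∧ empty X

  disjoint : Subset n → Subset n → Bool
  disjoint []      []      = true
  disjoint (x ∷ X) (y ∷ Y) = not (x ∧ y) ∧ disjoint X Y

  odd : Subset n → Bool
  odd []      = false
  odd (b ∷ X) = b xor odd X

  lookup-insert : ∀ (u v : Fin n) X → lookup (insert u X) v ≡ (u == v) ∨ lookup X v
  lookup-insert zero    zero    (x ∷ X) = refl
  lookup-insert zero    (suc v) (x ∷ X) = refl
  lookup-insert (suc u) zero    (x ∷ X) = refl
  lookup-insert (suc u) (suc v) (x ∷ X) = lookup-insert u v X

  disjoint-insertˡ : ∀ (u : Fin n) X Y → disjoint (insert u X) Y ≡ disjoint X Y ∧ not (lookup Y u)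
  disjoint-insertˡ zero (false ∷ X) (false ∷ Y) with disjoint X Y
  ... | true = refl
  ... | false = refl
  disjoint-insertˡ zero (false ∷ X) (true ∷ Y) with disjoint X Y
  ... | true = refl
  ... | false = refl
  disjoint-insertˡ zero (true ∷ X) (false ∷ Y) with disjoint X Y
  ... | true = refl
  ... | false = refl
  disjoint-insertˡ zero (true ∷ X) (true ∷ Y) = refl
  disjoint-insertˡ (suc u) (x ∷ X) (y ∷ Y) with not (x ∧ y)
  ... | true = disjoint-insertˡ u X Y
  ... | false = refl

  disjoint-sym : ∀ (X Y : Subset n) → disjoint X Y ≡ disjoint Y X
  disjoint-sym []      []      = refl
  disjoint-sym (false ∷ X) (false ∷ Y) = disjoint-sym X Y
  disjoint-sym (false ∷ X) (true ∷ Y)  = disjoint-sym X Y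
  disjoint-sym (true ∷ X)  (false ∷ Y) = disjoint-sym X Y
  disjoint-sym (true ∷ X)  (true ∷ Y)  = refl

  disjoint-insertʳ : ∀ (u : Fin n) X Y → disjoint X (insert u Y) ≡ disjoint X Y ∧ not (lookup X u)
  disjoint-insertʳ u X Y = trans (disjoint-sym X (insert u Y))
    (trans (disjoint-insertˡ u Y X) (cong (_∧ not (lookup X u)) (disjoint-sym Y X)))

  disjoint-∅ : ∀ (X : Subset n) → disjoint X ∅ ≡ true
  disjoint-∅ []          = refl
  disjoint-∅ (false ∷ X) = disjoint-∅ X
  disjoint-∅ (true ∷ X)  = disjoint-∅ X

  card-delete : ∀ (u : Fin n) X → lookup X u ≡ true → suc (card (delete u X)) ≡ card X
  card-delete zero    (true ∷ X) p = refl
  card-delete (suc u) (x ∷ X)    p = trans (sym (+-suc ⌞ x ⌟ _)) (cong (⌞ x ⌟ +_) (card-delete u X p))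

  card-insert : ∀ (u : Fin n) X → card X ≤ card (insert u X)
  card-insert zero    (x ∷ X) = +-monoˡ-≤ (card X) (⌞⌟≤1 x)
  card-insert (suc u) (x ∷ X) = +-monoʳ-≤ ⌞ x ⌟ (card-insert u X)

  empty⇒card : ∀ (X : Subset n) → empty X ≡ true → card X ≡ 0
  empty⇒card []          p = refl
  empty⇒card (false ∷ X) p = empty⇒card X p

  card⇒empty : ∀ (X : Subset n) → card X ≡ 0 → empty X ≡ true
  card⇒empty []          p = refl
  card⇒empty (false ∷ X) p = card⇒empty X p

  empty-lookup : ∀ (u : Fin n) X → lookup X u ≡ true → empty X ≡ false
  empty-lookup zero    (true ∷ X) p = refl
  empty-lookup (suc u) (true ∷ X)  p = refl
  empty-lookup (suc u) (false ∷ X) p = empty-lookup u X p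

  ∑-empty : ∀ n (h : Subset n → ℕ) → ∑ (subsets n) (λ X → ⌞ empty X ⌟ * h X) ≡ h ∅
  ∑-empty zero    h = trans (+-identityʳ _) (*-identityˡ _)
  ∑-empty (suc n) h = trans (∑-subsets-suc n (λ X → ⌞ empty X ⌟ * h X))
    (trans (cong₂ _+_ (∑-empty n (h ∘ (false ∷_))) (∑-zero (subsets n) (λ _ → refl))) (+-identityʳ _))

  -- Deletion of u is a bijection from the sets containing u onto the sets without it, with
  -- insertion as inverse.
  ∑-reindex : ∀ (u : Fin n) (h : Subset n → Subset n → ℕ) →
    ∑ (subsets n) (λ X → ⌞ lookup X u ⌟ * h X (delete u X)) ≡ ∑ (subsets n) (λ X → ⌞ not (lookup X u) ⌟ * h (insert u X) X)
  ∑-reindex {suc n} zero h = begin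
    _ ≡⟨ ∑-subsets-suc n (λ X → ⌞ lookup X zero ⌟ * h X (delete zero X)) ⟩
    ∑ (subsets n) (λ _ → 0) + q ≡⟨ +-comm _ q ⟩
    q + ∑ (subsets n) (λ _ → 0) ≡⟨ ∑-subsets-suc n (λ X → ⌞ not (lookup X zero) ⌟ * h (insert zero X) X) ⟨
    _ ∎
    where q = ∑ (subsets n) (λ X → 1 * h (true ∷ X) (false ∷ X))
  ∑-reindex {suc n} (suc u) h = begin
    _ ≡⟨ ∑-subsets-suc n (λ X → ⌞ lookup X (suc u) ⌟ * h X (delete (suc u) X)) ⟩
    _ ≡⟨ cong₂ _+_ (∑-reindex u (λ X Y → h (false ∷ X) (false ∷ Y))) (∑-reindex u (λ X Y → h (true ∷ X) (true ∷ Y))) ⟩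
    _ ≡⟨ ∑-subsets-suc n (λ X → ⌞ not (lookup X (suc u)) ⌟ * h (insert (suc u) X) X) ⟨
    _ ∎

  -- Half paths and their composition.

  module Half {n m : ℕ} (val : Fin m → ℕ) where

    V : List (Fin n)
    V = allFin n

    𝔼 : List (Fin m)
    𝔼 = allFin m

    𝕊 : List (Subset n)
    𝕊 = subsets n

    -- Weighted number of paths of length j from r to v along the edges
    -- S e → E e whose set of vertices other than v is X.
    half : (S E : Fin m → Fin n) (r : Fin n) → ℕ → Fin n → Subset n → ℕ
    half S E r zero    v X = ⌞ v == r ⌟ * ⌞ empty X ⌟
    half S E r (suc j) v X = ∑ 𝔼 λ e →
      ⌞ E e == v ⌟ * (⌞ lookup X (S e) ⌟ * (⌞ not (lookup X v) ⌟ * (val e * half S E r j (S e) (delete (S e) X))))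

    half-self : ∀ S E r j v X → lookup X v ≡ true → half S E r j v X ≡ 0
    half-self S E r zero    v X p rewrite empty-lookup v X p = *-zeroʳ ⌞ v == r ⌟
    half-self S E r (suc j) v X p rewrite p = ∑-zero 𝔼 λ e →
      trans (cong (⌞ E e == v ⌟ *_) (*-zeroʳ ⌞ lookup X (S e) ⌟)) (*-zeroʳ ⌞ E e == v ⌟)

    half-¬self : ∀ S E r j v X → ⌞ not (lookup X v) ⌟ * half S E r j v X ≡ half S E r j v X
    half-¬self S E r j v X with lookup X v in eq
    ... | true  = sym (half-self S E r j v X eq)
    ... | false = *-identityˡ _

    -- A path with j edges has j vertices besides its endpoint v.
    half-card : ∀ S E r j v X → card X ≢ j → half S E r j v X ≡ 0
    half-card S E r zero v X p with empty X in eq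
    ... | true  with () ← p (empty⇒card X eq)
    ... | false = *-zeroʳ ⌞ v == r ⌟
    half-card S E r (suc j) v X p = ∑-zero 𝔼 λ e → term e
      where
      term : ∀ e → ⌞ E e == v ⌟ * (⌞ lookup X (S e) ⌟ * (⌞ not (lookup X v) ⌟ * (val e * half S E r j (S e) (delete (S e) X)))) ≡ 0
      term e with lookup X (S e) in eq
      ... | false = *-zeroʳ ⌞ E e == v ⌟
      ... | true rewrite half-card S E r j (S e) (delete (S e) X) (λ q → p (trans (sym (card-delete (S e) X eq)) (cong suc q)))
        = zeros ⌞ E e == v ⌟ ⌞ not (lookup X v) ⌟ (val e)
        where
        zeros : ∀ a b c → a * (1 * (b * (c * 0))) ≡ 0
        zeros = solve-∀

    half-≤ : ∀ S E r {b} j v X → (∀ e → val e ≤ b) → half S E r j v X ≤ (m * b) ^ j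
    half-≤ S E r zero v X p = *-mono-≤ (⌞⌟≤1 (v == r)) (⌞⌟≤1 (empty X))
    half-≤ S E r {b} (suc j) v X p = ≤-trans (∑-const-≤ 𝔼 λ e → ≤-trans (⌞⌟*-≤ (E e == v) _) (≤-trans (⌞⌟*-≤ (lookup X (S e)) _)
        (≤-trans (⌞⌟*-≤ (not (lookup X v)) _) (*-mono-≤ (p e) (half-≤ S E r j (S e) (delete (S e) X) p)))))
      (≤-reflexive (trans (cong (_* (b * (m * b) ^ j)) (length-tabulate {n = m} id)) (sym (*-assoc m b _))))

    module _ (S E : Fin m → Fin n) (t : Fin n) where

      -- Weighted number of paths of length j from u to t avoiding X.
      avoiding : ℕ → Fin n → Subset n → ℕ
      avoiding zero    u X = ⌞ u == t ⌟
      avoiding (suc j) u X = ∑ 𝔼 λ e →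
        ⌞ S e == u ⌟ * (⌞ not (lookup (insert u X) (E e)) ⌟ * (val e * avoiding j (E e) (insert u X)))

      -- The paths on the left are sorted by their set Y of vertices other than v and read backwards
      -- from t, whence `half E S t`. The induction strips the first edge, from v to w: w leaves Y,
      -- and v joins X.
      avoiding-half : ∀ j v X → avoiding j v X ≡ ∑ 𝕊 λ Y → ⌞ disjoint X Y ⌟ * half E S t j v Y
      avoiding-half zero v X = sym (begin
        ∑ 𝕊 (λ Y → ⌞ disjoint X Y ⌟ * (⌞ v == t ⌟ * ⌞ empty Y ⌟))
          ≡⟨ ∑-cong 𝕊 (λ Y → shuffle ⌞ disjoint X Y ⌟ ⌞ v == t ⌟ ⌞ empty Y ⌟) ⟩
        ∑ 𝕊 (λ Y → ⌞ empty Y ⌟ * (⌞ disjoint X Y ⌟ * ⌞ v == t ⌟)) ≡⟨ ∑-empty n (λ Y → ⌞ disjoint X Y ⌟ * ⌞ v == t ⌟) ⟩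
        ⌞ disjoint X ∅ ⌟ * ⌞ v == t ⌟ ≡⟨ cong (λ b → ⌞ b ⌟ * ⌞ v == t ⌟) (disjoint-∅ X) ⟩
        1 * ⌞ v == t ⌟ ≡⟨ *-identityˡ _ ⟩
        ⌞ v == t ⌟ ∎)
        where
        shuffle : ∀ a b c → a * (b * c) ≡ c * (a * b)
        shuffle = solve-∀
      avoiding-half (suc j) v X = sym (begin
        ∑ 𝕊 (λ Y → ⌞ disjoint X Y ⌟ * ∑ 𝔼 (λ e → term e Y)) ≡⟨ ∑-cong 𝕊 (λ Y → sym (∑-*ˡ 𝔼 ⌞ disjoint X Y ⌟ (λ e → term e Y))) ⟩
        ∑ 𝕊 (λ Y → ∑ 𝔼 (λ e → ⌞ disjoint X Y ⌟ * term e Y)) ≡⟨ ∑-swap 𝕊 𝔼 _ ⟩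
        ∑ 𝔼 (λ e → ∑ 𝕊 (λ Y → ⌞ disjoint X Y ⌟ * term e Y)) ≡⟨ ∑-cong 𝔼 edge ⟩
        avoiding (suc j) v X ∎)
        where
        term : Fin m → Subset n → ℕ
        term e Y = ⌞ S e == v ⌟ * (⌞ lookup Y (E e) ⌟ * (⌞ not (lookup Y v) ⌟ * (val e * half E S t j (E e) (delete (E e) Y))))
        edge : ∀ e → ∑ 𝕊 (λ Y → ⌞ disjoint X Y ⌟ * term e Y)
          ≡ ⌞ S e == v ⌟ * (⌞ not (lookup (insert v X) (E e)) ⌟ * (val e * avoiding j (E e) (insert v X)))
        edge e = begin
          ∑ 𝕊 (λ Y → ⌞ disjoint X Y ⌟ * term e Y)
            ≡⟨ ∑-cong 𝕊 (λ Y → shuffle₁ ⌞ disjoint X Y ⌟ q ⌞ lookup Y w ⌟ _) ⟩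
          ∑ 𝕊 (λ Y → ⌞ lookup Y w ⌟ * h Y (delete w Y)) ≡⟨ ∑-reindex w h ⟩
          ∑ 𝕊 (λ Y → ⌞ not (lookup Y w) ⌟ * h (insert w Y) Y) ≡⟨ ∑-cong 𝕊 pointwise ⟩
          ∑ 𝕊 (λ Y → q * (a * val e) * (⌞ disjoint (insert v X) Y ⌟ * G Y)) ≡⟨ ∑-*ˡ 𝕊 (q * (a * val e)) _ ⟩
          q * (a * val e) * ∑ 𝕊 (λ Y → ⌞ disjoint (insert v X) Y ⌟ * G Y) ≡⟨ cong (q * (a * val e) *_) (avoiding-half j w (insert v X)) ⟨
          q * (a * val e) * avoiding j w (insert v X) ≡⟨ shuffle₂ q a (val e) _ ⟩
          q * (a * (val e * avoiding j w (insert v X))) ∎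
          where
          w = E e
          q = ⌞ S e == v ⌟
          a = ⌞ not (lookup (insert v X) w) ⌟
          G = half E S t j w
          h : Subset n → Subset n → ℕ
          h Y Z = ⌞ disjoint X Y ⌟ * (q * (⌞ not (lookup Y v) ⌟ * (val e * G Z)))
          shuffle₁ : ∀ d q l x → d * (q * (l * x)) ≡ l * (d * (q * x))
          shuffle₁ = solve-∀
          shuffle₂ : ∀ q a c x → q * (a * c) * x ≡ q * (a * (c * x))
          shuffle₂ = solve-∀
          shuffle₃ : ∀ nb d nx q vw nv c g → nb * (d * nx * (q * (vw * nv * (c * g)))) ≡ q * (vw * nx * c) * (d * nv * (nb * g))
          shuffle₃ = solve-∀
          -- Both sides impose the same conditions: X and Y are disjoint, v and w differ, w is not
          -- in X, v is not in Y. The left adds that w is not in Y, which `half-¬self` absorbs.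
          pointwise : ∀ Y → ⌞ not (lookup Y w) ⌟ * h (insert w Y) Y ≡ q * (a * val e) * (⌞ disjoint (insert v X) Y ⌟ * G Y)
          pointwise Y
            rewrite disjoint-insertʳ w X Y | lookup-insert w v Y | disjoint-insertˡ v X Y | lookup-insert v w X | ==-sym w v
                  | not-∨ (v == w) (lookup Y v) | not-∨ (v == w) (lookup X w)
                  | ⌞∧⌟ (disjoint X Y) (not (lookup X w)) | ⌞∧⌟ (disjoint X Y) (not (lookup Y v))
                  | ⌞∧⌟ (not (v == w)) (not (lookup Y v)) | ⌞∧⌟ (not (v == w)) (not (lookup X w))
            = trans (shuffle₃ ⌞ not (lookup Y w) ⌟ ⌞ disjoint X Y ⌟ _ q ⌞ not (v == w) ⌟ _ (val e) (G Y))
                (cong (λ g → q * (⌞ not (v == w) ⌟ * ⌞ not (lookup X w) ⌟ * val e) * (⌞ disjoint X Y ⌟ * ⌞ not (lookup Y v) ⌟ * g))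
                  (half-¬self E S t j w Y))

      module _ (s : Fin n) where

        -- The last edge of the first half becomes the first edge of the second. On the left its end
        -- is the middle vertex v, on the right its start; summing over edges outermost eliminates v
        -- on both sides.
        shift : ∀ i j → ∑ V (λ v → ∑ 𝕊 λ X → half S E s (suc i) v X * avoiding j v X)
                      ≡ ∑ V (λ v → ∑ 𝕊 λ X → half S E s i v X * avoiding (suc j) v X)
        shift i j = begin
          ∑ V (λ v → ∑ 𝕊 λ X → half S E s (suc i) v X * avoiding j v X)
            ≡⟨ ∑-cong V (λ v → ∑-cong 𝕊 λ X → sym (∑-*ʳ 𝔼 (avoiding j v X) _)) ⟩
          ∑ V (λ v → ∑ 𝕊 λ X → ∑ 𝔼 λ e → ⌞ E e == v ⌟ * x e v X * avoiding j v X)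
            ≡⟨ ∑-cong V (λ v → ∑-swap 𝕊 𝔼 _) ⟩
          ∑ V (λ v → ∑ 𝔼 λ e → ∑ 𝕊 λ X → ⌞ E e == v ⌟ * x e v X * avoiding j v X) ≡⟨ ∑-swap V 𝔼 _ ⟩
          ∑ 𝔼 (λ e → ∑ V λ v → ∑ 𝕊 λ X → ⌞ E e == v ⌟ * x e v X * avoiding j v X)
            ≡⟨ ∑-cong 𝔼 (λ e → ∑-cong V λ v → trans (∑-cong 𝕊 λ X → *-assoc ⌞ E e == v ⌟ (x e v X) _) (∑-*ˡ 𝕊 ⌞ E e == v ⌟ _)) ⟩
          ∑ 𝔼 (λ e → ∑ V λ v → ⌞ E e == v ⌟ * ∑ 𝕊 λ X → x e v X * avoiding j v X) ≡⟨ ∑-cong 𝔼 (λ e → ∑-δ (E e) _) ⟩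
          ∑ 𝔼 (λ e → ∑ 𝕊 λ X → x e (E e) X * avoiding j (E e) X) ≡⟨ ∑-cong 𝔼 edge ⟩
          ∑ 𝔼 (λ e → ∑ 𝕊 λ X → half S E s i (S e) X * y e (S e) X) ≡⟨ ∑-cong 𝔼 (λ e → ∑-δ (S e) _) ⟨
          ∑ 𝔼 (λ e → ∑ V λ v → ⌞ S e == v ⌟ * ∑ 𝕊 λ X → half S E s i v X * y e v X)
            ≡⟨ ∑-cong 𝔼 (λ e → ∑-cong V λ v → trans (∑-cong 𝕊 λ X → shuffle (half S E s i v X) ⌞ S e == v ⌟ _) (∑-*ˡ 𝕊 ⌞ S e == v ⌟ _)) ⟨
          ∑ 𝔼 (λ e → ∑ V λ v → ∑ 𝕊 λ X → half S E s i v X * (⌞ S e == v ⌟ * y e v X)) ≡⟨ ∑-swap V 𝔼 _ ⟨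
          ∑ V (λ v → ∑ 𝔼 λ e → ∑ 𝕊 λ X → half S E s i v X * (⌞ S e == v ⌟ * y e v X)) ≡⟨ ∑-cong V (λ v → ∑-swap 𝕊 𝔼 _) ⟨
          ∑ V (λ v → ∑ 𝕊 λ X → ∑ 𝔼 λ e → half S E s i v X * (⌞ S e == v ⌟ * y e v X))
            ≡⟨ ∑-cong V (λ v → ∑-cong 𝕊 λ X → ∑-*ˡ 𝔼 (half S E s i v X) _) ⟩
          ∑ V (λ v → ∑ 𝕊 λ X → half S E s i v X * avoiding (suc j) v X) ∎
          where
          x : Fin m → Fin n → Subset n → ℕ
          x e v X = ⌞ lookup X (S e) ⌟ * (⌞ not (lookup X v) ⌟ * (val e * half S E s i (S e) (delete (S e) X)))
          y : Fin m → Fin n → Subset n → ℕ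
          y e v X = ⌞ not (lookup (insert v X) (E e)) ⌟ * (val e * avoiding j (E e) (insert v X))
          shuffle : ∀ a b c → a * (b * c) ≡ b * (a * c)
          shuffle = solve-∀
          shuffle′ : ∀ ns nw c f p → ns * (nw * (c * f) * p) ≡ ns * f * (nw * (c * p))
          shuffle′ = solve-∀
          edge : ∀ e → ∑ 𝕊 (λ X → x e (E e) X * avoiding j (E e) X) ≡ ∑ 𝕊 (λ X → half S E s i (S e) X * y e (S e) X)
          edge e = begin
            ∑ 𝕊 (λ X → x e (E e) X * avoiding j (E e) X) ≡⟨ ∑-cong 𝕊 (λ X → *-assoc ⌞ lookup X (S e) ⌟ _ _) ⟩
            _ ≡⟨ ∑-reindex (S e) (λ X Y → ⌞ not (lookup X (E e)) ⌟ * (val e * half S E s i (S e) Y) * avoiding j (E e) X) ⟩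
            _ ≡⟨ ∑-cong 𝕊 (λ X → trans (shuffle′ ⌞ not (lookup X (S e)) ⌟ ⌞ not (lookup (insert (S e) X) (E e)) ⌟ (val e) (half S E s i (S e) X) (avoiding j (E e) (insert (S e) X)))
                   (cong (_* y e (S e) X) (half-¬self S E s i (S e) X))) ⟩
            _ ∎

        -- Once all i edges are moved over, the first half is the trivial path at s with the empty
        -- set.
        split : ∀ i j → ∑ V (λ v → ∑ 𝕊 λ X → half S E s i v X * avoiding j v X) ≡ avoiding (i + j) s ∅
        split zero j = begin
          ∑ V (λ v → ∑ 𝕊 λ X → ⌞ v == s ⌟ * ⌞ empty X ⌟ * avoiding j v X)
            ≡⟨ ∑-cong V (λ v → trans (∑-cong 𝕊 λ X → *-assoc ⌞ v == s ⌟ _ _) (∑-*ˡ 𝕊 ⌞ v == s ⌟ _)) ⟩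
          ∑ V (λ v → ⌞ v == s ⌟ * ∑ 𝕊 λ X → ⌞ empty X ⌟ * avoiding j v X) ≡⟨ ∑-δ′ s _ ⟩
          ∑ 𝕊 (λ X → ⌞ empty X ⌟ * avoiding j s X) ≡⟨ ∑-empty n (avoiding j s) ⟩
          avoiding j s ∅ ∎
        split (suc i) j = trans (shift i j) (trans (split i (suc j)) (cong (λ k → avoiding k s ∅) (+-suc i j)))

  -- Zeta transform and inclusion-exclusion.

  disjointPairs : (φ ψ : Subset n → ℕ) → ℕ
  disjointPairs {n} φ ψ = ∑ (subsets n) λ X → φ X * ∑ (subsets n) λ Y → ⌞ disjoint X Y ⌟ * ψ Y

  -- A single coordinate of the superset transform. Treating the coordinates one after the other
  -- (Yates's algorithm) takes n passes instead of a sum over all supersets.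
  fold₁ : Fin n → (Subset n → ℕ) → Subset n → ℕ
  fold₁ i φ X = φ X + ⌞ not (lookup X i) ⌟ * φ (insert i X)

  -- ζ (allFin n) φ X = ∑ of φ over the supersets of X.
  ζ : List (Fin n) → (Subset n → ℕ) → Subset n → ℕ
  ζ []       φ = φ
  ζ (i ∷ is) φ = ζ is (fold₁ i φ)

  ζ-cong : ∀ is {φ ψ : Subset n → ℕ} → (∀ X → φ X ≡ ψ X) → ∀ X → ζ is φ X ≡ ζ is ψ X
  ζ-cong []       p X = p X
  ζ-cong (i ∷ is) p X = ζ-cong is (λ Y → cong₂ (λ a b → a + ⌞ not (lookup Y i) ⌟ * b) (p Y) (p (insert i Y))) X

  ζ-++ : ∀ is js (φ : Subset n → ℕ) X → ζ (is ++ js) φ X ≡ ζ js (ζ is φ) X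
  ζ-++ []       js φ X = refl
  ζ-++ (i ∷ is) js φ X = ζ-++ is js (fold₁ i φ) X

  ζ-suc : ∀ is b (φ : Subset (suc n) → ℕ) X → ζ (map suc is) φ (b ∷ X) ≡ ζ is (φ ∘ (b ∷_)) X
  ζ-suc []       b φ X = refl
  ζ-suc (i ∷ is) b φ X = ζ-suc is b (fold₁ (suc i) φ) X

  -- Supersets of a large set are large. This is what permits the program to store small sets only.
  ζ-vanish : ∀ is {φ : Subset n → ℕ} {K} → (∀ X → K < card X → φ X ≡ 0) → ∀ X → K < card X → ζ is φ X ≡ 0
  ζ-vanish []       p X q = p X q
  ζ-vanish (i ∷ is) {φ} p = ζ-vanish is λ X q → cong₂ _+_ (p X q)
    (trans (cong (⌞ not (lookup X i) ⌟ *_) (p (insert i X) (<-≤-trans q (card-insert i X)))) (*-zeroʳ ⌞ not (lookup X i) ⌟))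

  ζ-≤ : ∀ is {φ : Subset n → ℕ} {b} → (∀ X → φ X ≤ b) → ∀ X → ζ is φ X ≤ 2 ^ length is * b
  ζ-≤ []       {b = b} p X = ≤-trans (p X) (≤-reflexive (sym (*-identityˡ b)))
  ζ-≤ (i ∷ is) {φ} {b} p X = ≤-trans (ζ-≤ is (λ Y → +-mono-≤ (p Y) (≤-trans (⌞⌟*-≤ (not (lookup Y i)) (φ (insert i Y))) (p (insert i Y)))) X)
    (≤-reflexive (double (2 ^ length is) b))
    where
    double : ∀ a b → a * (b + b) ≡ 2 * a * b
    double = solve-∀

  sameParity : Bool → Subset n → ℕ
  sameParity p X = ⌞ not (p xor odd X) ⌟

  paritySum : Bool → (φ ψ : Subset n → ℕ) → ℕ
  paritySum {n} p φ ψ = ∑ (subsets n) λ X → sameParity p X * (ζ (allFin n) φ X * ζ (allFin n) ψ X)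

  private
    merge : (Subset (suc n) → ℕ) → Subset n → ℕ
    merge φ X = φ (false ∷ X) + φ (true ∷ X)

    ζ-false : ∀ (φ : Subset (suc n) → ℕ) X → ζ (allFin (suc n)) φ (false ∷ X) ≡ ζ (allFin n) (merge φ) X
    ζ-false {n} φ X = begin
      ζ (tabulate suc) (fold₁ zero φ) (false ∷ X) ≡⟨ cong (λ is → ζ is (fold₁ zero φ) (false ∷ X)) (map-tabulate id suc) ⟨
      ζ (map suc (allFin n)) (fold₁ zero φ) (false ∷ X) ≡⟨ ζ-suc (allFin n) false (fold₁ zero φ) X ⟩
      ζ (allFin n) (fold₁ zero φ ∘ (false ∷_)) X ≡⟨ ζ-cong (allFin n) (λ Y → cong (φ (false ∷ Y) +_) (*-identityˡ _)) X ⟩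
      ζ (allFin n) (merge φ) X ∎

    ζ-true : ∀ (φ : Subset (suc n) → ℕ) X → ζ (allFin (suc n)) φ (true ∷ X) ≡ ζ (allFin n) (φ ∘ (true ∷_)) X
    ζ-true {n} φ X = begin
      ζ (tabulate suc) (fold₁ zero φ) (true ∷ X) ≡⟨ cong (λ is → ζ is (fold₁ zero φ) (true ∷ X)) (map-tabulate id suc) ⟨
      ζ (map suc (allFin n)) (fold₁ zero φ) (true ∷ X) ≡⟨ ζ-suc (allFin n) true (fold₁ zero φ) X ⟩
      ζ (allFin n) (fold₁ zero φ ∘ (true ∷_)) X ≡⟨ ζ-cong (allFin n) (λ Y → +-identityʳ _) X ⟩
      ζ (allFin n) (φ ∘ (true ∷_)) X ∎

    -- If the first element is missing from X, a superset may or may not contain it, which merges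
    -- the two halves of φ; if it is present, it lies in every superset and flips the parity.
    paritySum-suc : ∀ p (φ ψ : Subset (suc n) → ℕ) →
      paritySum p φ ψ ≡ paritySum p (merge φ) (merge ψ) + paritySum (not p) (φ ∘ (true ∷_)) (ψ ∘ (true ∷_))
    paritySum-suc {n} p φ ψ = trans (∑-subsets-suc n (λ X → sameParity p X * (ζ (allFin (suc n)) φ X * ζ (allFin (suc n)) ψ X)))
      (cong₂ _+_ (∑-cong (subsets n) λ X → cong (sameParity p X *_) (cong₂ _*_ (ζ-false φ X) (ζ-false ψ X)))
                 (∑-cong (subsets n) λ X → cong₂ _*_ (flip p (odd X)) (cong₂ _*_ (ζ-true φ X) (ζ-true ψ X))))
      where
      flip : ∀ p q → ⌞ not (p xor not q) ⌟ ≡ ⌞ not (not p xor q) ⌟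
      flip false q = refl
      flip true false = refl
      flip true true = refl

    -- After merging, the first element may lie in both sets; the last summand counts these surplus
    -- pairs.
    disjointPairs-suc : ∀ (φ ψ : Subset (suc n) → ℕ) →
      disjointPairs (merge φ) (merge ψ) ≡ disjointPairs φ ψ + disjointPairs (φ ∘ (true ∷_)) (ψ ∘ (true ∷_))
    disjointPairs-suc {n} φ ψ = begin
      ∑ 𝕊 (λ X → (φ₀ X + φ₁ X) * ∑ 𝕊 (λ Y → ⌞ disjoint X Y ⌟ * (ψ₀ Y + ψ₁ Y)))
        ≡⟨ ∑-cong 𝕊 (λ X → trans (cong ((φ₀ X + φ₁ X) *_) (trans (∑-cong 𝕊 λ Y → *-distribˡ-+ ⌞ disjoint X Y ⌟ (ψ₀ Y) (ψ₁ Y)) (∑-+ 𝕊 _ _)))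
             (expand (φ₀ X) (φ₁ X) (D X ψ₀) (D X ψ₁))) ⟩
      ∑ 𝕊 (λ X → φ₀ X * (D X ψ₀ + D X ψ₁) + φ₁ X * D X ψ₀ + φ₁ X * D X ψ₁)
        ≡⟨ trans (∑-+ 𝕊 _ _) (cong (_+ ∑ 𝕊 (λ X → φ₁ X * D X ψ₁)) (∑-+ 𝕊 _ _)) ⟩
      ∑ 𝕊 (λ X → φ₀ X * (D X ψ₀ + D X ψ₁)) + ∑ 𝕊 (λ X → φ₁ X * D X ψ₀) + ∑ 𝕊 (λ X → φ₁ X * D X ψ₁)
        ≡⟨ cong (_+ ∑ 𝕊 (λ X → φ₁ X * D X ψ₁)) (trans (∑-subsets-suc n (λ X → φ X * ∑ (subsets (suc n)) (λ Y → ⌞ disjoint X Y ⌟ * ψ Y)))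
             (cong₂ _+_ (∑-cong 𝕊 λ X → cong (φ₀ X *_) (∑-subsets-suc n (λ Y → ⌞ disjoint (false ∷ X) Y ⌟ * ψ Y)))
                        (∑-cong 𝕊 λ X → cong (φ₁ X *_) (trans (∑-subsets-suc n (λ Y → ⌞ disjoint (true ∷ X) Y ⌟ * ψ Y))
                          (trans (cong (D X ψ₀ +_) (∑-zero 𝕊 (λ _ → refl))) (+-identityʳ _)))))) ⟨
      disjointPairs φ ψ + disjointPairs φ₁ ψ₁ ∎
      where
      𝕊 = subsets n
      φ₀ = φ ∘ (false ∷_)
      φ₁ = φ ∘ (true ∷_)
      ψ₀ = ψ ∘ (false ∷_)
      ψ₁ = ψ ∘ (true ∷_)
      D : Subset n → (Subset n → ℕ) → ℕ
      D X θ = ∑ 𝕊 (λ Y → ⌞ disjoint X Y ⌟ * θ Y)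
      expand : ∀ a b c d → (a + b) * (c + d) ≡ a * (c + d) + b * c + b * d
      expand = solve-∀

  -- The alternating sum with its negative part moved to the other side. A pair (Y, Z) is counted
  -- once for every X inside both, and the signs cancel unless Y and Z are disjoint; the induction
  -- performs this cancellation one element at a time.
  inclusion-exclusion : ∀ (φ ψ : Subset n → ℕ) → paritySum false φ ψ ≡ paritySum true φ ψ + disjointPairs φ ψ
  inclusion-exclusion {zero} φ ψ = identity (φ []) (ψ [])
    where
    identity : ∀ a b → 1 * (a * b) + 0 ≡ 0 + (a * (1 * b + 0) + 0)
    identity = solve-∀
  inclusion-exclusion {suc n} φ ψ = begin
    paritySum false φ ψ ≡⟨ paritySum-suc false φ ψ ⟩
    paritySum false (merge φ) (merge ψ) + t₁ ≡⟨ cong (_+ t₁) (inclusion-exclusion (merge φ) (merge ψ)) ⟩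
    o + disjointPairs (merge φ) (merge ψ) + t₁ ≡⟨ cong (λ z → o + z + t₁) (disjointPairs-suc φ ψ) ⟩
    o + (disjointPairs φ ψ + d₁) + t₁ ≡⟨ shuffle o (disjointPairs φ ψ) d₁ t₁ ⟩
    o + (t₁ + d₁) + disjointPairs φ ψ ≡⟨ cong (λ z → o + z + disjointPairs φ ψ) (inclusion-exclusion φ₁ ψ₁) ⟨
    o + paritySum false φ₁ ψ₁ + disjointPairs φ ψ ≡⟨ cong (_+ disjointPairs φ ψ) (paritySum-suc true φ ψ) ⟨
    paritySum true φ ψ + disjointPairs φ ψ ∎
    where
    φ₁ = φ ∘ (true ∷_)
    ψ₁ = ψ ∘ (true ∷_)
    o = paritySum true (merge φ) (merge ψ)
    t₁ = paritySum true φ₁ ψ₁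
    d₁ = disjointPairs φ₁ ψ₁
    shuffle : ∀ o d e t → o + (d + e) + t ≡ o + (t + e) + d
    shuffle = solve-∀

-- Digits of a generating function, and the enumeration of paths.

module Paths where
  open import Defs
  open Combinatorics
  open import Data.Bool using (Bool; true; false; not; _∧_; _∨_; if_then_else_)
  open import Data.Fin using (Fin; zero; suc)
  open import Data.List as List using (List; []; _∷_; length; map; concatMap; allFin; filter)
  open import Data.List.Membership.Propositional using (_∈_)
  open import Data.List.Membership.Propositional.Properties
  open import Data.List.Properties using (length-map; length-tabulate; length-filter; filter-accept; filter-reject)
  import Data.List.Relation.Unary.All as All
  import Data.List.Relation.Unary.All.Properties as Allₚ
  open import Data.List.Relation.Unary.AllPairs as AllPairs using ([]; _∷_)
  import Data.List.Relation.Unary.AllPairs.Properties as AllPairsₚ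
  open import Data.List.Relation.Unary.Any using (here)
  open import Data.List.Relation.Unary.Unique.Propositional using (Unique)
  import Data.List.Relation.Unary.Unique.Propositional.Properties as Uniqueₚ
  open import Data.Nat
  open import Data.Nat.Divisibility using (m∣m*n)
  open import Data.Nat.DivMod
  open import Data.Nat.Properties
  open import Data.Nat.Tactic.RingSolver using (solve-∀)
  open import Data.Product using (_×_; _,_; proj₁; proj₂; ∃-syntax)
  open import Data.Vec as Vec using (Vec; []; _∷_; lookup)
  open import Data.Vec.Properties using (lookup-replicate)
  import Data.Vec.Relation.Unary.All as VecAll
  import Data.Vec.Relation.Unary.AllPairs as VecAllPairs
  open import Function using (_∘_; id)
  open import Function.Bundles using (_⇔_; mk⇔)
  open import Relation.Binary.Definitions using (tri<; tri≈; tri>)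
  open import Relation.Binary.PropositionalEquality
  open import Relation.Nullary using (contradiction)

  private variable
    A B : Set

  module _ (t : A → ℕ) (b k : ℕ) .{{_ : NonZero b}} where

    private
      count : List A → ℕ
      count xs = length (filter (λ x → t x ≟ k) xs)

      count-≡ : ∀ {x} xs → t x ≡ k → count (x ∷ xs) ≡ suc (count xs)
      count-≡ xs p = cong length (filter-accept (λ x → t x ≟ k) p)

      count-≢ : ∀ {x} xs → t x ≢ k → count (x ∷ xs) ≡ count xs
      count-≢ xs p = cong length (filter-reject (λ x → t x ≟ k) p)

    -- `lo` collects the terms with exponent below k, `hi` those above. A term of `lo` is at most
    -- b^(k-1); the multiplied form of the bound also makes sense for k = 0.
    digit-decomposition : ∀ xs → ∃[ lo ] ∃[ hi ]
      (∑ xs (λ x → b ^ t x) ≡ lo + b ^ k * (count xs + b * hi) × lo * b ≤ length xs * b ^ k)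
    digit-decomposition [] = 0 , 0 , sym (trans (cong (b ^ k *_) (*-zeroʳ b)) (*-zeroʳ (b ^ k))) , z≤n
    digit-decomposition (x ∷ xs) with digit-decomposition xs | <-cmp (t x) k
    ... | lo , hi , eq , le | tri≈ _ ≡k _ = lo , hi ,
      trans (cong₂ _+_ (cong (b ^_) ≡k) eq) (trans (shuffle (b ^ k) lo (count xs + b * hi)) (cong (λ c → lo + b ^ k * (c + b * hi)) (sym (count-≡ xs ≡k)))) ,
      ≤-trans le (m≤n+m _ _)
      where
      shuffle : ∀ p l y → p + (l + p * y) ≡ l + p * suc y
      shuffle = solve-∀
    ... | lo , hi , eq , le | tri< <k ≢k _ = b ^ t x + lo , hi ,
      trans (cong (b ^ t x +_) eq) (trans (sym (+-assoc (b ^ t x) lo _)) (cong (λ c → b ^ t x + lo + b ^ k * (c + b * hi)) (sym (count-≢ xs ≢k)))) ,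
      (begin
        (b ^ t x + lo) * b          ≡⟨ *-distribʳ-+ b (b ^ t x) lo ⟩
        b ^ t x * b + lo * b        ≤⟨ +-mono-≤ (≤-trans (≤-reflexive (*-comm (b ^ t x) b)) (^-monoʳ-≤ b <k)) le ⟩
        b ^ k + length xs * b ^ k   ∎)
      where open ≤-Reasoning
    ... | lo , hi , eq , le | tri> _ ≢k >k = lo , b ^ (t x ∸ suc k) + hi ,
      trans (cong₂ _+_ power eq) (trans (shuffle (b ^ k) b _ lo (count xs) hi) (cong (λ c → lo + b ^ k * (c + b * (b ^ (t x ∸ suc k) + hi))) (sym (count-≢ xs ≢k)))) ,
      ≤-trans le (m≤n+m _ _)
      where
      power : b ^ t x ≡ b ^ k * (b * b ^ (t x ∸ suc k))
      power = trans (cong (b ^_) (sym (trans (+-suc k (t x ∸ suc k)) (m+[n∸m]≡n >k)))) (^-distribˡ-+-* b k (suc (t x ∸ suc k)))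
      shuffle : ∀ p b q l c h → p * (b * q) + (l + p * (c + b * h)) ≡ l + p * (c + b * (q + h))
      shuffle = solve-∀

    -- No carries occur, because every digit is a count and the whole list is shorter than b.
    digit : ∀ xs → length xs < b → (∑ xs (λ x → b ^ t x) / b ^ k) {{m^n≢0 b k}} % b ≡ count xs
    digit xs len< with digit-decomposition xs
    ... | lo , hi , eq , le = begin
      ∑ xs (λ x → b ^ t x) / b ^ k % b            ≡⟨ cong (λ z → z / b ^ k % b) eq ⟩
      (lo + b ^ k * y) / b ^ k % b                ≡⟨ cong (_% b) (+-distrib-/-∣ʳ lo {b ^ k * y} {b ^ k} (m∣m*n y)) ⟩
      (lo / b ^ k + b ^ k * y / b ^ k) % b        ≡⟨ cong₂ (λ u v → (u + v) % b) (m<n⇒m/n≡0 lo<) (trans (cong (_/ b ^ k) (*-comm (b ^ k) y)) (m*n/n≡m y (b ^ k))) ⟩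
      (count xs + b * hi) % b                     ≡⟨ cong (λ z → (count xs + z) % b) (*-comm b hi) ⟩
      (count xs + hi * b) % b                     ≡⟨ [m+kn]%n≡m%n (count xs) hi b ⟩
      count xs % b                                ≡⟨ m<n⇒m%n≡m (≤-<-trans (length-filter (λ x → t x ≟ k) xs) len<) ⟩
      count xs                                    ∎
      where
      open ≡-Reasoning
      instance
        b^k≢0 : NonZero (b ^ k)
        b^k≢0 = m^n≢0 b k
      y = count xs + b * hi
      lo< : lo < b ^ k
      lo< = *-cancelʳ-< b lo (b ^ k) (≤-<-trans le (<-≤-trans (*-monoˡ-< (b ^ k) len<) (≤-reflexive (*-comm b (b ^ k)))))

  unique-concatMap : ∀ {f : A → List B} {xs} → Unique xs → (∀ x → Unique (f x)) →
    (∀ {x y z} → z ∈ f x → z ∈ f y → x ≡ y) → Unique (concatMap f xs)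
  unique-concatMap {xs = xs} u uf inj = Uniqueₚ.concat⁺ (Allₚ.map⁺ (All.universal uf xs))
    (AllPairsₚ.map⁺ (AllPairs.map (λ x≢y {_} (p , q) → x≢y (inj p q)) u))

  last-∷ : ∀ {n} (x : A) (xs : Vec A (suc n)) → Vec.last (x ∷ xs) ≡ Vec.last xs
  last-∷ x xs with Vec.initLast xs
  ... | _ , _ , refl = refl

  module Enumeration {n} (D : Digraph n) (w : Weighting D) (t : Fin n) where

    Avoids : ∀ {k} → Subset n → Vec (Fin n) k → Set
    Avoids X = VecAll.All (λ v → lookup X v ≡ false)

    cons : ∀ {ℓ} → Fin n → Edge D → Walk D ℓ → Walk D (suc ℓ)
    cons u e (vs , es) = u ∷ vs , e ∷ es

    admissible : Fin n → Subset n → Edge D → Bool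
    admissible u X e = (start D e == u) ∧ not (lookup (insert u X) (end D e))

    -- Follows the recursion of `avoiding` with lists in place of numbers. It witnesses the
    -- cardinality and carries the generating function.
    paths : ∀ ℓ → Fin n → Subset n → List (Walk D ℓ)
    extensions : ∀ ℓ → Fin n → Subset n → Edge D → List (Walk D (suc ℓ))

    paths zero    u X = if u == t then (u ∷ [] , []) ∷ [] else []
    paths (suc ℓ) u X = concatMap (extensions ℓ u X) (allFin (size D))

    extensions ℓ u X e = if admissible u X e then map (cons u e) (paths ℓ (end D e) (insert u X)) else []

    module _ (b : ℕ) where
      open Half {n} (λ e → b ^ w e)

      ∑-paths : ∀ ℓ u X → ∑ (paths ℓ u X) (λ π → b ^ totalWeight D w π) ≡ avoiding (start D) (end D) t ℓ u X
      ∑-paths zero u X with u == t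
      ... | true  = refl
      ... | false = refl
      ∑-paths (suc ℓ) u X = trans (∑-concatMap (allFin (size D)) (extensions ℓ u X) _) (∑-cong (allFin (size D)) edge)
        where
        edge : ∀ e → ∑ (extensions ℓ u X e) (λ π → b ^ totalWeight D w π)
          ≡ ⌞ start D e == u ⌟ * (⌞ not (lookup (insert u X) (end D e)) ⌟ * (b ^ w e * avoiding (start D) (end D) t ℓ (end D e) (insert u X)))
        edge e with start D e == u
        ... | false = refl
        ... | true with lookup (insert u X) (end D e)
        ...   | true  = refl
        ...   | false = trans (∑-map (paths ℓ (end D e) (insert u X)) (cons u e) _)
          (trans (trans (∑-cong (paths ℓ (end D e) (insert u X)) λ π → ^-distribˡ-+-* b (w e) (totalWeight D w π))
                   (∑-*ˡ (paths ℓ (end D e) (insert u X)) (b ^ w e) _))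
            (trans (cong (b ^ w e *_) (∑-paths ℓ (end D e) (insert u X))) (sym (trans (*-identityˡ _) (*-identityˡ _)))))

    length-paths : ∀ ℓ u X → length (paths ℓ u X) ≤ size D ^ ℓ
    length-paths zero u X with u == t
    ... | true  = ≤-refl
    ... | false = z≤n
    length-paths (suc ℓ) u X = begin
      length (paths (suc ℓ) u X)    ≡⟨ length-∑ (paths (suc ℓ) u X) ⟩
      ∑ (paths (suc ℓ) u X) (λ _ → 1) ≡⟨ ∑-concatMap (allFin (size D)) (extensions ℓ u X) _ ⟩
      ∑ (allFin (size D)) (λ e → ∑ (extensions ℓ u X e) (λ _ → 1)) ≤⟨ ∑-const-≤ (allFin (size D)) edge ⟩
      length (allFin (size D)) * size D ^ ℓ ≡⟨ cong (_* size D ^ ℓ) (length-tabulate {n = size D} id) ⟩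
      size D * size D ^ ℓ ∎
      where
      open ≤-Reasoning
      edge : ∀ e → ∑ (extensions ℓ u X e) (λ _ → 1) ≤ size D ^ ℓ
      edge e with admissible u X e
      ... | false = z≤n
      ... | true  = ≤-trans (≤-reflexive (trans (sym (length-∑ (map (cons u e) (paths ℓ (end D e) (insert u X))))) (length-map (cons u e) (paths ℓ (end D e) (insert u X)))))
        (length-paths ℓ (end D e) (insert u X))

    cons-injective : ∀ {ℓ u e} {π ρ : Walk D ℓ} → cons u e π ≡ cons u e ρ → π ≡ ρ
    cons-injective refl = refl

    ∈-extensions : ∀ {ℓ u X e π} → π ∈ extensions ℓ u X e → admissible u X e ≡ true × ∃[ ρ ] (ρ ∈ paths ℓ (end D e) (insert u X) × π ≡ cons u e ρ)
    ∈-extensions {u = u} {X} {e} p with admissible u X e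
    ... | true = refl , ∈-map⁻ (cons u e) p

    unique-paths : ∀ ℓ u X → Unique (paths ℓ u X)
    unique-paths zero u X with u == t
    ... | true  = All.[] ∷ []
    ... | false = []
    unique-paths (suc ℓ) u X = unique-concatMap (Uniqueₚ.allFin⁺ (size D)) unique same-edge
      where
      unique : ∀ e → Unique (extensions ℓ u X e)
      unique e with admissible u X e
      ... | true  = Uniqueₚ.map⁺ cons-injective (unique-paths ℓ (end D e) (insert u X))
      ... | false = []
      same-edge : ∀ {e f π} → π ∈ extensions ℓ u X e → π ∈ extensions ℓ u X f → e ≡ f
      same-edge p q with ∈-extensions {ℓ} {u} {X} p | ∈-extensions {ℓ} {u} {X} q
      ... | _ , _ , _ , refl | _ , _ , _ , eq = cong (Vec.head ∘ proj₂) eq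

    ∧-true : ∀ {a b} → a ∧ b ≡ true → a ≡ true × b ≡ true
    ∧-true {true} {true} _ = refl , refl

    not-true : ∀ {a} → not a ≡ true → a ≡ false
    not-true {false} _ = refl

    avoids-insert⁻ : ∀ u X {k} {vs : Vec (Fin n) k} → Avoids (insert u X) vs → Avoids X vs × VecAll.All (u ≢_) vs
    avoids-insert⁻ u X VecAll.[] = VecAll.[] , VecAll.[]
    avoids-insert⁻ u X (VecAll._∷_ {x = v} p ps) with lookup-insert u v X | avoids-insert⁻ u X ps
    ... | eq | qs , rs with u == v in u==v
    ...   | true  with () ← trans (sym p) eq
    ...   | false = trans (sym eq) p VecAll.∷ qs , (λ { refl → contradiction (trans (sym u==v) (==-refl u)) λ () }) VecAll.∷ rs

    avoids-insert⁺ : ∀ u X {k} {vs : Vec (Fin n) k} → Avoids X vs → VecAll.All (u ≢_) vs → Avoids (insert u X) vs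
    avoids-insert⁺ u X VecAll.[] VecAll.[] = VecAll.[]
    avoids-insert⁺ u X (VecAll._∷_ {x = v} p ps) (q VecAll.∷ qs) = trans (lookup-insert u v X) head VecAll.∷ avoids-insert⁺ u X ps qs
      where
      head : (u == v) ∨ lookup X v ≡ false
      head with u == v in eq
      ... | true  = contradiction (==-sound u v eq) q
      ... | false = p

    open IsPath

    -- Membership in X is tested when a vertex is entered, so the avoidance concerns the vertices
    -- after u.
    ∈-paths⁻ : ∀ ℓ u X {π} → π ∈ paths ℓ u X → IsPath D u t π × Avoids X (Vec.tail (proj₁ π))
    ∈-paths⁻ zero u X p with u == t in eq
    ∈-paths⁻ zero u X (here refl) | true = record
      { source = refl ; target = ==-sound u t eq ; distinct = VecAll.[] VecAllPairs.∷ VecAllPairs.[]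
      ; starts = λ () ; ends = λ () } , VecAll.[]
    ∈-paths⁻ (suc ℓ) u X p with ∈-concat⁻′ (map (extensions ℓ u X) (allFin (size D))) p
    ... | _ , π∈ , xs∈ with ∈-map⁻ (extensions ℓ u X) xs∈
    ...   | e , _ , refl with ∈-extensions {ℓ} {u} {X} π∈
    ...     | adm , (v ∷ vs , es) , ρ∈ , refl with ∧-true adm | ∈-paths⁻ ℓ (end D e) (insert u X) ρ∈
    ...       | start≡ , end∉ | ρ , avoids = record
      { source   = refl
      ; target   = trans (last-∷ u (v ∷ vs)) (target ρ)
      ; distinct = proj₂ split VecAllPairs.∷ distinct ρ
      ; starts   = λ { zero → ==-sound (start D e) u start≡ ; (suc i) → starts ρ i }
      ; ends     = λ { zero → sym (source ρ) ; (suc i) → ends ρ i } } , proj₁ split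
      where
      split : Avoids X (v ∷ vs) × VecAll.All (u ≢_) (v ∷ vs)
      split = avoids-insert⁻ u X (subst (λ z → lookup (insert u X) z ≡ false) (sym (source ρ)) (not-true end∉) VecAll.∷ avoids)

    ∈-paths⁺ : ∀ ℓ u X {π} → IsPath D u t π → Avoids X (Vec.tail (proj₁ π)) → π ∈ paths ℓ u X
    ∈-paths⁺ zero u X {v ∷ [] , []} ρ _ with source ρ
    ... | refl with target ρ
    ...   | refl rewrite ==-refl u = here refl
    ∈-paths⁺ (suc ℓ) u X {v ∷ v′ ∷ vs , e ∷ es} ρ avoids with source ρ
    ... | refl = ∈-concat⁺′ member (∈-map⁺ (extensions ℓ u X) (∈-allFin e))
      where
      avoids′ : Avoids (insert u X) (v′ ∷ vs)
      avoids′ = avoids-insert⁺ u X avoids (VecAllPairs.head (distinct ρ))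
      end≡ : end D e ≡ v′
      end≡ = ends ρ zero
      tail : IsPath D (end D e) t (v′ ∷ vs , es)
      tail = record
        { source   = sym end≡
        ; target   = trans (sym (last-∷ u (v′ ∷ vs))) (target ρ)
        ; distinct = VecAllPairs.tail (distinct ρ)
        ; starts   = λ i → starts ρ (suc i)
        ; ends     = λ i → ends ρ (suc i) }
      adm : admissible u X e ≡ true
      adm = cong₂ (λ a b → a ∧ not b) (trans (cong (_== u) (starts ρ zero)) (==-refl u))
        (trans (cong (lookup (insert u X)) end≡) (VecAll.head avoids′))
      member : (u ∷ v′ ∷ vs , e ∷ es) ∈ extensions ℓ u X e
      member rewrite adm = ∈-map⁺ (cons u e) (∈-paths⁺ ℓ (end D e) (insert u X) tail (VecAll.tail avoids′))

    avoids-∅ : ∀ {k} (vs : Vec (Fin n) k) → Avoids ∅ vs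
    avoids-∅ vs = VecAll.universal (λ v → lookup-replicate v false) vs

    cardinality : ∀ s ℓ k → (λ π → IsPath D s t π × totalWeight D w π ≡ k) HasCardinality
      length (filter (λ π → totalWeight D w π ≟ k) (paths ℓ s ∅))
    cardinality s ℓ k = filter weight? (paths ℓ s ∅) , Uniqueₚ.filter⁺ weight? (unique-paths ℓ s ∅) , equiv , refl
      where
      weight? = λ (π : Walk D ℓ) → totalWeight D w π ≟ k
      equiv : ∀ π → π ∈ filter weight? (paths ℓ s ∅) ⇔ (IsPath D s t π × totalWeight D w π ≡ k)
      equiv π = mk⇔
        (λ p → let π∈ , eq = ∈-filter⁻ weight? {xs = paths ℓ s ∅} p in proj₁ (∈-paths⁻ ℓ s ∅ π∈) , eq)
        (λ (ρ , eq) → ∈-filter⁺ weight? (∈-paths⁺ ℓ s ∅ ρ (avoids-∅ _)) eq)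

-- Bit masks and the list of small sets.

module Masks where
  open Combinatorics
  open import Defs using (contents)
  open import Data.Bool using (Bool; true; false; if_then_else_)
  open import Data.Bool.Properties using (T-≡)
  open import Data.Fin using (Fin; zero; suc; toℕ)
  open import Data.List as List using (List; []; _∷_; _++_; [_]; length; map; filterᵇ; tabulate)
  open import Data.List.Membership.Propositional using (_∈_)
  open import Data.List.Membership.Propositional.Properties
  open import Data.List.Properties using (length-++; length-map)
  open import Data.List.Relation.Unary.All as All using (All; []; _∷_)
  import Data.List.Relation.Unary.All.Properties as Allₚ
  open import Data.List.Relation.Unary.AllPairs as AllPairs using (AllPairs; []; _∷_)
  import Data.List.Relation.Unary.AllPairs.Properties as AllPairsₚ
  open import Data.List.Relation.Unary.Any using (here; there)
  open import Data.Nat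
  open import Data.Nat.Divisibility using (m∣m*n)
  open import Data.Nat.DivMod
  open import Data.Nat.Properties
  open import Data.Nat.Tactic.RingSolver using (solve-∀)
  open import Data.Product using (_×_; _,_)
  open import Data.Vec using ([]; _∷_; lookup)
  open import Function using (_∘_)
  open import Function.Bundles using (Equivalence)
  open import Relation.Binary.PropositionalEquality hiding ([_])
  open import Relation.Nullary using (yes; no; contradiction)

  private variable
    A : Set
    n : ℕ

  -- The head is the most significant bit: putting a further vertex in front leaves the masks of old
  -- sets unchanged, and all sets containing it come after them.
  mask : Subset n → ℕ
  mask []                = 0
  mask {suc n} (b ∷ X)   = ⌞ b ⌟ * 2 ^ n + mask X

  place : Fin n → ℕ
  place {n} u = n ∸ 1 ∸ toℕ u

  place-suc : ∀ (u : Fin n) → place (suc u) ≡ place u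
  place-suc {n} u = sym (∸-+-assoc n 1 (toℕ u))

  mask-< : ∀ (X : Subset n) → mask X < 2 ^ n
  mask-< []              = s≤s z≤n
  mask-< {suc n} (b ∷ X) = +-mono-≤-< (⌞⌟*-≤ b (2 ^ n)) (<-≤-trans (mask-< X) (m≤m+n _ 0))

  mask-quotient : ∀ b (X : Subset n) → (mask (b ∷ X) / 2 ^ n) {{m^n≢0 2 n}} ≡ ⌞ b ⌟
  mask-quotient {n} b X = trans (cong (_/ 2 ^ n) (+-comm (⌞ b ⌟ * 2 ^ n) (mask X)))
    (trans (+-distrib-/-∣ʳ (mask X) {⌞ b ⌟ * 2 ^ n} {2 ^ n} (subst (2 ^ n Data.Nat.Divisibility.∣_) (*-comm (2 ^ n) ⌞ b ⌟) (m∣m*n ⌞ b ⌟)))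
      (cong₂ _+_ (m<n⇒m/n≡0 (mask-< X)) (m*n/n≡m ⌞ b ⌟ (2 ^ n))))
    where
    instance
      2^n≢0 : NonZero (2 ^ n)
      2^n≢0 = m^n≢0 2 n

  ⌞⌟-injective : ∀ {a b} → ⌞ a ⌟ ≡ ⌞ b ⌟ → a ≡ b
  ⌞⌟-injective {false} {false} _ = refl
  ⌞⌟-injective {true}  {true}  _ = refl

  mask-injective : ∀ {X Y : Subset n} → mask X ≡ mask Y → X ≡ Y
  mask-injective {X = []}    {[]}    _ = refl
  mask-injective {suc n} {b ∷ X} {c ∷ Y} p with ⌞⌟-injective (trans (sym (mask-quotient b X)) (trans (cong (λ z → (z / 2 ^ n) {{m^n≢0 2 n}}) p) (mask-quotient c Y)))
  ... | refl = cong (b ∷_) (mask-injective (+-cancelˡ-≡ (⌞ b ⌟ * 2 ^ n) _ _ p))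

  mask-insert : ∀ (u : Fin n) X → lookup X u ≡ false → mask (insert u X) ≡ mask X + 2 ^ place u
  mask-insert {suc n} zero (false ∷ X) p = trans (cong (_+ mask X) (*-identityˡ (2 ^ n))) (+-comm (2 ^ n) (mask X))
  mask-insert {suc n} (suc u) (b ∷ X) p = trans (cong (⌞ b ⌟ * 2 ^ n +_) (mask-insert u X p))
    (trans (sym (+-assoc (⌞ b ⌟ * 2 ^ n) (mask X) _)) (cong (λ k → ⌞ b ⌟ * 2 ^ n + mask X + 2 ^ k) (sym (place-suc u))))

  mask-delete : ∀ (u : Fin n) X → lookup X u ≡ true → mask (delete u X) + 2 ^ place u ≡ mask X
  mask-delete {suc n} zero (true ∷ X) p = trans (+-comm (mask X) (2 ^ n)) (cong (_+ mask X) (sym (*-identityˡ (2 ^ n))))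
  mask-delete {suc n} (suc u) (b ∷ X) p = trans (+-assoc (⌞ b ⌟ * 2 ^ n) _ _)
    (cong (⌞ b ⌟ * 2 ^ n +_) (trans (cong (λ k → mask (delete u X) + 2 ^ k) (place-suc u)) (mask-delete u X p)))

  place-< : ∀ (u : Fin n) → place u < n
  place-< {suc n} u = s≤s (m∸n≤m n (toℕ u))

  -- In the recursive case the leading bit contributes a multiple of 2^(k+1), where k is the place
  -- of u, and so leaves the bit at k alone.
  mask-bit : ∀ (u : Fin n) X → (mask X / 2 ^ place u) {{m^n≢0 2 (place u)}} % 2 ≡ ⌞ lookup X u ⌟
  mask-bit {suc n} zero (b ∷ X) = trans (cong (_% 2) (mask-quotient b X)) (m<n⇒m%n≡m (s≤s (⌞⌟≤1 b)))
  mask-bit {suc n} (suc u) (b ∷ X) = begin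
    mask (b ∷ X) / 2 ^ place (suc u) % 2 ≡⟨ cong (_% 2) (/-congʳ {m = mask (b ∷ X)} (cong (2 ^_) (place-suc u))) ⟩
    (⌞ b ⌟ * 2 ^ n + mask X) / 2 ^ k % 2  ≡⟨ cong (λ z → (z + mask X) / 2 ^ k % 2) high ⟩
    (2 ^ k * (h * 2) + mask X) / 2 ^ k % 2 ≡⟨ cong (λ z → z / 2 ^ k % 2) (+-comm (2 ^ k * (h * 2)) (mask X)) ⟩
    (mask X + 2 ^ k * (h * 2)) / 2 ^ k % 2 ≡⟨ cong (_% 2) (+-distrib-/-∣ʳ (mask X) {2 ^ k * (h * 2)} {2 ^ k} (m∣m*n (h * 2))) ⟩
    (mask X / 2 ^ k + 2 ^ k * (h * 2) / 2 ^ k) % 2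
      ≡⟨ cong (λ z → (mask X / 2 ^ k + z) % 2) (trans (cong (_/ 2 ^ k) (*-comm (2 ^ k) (h * 2))) (m*n/n≡m (h * 2) (2 ^ k))) ⟩
    (mask X / 2 ^ k + h * 2) % 2 ≡⟨ [m+kn]%n≡m%n (mask X / 2 ^ k) h 2 ⟩
    mask X / 2 ^ k % 2 ≡⟨ mask-bit u X ⟩
    ⌞ lookup X u ⌟ ∎
    where
    open ≡-Reasoning
    k = place u
    d = n ∸ suc k
    h = ⌞ b ⌟ * 2 ^ d
    instance
      2^k≢0 : NonZero (2 ^ k)
      2^k≢0 = m^n≢0 2 k
      2^k′≢0 : NonZero (2 ^ place (suc u))
      2^k′≢0 = m^n≢0 2 (place (suc u))
    shuffle : ∀ b p q → b * (p * (2 * q)) ≡ p * (b * q * 2)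
    shuffle = solve-∀
    high : ⌞ b ⌟ * 2 ^ n ≡ 2 ^ k * (h * 2)
    high = trans (cong (λ z → ⌞ b ⌟ * 2 ^ z) (sym (trans (+-suc k d) (m+[n∸m]≡n (place-< u)))))
      (trans (cong (⌞ b ⌟ *_) (^-distribˡ-+-* 2 k (suc d))) (shuffle ⌞ b ⌟ (2 ^ k) (2 ^ d)))

  infix 4 _<ᴹ_
  _<ᴹ_ : Subset n → Subset n → Set
  X <ᴹ Y = mask X < mask Y

  delete-<ᴹ : ∀ (u : Fin n) X → lookup X u ≡ true → delete u X <ᴹ X
  delete-<ᴹ u X p = subst (mask (delete u X) <_) (mask-delete u X p) (m<m+n (mask (delete u X)) (m^n>0 2 (place u)))

  -- The sets of at most K elements, in increasing order of their masks.
  small : ℕ → ∀ n → List (Subset n)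
  small K zero    = [ [] ]
  small K (suc n) = map (false ∷_) (small K n) ++ map (true ∷_) (filterᵇ (λ X → card X <ᵇ K) (small K n))

  ∈-filterᵇ⁺ : ∀ (p : A → Bool) {x xs} → x ∈ xs → p x ≡ true → x ∈ filterᵇ p xs
  ∈-filterᵇ⁺ p {x} (here refl) q rewrite q = here refl
  ∈-filterᵇ⁺ p {x} {y ∷ xs} (there i) q with p y
  ... | true  = there (∈-filterᵇ⁺ p i q)
  ... | false = ∈-filterᵇ⁺ p i q

  <ᵇ-true : ∀ {m n} → m < n → (m <ᵇ n) ≡ true
  <ᵇ-true p = Equivalence.to T-≡ (<⇒<ᵇ p)

  true-<ᵇ : ∀ {m n} → (m <ᵇ n) ≡ true → m < n
  true-<ᵇ {m} {n} p = <ᵇ⇒< m n (Equivalence.from T-≡ p)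

  ∈-small : ∀ K (X : Subset n) → card X ≤ K → X ∈ small K n
  ∈-small K [] p = here refl
  ∈-small K (false ∷ X) p = ∈-++⁺ˡ (∈-map⁺ (false ∷_) (∈-small K X p))
  ∈-small {suc n} K (true ∷ X) p = ∈-++⁺ʳ (map (false ∷_) (small K n))
    (∈-map⁺ (true ∷_) (∈-filterᵇ⁺ (λ X → card X <ᵇ K) (∈-small K X (<⇒≤ p)) (<ᵇ-true p)))

  All-filterᵇ : ∀ (p : A → Bool) {P Q : A → Set} {xs} → (∀ {x} → P x → p x ≡ true → Q x) → All P xs → All Q (filterᵇ p xs)
  All-filterᵇ p f [] = []
  All-filterᵇ p f (_∷_ {x = x} q qs) with p x in eq
  ... | true  = f q eq ∷ All-filterᵇ p f qs
  ... | false = All-filterᵇ p f qs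

  small-card : ∀ K n → All (λ X → card X ≤ K) (small K n)
  small-card K zero    = z≤n ∷ []
  small-card K (suc n) = Allₚ.++⁺ (Allₚ.map⁺ (small-card K n))
    (Allₚ.map⁺ (All-filterᵇ (λ X → card X <ᵇ K) (λ _ → true-<ᵇ) (small-card K n)))

  AllPairs-filterᵇ : ∀ (p : A → Bool) {R : A → A → Set} {xs} → AllPairs R xs → AllPairs R (filterᵇ p xs)
  AllPairs-filterᵇ p [] = []
  AllPairs-filterᵇ p (_∷_ {x = x} q qs) with p x
  ... | true  = All-filterᵇ p (λ r _ → r) q ∷ AllPairs-filterᵇ p qs
  ... | false = AllPairs-filterᵇ p qs

  small-sorted : ∀ K n → AllPairs _<ᴹ_ (small K n)
  small-sorted K zero    = [] ∷ []
  small-sorted K (suc n) = AllPairsₚ.++⁺ (AllPairsₚ.map⁺ (small-sorted K n))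
    (AllPairsₚ.map⁺ (AllPairs.map (+-monoʳ-< (1 * 2 ^ n)) (AllPairs-filterᵇ _ (small-sorted K n))))
    (Allₚ.map⁺ (All.universal (λ X → Allₚ.map⁺ (All.universal (λ Y → <-≤-trans (mask-< X) (≤-trans (≤-reflexive (sym (*-identityˡ (2 ^ n)))) (m≤m+n (1 * 2 ^ n) (mask Y)))) _)) (small K n)))

  -- The equation of 0 and 1 serves as the empty type in the first two hypotheses.
  earlier : ∀ {R : A → A → Set} (irrefl : ∀ {x} → R x x → ℕ.zero ≡ 1) (asym : ∀ {x y} → R x y → R y x → 0 ≡ 1) xs {a ys} →
    AllPairs R (xs ++ a ∷ ys) → ∀ {b} → b ∈ xs ++ a ∷ ys → R b a → b ∈ xs
  earlier i s [] _ (here refl) r with () ← i r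
  earlier i s [] (p ∷ _) (there b∈) r with () ← s (All.lookup p b∈) r
  earlier i s (x ∷ xs) _ (here refl) r = here refl
  earlier i s (x ∷ xs) (_ ∷ ps) (there b∈) r = there (earlier i s xs ps b∈ r)

  -- Guarantees the dynamic program that the rows of smaller sets are complete when they are read.
  earlier-small : ∀ K n xs {X ys} → small K n ≡ xs ++ X ∷ ys → ∀ Y → card Y ≤ K → Y <ᴹ X → Y ∈ xs
  earlier-small K n xs eq Y p q = earlier {R = _<ᴹ_} (λ r → contradiction r (<-irrefl refl)) (λ r r′ → contradiction r′ (<-asym r)) xs
    (subst (AllPairs _<ᴹ_) eq (small-sorted K n)) (subst (Y ∈_) eq (∈-small K Y p)) q

  distinct-earlier : ∀ {R : A → A → Set} xs {a ys} → AllPairs R (xs ++ a ∷ ys) → ∀ {b} → b ∈ xs → R b a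
  distinct-earlier (x ∷ xs) (p ∷ _) (here refl) = All.lookup p (∈-++⁺ʳ xs (here refl))
  distinct-earlier (x ∷ xs) (_ ∷ ps) (there b∈) = distinct-earlier xs ps b∈

  earlier-≢ : ∀ K n xs {X ys} → small K n ≡ xs ++ X ∷ ys → ∀ {Y} → Y ∈ xs → Y ≢ X
  earlier-≢ K n xs eq Y∈ refl = <-irrefl refl (distinct-earlier xs (subst (AllPairs _<ᴹ_) eq (small-sorted K n)) Y∈)

  ∑-small : ∀ K n (h : Subset n → ℕ) → (∀ X → K < card X → h X ≡ 0) → ∑ (small K n) h ≡ ∑ (subsets n) h
  ∑-small K zero    h z = refl
  ∑-small K (suc n) h z = begin
    ∑ (map (false ∷_) s ++ map (true ∷_) (filterᵇ p s)) h ≡⟨ ∑-++ (map (false ∷_) s) _ h ⟩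
    ∑ (map (false ∷_) s) h + ∑ (map (true ∷_) (filterᵇ p s)) h ≡⟨ cong₂ _+_ (∑-map s (false ∷_) h) (∑-map (filterᵇ p s) (true ∷_) h) ⟩
    ∑ s (h ∘ (false ∷_)) + ∑ (filterᵇ p s) (h ∘ (true ∷_))
      ≡⟨ cong₂ _+_ (∑-small K n _ (λ X → z (false ∷ X)))
           (trans (∑-filterᵇ p s _ (λ X q → z (true ∷ X) (≮⇒≥′ q))) (∑-small K n _ (λ X q → z (true ∷ X) (m≤n⇒m≤1+n q)))) ⟩
    ∑ (subsets n) (h ∘ (false ∷_)) + ∑ (subsets n) (h ∘ (true ∷_)) ≡⟨ ∑-subsets-suc n h ⟨
    ∑ (subsets (suc n)) h ∎
    where
    open ≡-Reasoning
    s = small K n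
    p = λ X → card X <ᵇ K
    ≮⇒≥′ : ∀ {m} → (m <ᵇ K) ≡ false → K < suc m
    ≮⇒≥′ {m} q with m <? K
    ... | yes m<K with () ← trans (sym (<ᵇ-true m<K)) q
    ... | no m≮K = s≤s (≮⇒≥ m≮K)

  ∑-mono-All : ∀ {f g : A → ℕ} {xs} → All (λ x → f x ≤ g x) xs → ∑ xs f ≤ ∑ xs g
  ∑-mono-All []       = z≤n
  ∑-mono-All (p ∷ ps) = +-mono-≤ p (∑-mono-All ps)

  ∑-filterᵇ-≤ : ∀ (p : A → Bool) xs (f : A → ℕ) → ∑ (filterᵇ p xs) f ≤ ∑ xs f
  ∑-filterᵇ-≤ p []       f = z≤n
  ∑-filterᵇ-≤ p (x ∷ xs) f with p x
  ... | true  = +-monoʳ-≤ (f x) (∑-filterᵇ-≤ p xs f)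
  ... | false = ≤-trans (∑-filterᵇ-≤ p xs f) (m≤n+m _ (f x))

  ∑-small-≤ : ∀ K n (h : Subset n → ℕ) → ∑ (small K n) h ≤ ∑ (subsets n) h
  ∑-small-≤ K zero    h = ≤-refl
  ∑-small-≤ K (suc n) h = begin
    ∑ (map (false ∷_) s ++ map (true ∷_) (filterᵇ _ s)) h ≡⟨ ∑-++ (map (false ∷_) s) _ h ⟩
    ∑ (map (false ∷_) s) h + ∑ (map (true ∷_) (filterᵇ _ s)) h ≡⟨ cong₂ _+_ (∑-map s (false ∷_) h) (∑-map (filterᵇ _ s) (true ∷_) h) ⟩
    ∑ s (h ∘ (false ∷_)) + ∑ (filterᵇ _ s) (h ∘ (true ∷_))
      ≤⟨ +-mono-≤ (∑-small-≤ K n _) (≤-trans (∑-filterᵇ-≤ _ s _) (∑-small-≤ K n _)) ⟩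
    ∑ (subsets n) (h ∘ (false ∷_)) + ∑ (subsets n) (h ∘ (true ∷_)) ≡⟨ ∑-subsets-suc n h ⟨
    ∑ (subsets (suc n)) h ∎
    where
    open ≤-Reasoning
    s = small K n

  module _ (x y : ℕ) where

    card-≤ : ∀ (X : Subset n) → card X ≤ n
    card-≤ []      = z≤n
    card-≤ (b ∷ X) = +-mono-≤ (⌞⌟≤1 b) (card-≤ X)

    binomial : ∀ n → ∑ (subsets n) (λ X → x ^ card X * y ^ (n ∸ card X)) ≡ (x + y) ^ n
    binomial zero    = refl
    binomial (suc n) = begin
      _ ≡⟨ ∑-subsets-suc n (λ X → x ^ card X * y ^ (suc n ∸ card X)) ⟩
      ∑ (subsets n) (λ X → x ^ card X * y ^ (suc n ∸ card X)) + ∑ (subsets n) (λ X → x * x ^ card X * y ^ (n ∸ card X))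
        ≡⟨ cong₂ _+_
             (trans (∑-cong (subsets n) λ X → trans (cong (λ k → x ^ card X * y ^ k) (+-∸-assoc 1 (card-≤ X))) (shuffle (x ^ card X) y _)) (∑-*ˡ (subsets n) y _))
             (trans (∑-cong (subsets n) λ X → *-assoc x (x ^ card X) _) (∑-*ˡ (subsets n) x _)) ⟩
      y * ∑ (subsets n) (λ X → x ^ card X * y ^ (n ∸ card X)) + x * ∑ (subsets n) (λ X → x ^ card X * y ^ (n ∸ card X))
        ≡⟨ cong (λ z → y * z + x * z) (binomial n) ⟩
      y * (x + y) ^ n + x * (x + y) ^ n ≡⟨ factor x y _ ⟩
      (x + y) ^ suc n ∎
      where
      open ≡-Reasoning
      shuffle : ∀ a b c → a * (b * c) ≡ b * (a * c)
      shuffle = solve-∀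
      factor : ∀ x y z → y * z + x * z ≡ (x + y) * z
      factor = solve-∀

    -- As x ≤ y, the weight x^|X| y^(n-|X|) of a small set is least for |X| = K, and by the binomial
    -- theorem all weights together make (x + y)^n.
    length-small : x ≤ y → .{{_ : NonZero x}} → ∀ K n → K ≤ n → length (small K n) * (x ^ K * y ^ (n ∸ K)) ≤ (x + y) ^ n
    length-small x≤y K n K≤n = begin
      length (small K n) * w ≡⟨ ∑-const (small K n) ⟨
      ∑ (small K n) (λ _ → w) ≤⟨ ∑-mono-All (All.map (λ {X} p → weight p) (small-card K n)) ⟩
      ∑ (small K n) (λ X → x ^ card X * y ^ (n ∸ card X)) ≤⟨ ∑-small-≤ K n _ ⟩
      ∑ (subsets n) (λ X → x ^ card X * y ^ (n ∸ card X)) ≡⟨ binomial n ⟩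
      (x + y) ^ n ∎
      where
      open ≤-Reasoning
      w = x ^ K * y ^ (n ∸ K)
      ∑-const : ∀ (xs : List (Subset n)) → ∑ xs (λ _ → w) ≡ length xs * w
      ∑-const []       = refl
      ∑-const (_ ∷ xs) = cong (w +_) (∑-const xs)
      weight : ∀ {c} → c ≤ K → w ≤ x ^ c * y ^ (n ∸ c)
      weight {c} c≤K = begin
        x ^ K * y ^ (n ∸ K) ≡⟨ cong (λ k → x ^ k * y ^ (n ∸ K)) (m+[n∸m]≡n c≤K) ⟨
        x ^ (c + d) * y ^ (n ∸ K) ≡⟨ cong (_* y ^ (n ∸ K)) (^-distribˡ-+-* x c d) ⟩
        x ^ c * x ^ d * y ^ (n ∸ K) ≤⟨ *-monoˡ-≤ (y ^ (n ∸ K)) (*-monoʳ-≤ (x ^ c) (^-monoˡ-≤ d x≤y)) ⟩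
        x ^ c * y ^ d * y ^ (n ∸ K) ≡⟨ trans (*-assoc (x ^ c) (y ^ d) _) (cong (x ^ c *_) (sym (^-distribˡ-+-* y d (n ∸ K)))) ⟩
        x ^ c * y ^ (d + (n ∸ K)) ≡⟨ cong (λ k → x ^ c * y ^ k) (+-cancelˡ-≡ c _ _ (trans (sym (+-assoc c d (n ∸ K))) (trans (cong (_+ (n ∸ K)) (m+[n∸m]≡n c≤K)) (trans (m+[n∸m]≡n K≤n) (sym (m+[n∸m]≡n (≤-trans c≤K K≤n))))))) ⟩
        x ^ c * y ^ (n ∸ c) ∎
        where d = K ∸ c

  length-small-≤ : ∀ K n → length (small K n) ≤ 2 ^ n
  length-small-≤ K n = begin
    length (small K n)                   ≡⟨ length-∑ (small K n) ⟩
    ∑ (small K n) (λ _ → 1)              ≤⟨ ∑-small-≤ K n _ ⟩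
    ∑ (subsets n) (λ _ → 1)              ≡⟨ ∑-cong (subsets n) (λ X → cong₂ _*_ (^-zeroˡ (card X)) (^-zeroˡ (n ∸ card X))) ⟨
    ∑ (subsets n) (λ X → 1 ^ card X * 1 ^ (n ∸ card X)) ≡⟨ binomial 1 1 n ⟩
    2 ^ n ∎
    where open ≤-Reasoning

  length-small-mono : ∀ K {k n} → k ≤ n → length (small K k) ≤ length (small K n)
  length-small-mono K {k} k≤n = go (≤⇒≤′ k≤n)
    where
    go : ∀ {n} → k ≤′ n → length (small K k) ≤ length (small K n)
    go (≤′-reflexive refl) = ≤-refl
    go (≤′-step {n} q) = ≤-trans (go q) (≤-trans (m≤m+n _ _)
      (≤-reflexive (sym (trans (length-++ (map (false ∷_) (small K n))) (cong (_+ length (map (true ∷_) (filterᵇ (λ X → card X <ᵇ K) (small K n)))) (length-map (false ∷_) (small K n)))))))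

  contents-at : ∀ xs y ys → contents (xs ++ y ∷ ys) (length xs) ≡ y
  contents-at []       y ys = refl
  contents-at (x ∷ xs) y ys = contents-at xs y ys

  contents-map-at : ∀ (g : A → ℕ) xs x ys → contents (map g (xs ++ x ∷ ys)) (length xs) ≡ g x
  contents-map-at g []       x ys = refl
  contents-map-at g (y ∷ xs) x ys = contents-map-at g xs x ys

  contents-snoc : ∀ xs y j → contents (xs ++ [ y ]) j ≡ (if length xs ≡ᵇ j then y else contents xs j)
  contents-snoc []       y zero    = refl
  contents-snoc []       y (suc j) = refl
  contents-snoc (x ∷ xs) y zero    = refl
  contents-snoc (x ∷ xs) y (suc j) = contents-snoc xs y j

  contents-tabulate : ∀ {m} (f : Fin m → ℕ) e → contents (tabulate f) (toℕ e) ≡ f e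
  contents-tabulate f zero    = refl
  contents-tabulate f (suc e) = contents-tabulate (f ∘ suc) e

  contents-≤ : ∀ xs {b} → All (_≤ b) xs → ∀ j → contents xs j ≤ b
  contents-≤ []       []       j       = z≤n
  contents-≤ (x ∷ xs) (p ∷ ps) zero    = p
  contents-≤ (x ∷ xs) (p ∷ ps) (suc j) = contents-≤ xs ps j

  [m*d+r]/d : ∀ m {r d} .{{_ : NonZero d}} → r < d → (m * d + r) / d ≡ m
  [m*d+r]/d m {r} {d} r<d = trans (cong (_/ d) (+-comm (m * d) r)) (trans (+-distrib-/-∣ʳ r {m * d} {d} (subst (d Data.Nat.Divisibility.∣_) (*-comm d m) (m∣m*n m)))
    (cong₂ _+_ (m<n⇒m/n≡0 r<d) (m*n/n≡m m d)))

  address-injective : ∀ {m m′ r r′ d} → r < d → r′ < d → m * d + r ≡ m′ * d + r′ → m ≡ m′ × r ≡ r′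
  address-injective {m} {m′} {r} {r′} {suc d} p q e with trans (sym ([m*d+r]/d m p)) (trans (cong (_/ suc d) e) ([m*d+r]/d m′ q))
  ... | refl = refl , +-cancelˡ-≡ (m * suc d) r r′ e

-- The algorithm.

module Program where
  open import Defs
  open Hoare using (for)
  open import Data.Bool using (Bool; true; false; if_then_else_)
  open import Data.Nat using (ℕ)

  infixl 6 _⊕_ _⊝_
  infixl 7 _⊗_ _⊘_

  _⊕_ _⊝_ _⊗_ _⊘_ : Expr → Expr → Expr
  _⊕_ = op add
  _⊝_ = op monus
  _⊗_ = op mul
  _⊘_ = op div

  var : Array → Expr
  var a = read a (lit 0)

  -- pow holds the powers of 2; lst and crd the masks and cardinalities of the
  -- len small subsets. Column c < n of tab and fam counts paths from s to c,
  -- column n + c paths from c to t; their rows are addressed by masks.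
  pow lst crd len 𝕚 𝕡 𝕧 𝕖 acc tab fam sums cur : Array
  pow  = 6
  lst  = 7
  crd  = 8
  len  = 9
  𝕚    = 10
  𝕡    = 11
  𝕧    = 12
  𝕖    = 13
  acc  = 14
  tab  = 15
  fam  = 16
  sums = 17
  cur  = 18

  vertexCount edgeCount source target pathLength : Expr
  vertexCount = read 0 (lit 0)
  edgeCount   = read 0 (lit 1)
  source      = read 0 (lit 2)
  target      = read 0 (lit 3)
  pathLength  = read 0 (lit 4)

  -- The two truncated differences add up to 0 exactly when the numbers agree.
  equals : Expr → Expr → Expr
  equals a b = lit 1 ⊝ ((a ⊝ b) ⊕ (b ⊝ a))

  negate : Expr → Expr
  negate a = lit 1 ⊝ a

  modulo : Expr → Expr → Expr
  modulo a b = a ⊝ a ⊘ b ⊗ b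

  halfLength : Bool → Expr
  halfLength false = pathLength ⊘ lit 2
  halfLength true  = pathLength ⊝ pathLength ⊘ lit 2

  -- Generating functions in an indeterminate X are stored as their values
  -- at X = 2 ^ digitBits, which exceeds the number of paths.
  digitBits : Expr
  digitBits = edgeCount ⊗ vertexCount ⊕ lit 1

  weightOf : Expr → Expr
  weightOf u = read pow (vertexCount ⊝ lit 1 ⊝ u)

  contains : Expr → Expr → Expr
  contains X u = modulo (X ⊘ weightOf u) (lit 2)

  address : Expr → Expr → Expr
  address X c = X ⊗ (vertexCount ⊕ vertexCount) ⊕ c

  column : Bool → Expr → Expr
  column false u = u
  column true  u = vertexCount ⊕ u

  root : Bool → Expr
  root false = source
  root true  = target

  tail head : Bool → Expr
  tail b = read (if b then 2 else 1) (var 𝕖)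
  head b = read (if b then 1 else 2) (var 𝕖)

  current : Expr
  current = read lst (var 𝕡)

  -- The exponents looked up are places of vertices, which are below n, and multiples of `digitBits`
  -- by at most B n + 1. Weights of paths are at most B ℓ, which makes B ℓ + 1 outputs.
  powerLimit weightLimit : ℕ → Expr
  powerLimit B  = digitBits ⊗ (lit B ⊗ vertexCount ⊕ lit 1) ⊕ vertexCount
  weightLimit B = lit B ⊗ pathLength ⊕ lit 1

  double : Cmd
  double = write pow (var 𝕚 ⊕ lit 1) (lit 2 ⊗ read pow (var 𝕚))

  powers : ℕ → Cmd
  powers B = write pow (lit 0) (lit 1) ⨾ for 𝕚 (powerLimit B) double

  append : Cmd
  append = write lst (var len) (current ⊕ read pow (var 𝕚))
    ⨾ write crd (var len) (read crd (var 𝕡) ⊕ lit 1)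
    ⨾ write len (lit 0) (var len ⊕ lit 1)

  -- The truncated difference is nonzero exactly when the set has room for one more element.
  appendIfSmall : Cmd
  appendIfSmall = ifnz (halfLength true ⊝ read crd (var 𝕡)) append skip

  -- `cur` freezes the length: the loop appends to the list that it traverses, and only the old sets
  -- are to be extended.
  addVertex : Cmd
  addVertex = write cur (lit 0) (var len) ⨾ for 𝕡 (var cur) appendIfSmall

  -- Setting the length to 1 suffices to start, because the cleared cells already describe the empty
  -- set.
  smallSubsets : Cmd
  smallSubsets = write len (lit 0) (lit 1) ⨾ for 𝕚 vertexCount addVertex

  -- The table is read even if the tail is not in the current set; the address is then meaningless,
  -- but the value is multiplied by 0.
  extend : Bool → Cmd
  extend b = write acc (lit 0) (var acc
    ⊕ equals (head b) (var 𝕧) ⊗ (contains current (tail b) ⊗ (negate (contains current (var 𝕧))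
      ⊗ (read pow (digitBits ⊗ read 3 (var 𝕖)) ⊗ read tab (address (current ⊝ weightOf (tail b)) (column b (tail b)))))))

  -- `tab` keeps every cardinality for the sake of the recursion, `fam` only that of a half path.
  visit : Bool → Cmd
  visit b = write acc (lit 0) (equals (var 𝕧) (root b) ⊗ equals (read crd (var 𝕡)) (lit 0))
    ⨾ for 𝕖 edgeCount (extend b)
    ⨾ write tab (address current (column b (var 𝕧))) (var acc)
    ⨾ write fam (address current (column b (var 𝕧))) (equals (read crd (var 𝕡)) (halfLength b) ⊗ var acc)

  halfPaths : Bool → Cmd
  halfPaths b = for 𝕡 (var len) (for 𝕧 vertexCount (visit b))

  -- Works in place: the superset has the larger mask, so in increasing order it is still unmodified
  -- when read. If it is too large to be listed, its cell holds 0.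
  foldColumn : Cmd
  foldColumn = write fam (address current (var 𝕧))
    (read fam (address current (var 𝕧))
      ⊕ negate (contains current (var 𝕚)) ⊗ read fam (address (current ⊕ weightOf (var 𝕚)) (var 𝕧)))

  zeta : Cmd
  zeta = for 𝕚 vertexCount (for 𝕡 (var len) (for 𝕧 (vertexCount ⊕ vertexCount) foldColumn))

  cardParity : Expr
  cardParity = modulo (read crd (var 𝕡)) (lit 2)

  -- Cells 0 and 1 of `sums` belong to the even and to the odd sets.
  addProduct : Cmd
  addProduct = write sums cardParity
    (read sums cardParity ⊕ read fam (address current (var 𝕧)) ⊗ read fam (address current (vertexCount ⊕ var 𝕧)))

  combine : Cmd
  combine = for 𝕡 (var len) (for 𝕧 vertexCount addProduct)

  digitAt : Cmd
  digitAt = write 5 (var 𝕚)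
    (modulo ((read sums (lit 0) ⊝ read sums (lit 1)) ⊘ read pow (digitBits ⊗ var 𝕚)) (read pow digitBits))

  digits : ℕ → Cmd
  digits B = for 𝕚 (weightLimit B) digitAt ⨾ write 4 (lit 0) (weightLimit B)

  program : ℕ → Cmd
  program B = powers B ⨾ smallSubsets ⨾ (halfPaths false ⨾ halfPaths true) ⨾ zeta ⨾ combine ⨾ digits B

-- Values of the program's expressions, and the size parameters.

module Correctness where
  open Combinatorics
  open import Defs hiding (size)
  open Hoare
  open Masks
  open Paths
  open Program
  open import Data.Bool using (Bool; true; false; not; _xor_; if_then_else_; T; T?)
  open import Data.Fin as Fin using (Fin; toℕ; fromℕ<; _↑ˡ_; _↑ʳ_)
  open import Data.Fin.Properties using (toℕ-fromℕ<; toℕ<n; toℕ-↑ˡ; toℕ-↑ʳ; ↑ˡ-injective; ↑ʳ-injective)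
  open import Data.List as List using (List; []; _∷_; _++_; [_]; length; map; filter; filterᵇ; allFin; tabulate)
  open import Data.List.Properties using (length-++; length-map; map-++; map-tabulate; length-tabulate; ++-assoc; ++-identityʳ; filter-++; filter-none; length-filter; map-∘; map-cong)
  open import Data.List.Membership.Propositional using (_∈_; _∉_)
  open import Data.List.Membership.Propositional.Properties
  open import Data.List.Relation.Unary.All as All using (All; []; _∷_)
  import Data.List.Relation.Unary.All.Properties as Allₚ
  open import Data.List.Relation.Unary.AllPairs using (AllPairs)
  open import Data.List.Relation.Unary.Any using (here; there)
  import Data.List.Relation.Unary.Unique.Propositional.Properties as Uniqueₚ
  open import Data.Nat
  open import Data.Nat.DivMod hiding (_div_; _mod_)
  open import Data.Nat.Properties
  open import Data.Nat.Tactic.RingSolver using (solve-∀)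
  open import Data.Product using (_×_; _,_; proj₁; proj₂; ∃-syntax)
  open import Data.Sum using (_⊎_; inj₁; inj₂)
  open import Data.Vec using ([]; _∷_; lookup)
  open import Function using (_∘_; id)
  open import Relation.Binary.PropositionalEquality hiding ([_])
  open import Relation.Nullary using (yes; no; contradiction; ¬_)

  equal-value : ∀ x y → 1 ∸ ((x ∸ y) + (y ∸ x)) ≡ ⌞ x ≡ᵇ y ⌟
  equal-value zero    zero    = refl
  equal-value zero    (suc y) = 0∸n≡0 y
  equal-value (suc x) zero    = trans (cong (λ z → 0 ∸ z) (+-identityʳ x)) (0∸n≡0 x)
  equal-value (suc x) (suc y) = equal-value x y

  negate-value : ∀ b → 1 ∸ ⌞ b ⌟ ≡ ⌞ not b ⌟
  negate-value false = refl
  negate-value true  = refl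

  div-value : ∀ x y .{{_ : NonZero y}} → apply div x y ≡ x / y
  div-value x (suc y) = refl

  modulo-value : ∀ x y .{{_ : NonZero y}} → x ∸ apply div x y * y ≡ x % y
  modulo-value x y@(suc _) = sym (m%n≡m∸m/n*n x y)

  card-odd : ∀ {n} (X : Subset n) → card X % 2 ≡ ⌞ odd X ⌟
  card-odd []          = refl
  card-odd (false ∷ X) = card-odd X
  card-odd (true ∷ X)  with odd X | card-odd X
  ... | b | q = trans (%-distribˡ-+ 1 (card X) 2) (trans (cong (λ z → (1 + z) % 2) q) (flip b))
    where
    flip : ∀ b → (1 + ⌞ b ⌟) % 2 ≡ ⌞ not b ⌟
    flip false = refl
    flip true  = refl

  contents-toℕ : ∀ {n k} → k < n → contents (tabulate {n = n} toℕ) k ≡ k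
  contents-toℕ {n} {k} k<n = subst (λ j → contents (tabulate {n = n} toℕ) j ≡ j) (toℕ-fromℕ< k<n) (contents-tabulate toℕ (fromℕ< k<n))

  -- Identifies the loop counter, the length of the prefix, with the vertex, edge or column being
  -- processed.
  allFin-split : ∀ {n} xs {v : Fin n} {ys} → allFin n ≡ xs ++ v ∷ ys → length xs ≡ toℕ v
  allFin-split {n} xs {v} {ys} eq = begin
    length xs                                        ≡⟨ contents-toℕ lt ⟨
    contents (tabulate {n = n} toℕ) (length xs)      ≡⟨ cong (λ l → contents l (length xs)) (map-tabulate {n = n} id toℕ) ⟨
    contents (map toℕ (allFin n)) (length xs)        ≡⟨ cong (λ l → contents (map toℕ l) (length xs)) eq ⟩
    contents (map toℕ (xs ++ v ∷ ys)) (length xs)    ≡⟨ cong₂ contents (map-++ toℕ xs (v ∷ ys)) (sym (length-map toℕ xs)) ⟩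
    contents (map toℕ xs ++ toℕ v ∷ map toℕ ys) (length (map toℕ xs)) ≡⟨ contents-at (map toℕ xs) _ _ ⟩
    toℕ v ∎
    where
    open ≡-Reasoning
    lt : length xs < n
    lt = subst (length xs <_) (trans (sym (trans (cong length eq) (length-++ xs))) (length-tabulate {n = n} id)) (m<m+n (length xs) z<s)

  record Input : Set where
    constructor mkInput
    field
      {n}    : ℕ
      D      : Digraph n
      w      : Weighting D
      s t    : Fin n
      ℓ B    : ℕ
      n>0    : 0 < n
      w≤B    : ∀ e → w e ≤ B
      ℓ<n    : ℓ < n

    m : ℕ
    m = Digraph.size D

    digit-bits : ℕ
    digit-bits = m * n + 1

    max-power : ℕ
    max-power = digit-bits * (B * n + 1) + n

    -- Chosen so that (m · b^B)^n ≤ 2 ^ `growth`, where b = 2 ^ `digit-bits`; this bounds the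
    -- generating functions of half paths.
    growth : ℕ
    growth = (m + digit-bits * B) * n

    -- Collects the demands on the cells: the powers of 2, the edge counter, and 4n + 2 `growth` for
    -- the parity sums (see `totalBound`); the last summand keeps it positive.
    word : ℕ
    word = max-power + m + 4 * n + 2 * growth + 2

    K : ℕ
    K = ℓ ∸ ℓ / 2

  if-≡ : ∀ {A : Set} {a j} {x y : A} → a ≡ j → (if a ≡ᵇ j then x else y) ≡ x
  if-≡ {a = a} refl rewrite ≡ᵇ-refl a = refl

  if-≢ : ∀ {A : Set} {a j} {x y : A} → j ≢ a → (if a ≡ᵇ j then x else y) ≡ y
  if-≢ p rewrite ≢⇒≡ᵇ (λ q → p (sym q)) = refl

  ∑-snoc : ∀ {A : Set} (xs : List A) x (f : A → ℕ) → ∑ (xs ++ [ x ]) f ≡ ∑ xs f + f x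
  ∑-snoc xs x f = trans (∑-++ xs [ x ] f) (cong (∑ xs f +_) (+-identityʳ (f x)))

  ∑-prefix-≤ : ∀ {A : Set} {zs : List A} xs x ys (f : A → ℕ) → zs ≡ xs ++ x ∷ ys → ∑ (xs ++ [ x ]) f ≤ ∑ zs f
  ∑-prefix-≤ xs x ys f refl = ≤-trans (m≤m+n _ (∑ ys f))
    (≤-reflexive (trans (sym (∑-++ (xs ++ [ x ]) ys f)) (cong (λ l → ∑ l f) (++-assoc xs [ x ] ys))))

  allFin-fresh : ∀ {k} xs {c : Fin k} {ys} → allFin k ≡ xs ++ c ∷ ys → c ∉ xs
  allFin-fresh {k} xs eq c∈ = distinct-earlier xs (subst (AllPairs _≢_) eq (Uniqueₚ.allFin⁺ k)) c∈ refl

  -- Polynomial bounds on time and word length.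

  IsPolynomial : (ℕ → ℕ) → Set
  IsPolynomial f = ∃[ p ] ∀ x → eval p x ≡ f x

  constant : ∀ k → IsPolynomial (λ _ → k)
  constant k = k ∷ [] , λ x → trans (cong (k +_) (*-zeroʳ x)) (+-identityʳ k)

  identity : IsPolynomial (λ x → x)
  identity = 0 ∷ 1 ∷ [] , λ x → trans (cong (λ z → x * (1 + z)) (*-zeroʳ x)) (*-identityʳ x)

  infixl 6 _⟨+⟩_
  infixl 7 _⟨*⟩_

  _⟨+⟩_ : ∀ {f g} → IsPolynomial f → IsPolynomial g → IsPolynomial (λ x → f x + g x)
  (p , p≡) ⟨+⟩ (q , q≡) = add′ p q , λ x → trans (eval-add p q x) (cong₂ _+_ (p≡ x) (q≡ x))
    where
    add′ : Polynomial → Polynomial → Polynomial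
    add′ []      q       = q
    add′ (a ∷ p) []      = a ∷ p
    add′ (a ∷ p) (c ∷ q) = a + c ∷ add′ p q
    shuffle : ∀ a c x p q → a + c + x * (p + q) ≡ a + x * p + (c + x * q)
    shuffle = solve-∀
    eval-add : ∀ p q x → eval (add′ p q) x ≡ eval p x + eval q x
    eval-add []      q       x = refl
    eval-add (a ∷ p) []      x = sym (+-identityʳ _)
    eval-add (a ∷ p) (c ∷ q) x = trans (cong (λ z → a + c + x * z) (eval-add p q x)) (shuffle a c x (eval p x) (eval q x))

  _⟨*⟩_ : ∀ {f g} → IsPolynomial f → IsPolynomial g → IsPolynomial (λ x → f x * g x)
  _⟨*⟩_ {f} {g} (p , p≡) 𝕘@(q , q≡) = let (r , r≡) = times p in r , λ x → trans (r≡ x) (cong (_* g x) (p≡ x))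
    where
    shift : ∀ {h} → IsPolynomial h → IsPolynomial (λ x → x * h x)
    shift (r , r≡) = 0 ∷ r , λ x → cong (x *_) (r≡ x)
    scale : ∀ a → IsPolynomial (λ x → a * g x)
    scale a = map (a *_) q , λ x → trans (go q x) (cong (a *_) (q≡ x))
      where
      shuffle : ∀ a c x q → a * c + x * (a * q) ≡ a * (c + x * q)
      shuffle = solve-∀
      go : ∀ q x → eval (map (a *_) q) x ≡ a * eval q x
      go []      x = sym (*-zeroʳ a)
      go (c ∷ q) x = trans (cong (λ z → a * c + x * z) (go q x)) (shuffle a c x (eval q x))
    times : ∀ p → IsPolynomial (λ x → eval p x * g x)
    times []      = [] , λ x → refl
    times (a ∷ p) = let (r , r≡) = scale a ⟨+⟩ shift (times p) in r , λ x → trans (r≡ x) (shuffle a x (eval p x) (g x))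
      where
      shuffle : ∀ a x p g → a * g + x * (p * g) ≡ (a + x * p) * g
      shuffle = solve-∀

  module Bounds (B n m : ℕ) where

    -- The quantities of `Input` with m as a parameter, so that they can also be taken at the bound
    -- `eval q n`.
    digit-bits′ max-power′ growth′ word′ : ℕ
    digit-bits′ = m * n + 1
    max-power′  = digit-bits′ * (B * n + 1) + n
    growth′     = (m + digit-bits′ * B) * n
    word′       = max-power′ + m + 4 * n + 2 * growth′ + 2

    steps : (ℓ Λ : ℕ) → ℕ
    steps ℓ Λ = 1 + (max-power′ * 3 + 2) + (1 + (n * (Λ * 6 + 5) + 2) + (Λ * (n * (m * 3 + 7) + 4) + 2 + (Λ * (n * (m * 3 + 7) + 4) + 2)
      + (n * (Λ * ((n + n) * 3 + 4) + 4) + 2 + (Λ * (n * 3 + 4) + 2 + ((B * ℓ + 1) * 3 + 2 + 1)))))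

    -- `steps` is affine in Λ, and a + b Λ ≤ (a + b) Λ for Λ ≥ 1; with Λ = k + 1 the difference is k
    -- a = k · `steps ℓ 0`.
    steps-≤ : ∀ ℓ Λ → 0 < Λ → steps ℓ Λ ≤ Λ * steps ℓ 1
    steps-≤ ℓ (suc k) _ = ≤-trans (m≤m+n _ (k * steps ℓ 0)) (≤-reflexive (linear max-power′ n m B ℓ k))
      where
      linear : ∀ z n m B ℓ k →
        1 + (z * 3 + 2) + (1 + (n * (suc k * 6 + 5) + 2) + (suc k * (n * (m * 3 + 7) + 4) + 2 + (suc k * (n * (m * 3 + 7) + 4) + 2)
          + (n * (suc k * ((n + n) * 3 + 4) + 4) + 2 + (suc k * (n * 3 + 4) + 2 + ((B * ℓ + 1) * 3 + 2 + 1)))))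
        + k * (1 + (z * 3 + 2) + (1 + (n * (0 * 6 + 5) + 2) + (0 * (n * (m * 3 + 7) + 4) + 2 + (0 * (n * (m * 3 + 7) + 4) + 2)
          + (n * (0 * ((n + n) * 3 + 4) + 4) + 2 + (0 * (n * 3 + 4) + 2 + ((B * ℓ + 1) * 3 + 2 + 1))))))
        ≡ suc k * (1 + (z * 3 + 2) + (1 + (n * (1 * 6 + 5) + 2) + (1 * (n * (m * 3 + 7) + 4) + 2 + (1 * (n * (m * 3 + 7) + 4) + 2)
          + (n * (1 * ((n + n) * 3 + 4) + 4) + 2 + (1 * (n * 3 + 4) + 2 + ((B * ℓ + 1) * 3 + 2 + 1))))))
      linear = solve-∀

  module _ (B n : ℕ) {m M : ℕ} (m≤M : m ≤ M) where

    private
      module 𝟙 = Bounds B n m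
      module 𝟚 = Bounds B n M

      digit-bits-mono : 𝟙.digit-bits′ ≤ 𝟚.digit-bits′
      digit-bits-mono = +-monoˡ-≤ 1 (*-monoˡ-≤ n m≤M)

      max-power-mono : 𝟙.max-power′ ≤ 𝟚.max-power′
      max-power-mono = +-monoˡ-≤ n (*-monoˡ-≤ (B * n + 1) digit-bits-mono)

    word-mono : 𝟙.word′ ≤ 𝟚.word′
    word-mono = +-monoˡ-≤ 2 (+-mono-≤ (+-monoˡ-≤ (4 * n) (+-mono-≤ max-power-mono m≤M))
      (*-monoʳ-≤ 2 (*-monoˡ-≤ n (+-mono-≤ m≤M (*-monoˡ-≤ B digit-bits-mono)))))

    steps-mono : ∀ {ℓ} → ℓ ≤ n → 𝟙.steps ℓ 1 ≤ 𝟚.steps n 1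
    steps-mono ℓ≤n = +-mono-≤ (+-monoʳ-≤ 1 (+-monoˡ-≤ 2 (*-monoˡ-≤ 3 max-power-mono)))
      (+-monoʳ-≤ (1 + (n * (1 * 6 + 5) + 2)) (+-mono-≤ (+-mono-≤ half half)
        (+-monoʳ-≤ (n * (1 * ((n + n) * 3 + 4) + 4) + 2) (+-monoʳ-≤ (1 * (n * 3 + 4) + 2)
          (+-monoˡ-≤ 1 (+-monoˡ-≤ 2 (*-monoˡ-≤ 3 (+-monoˡ-≤ 1 (*-monoʳ-≤ B ℓ≤n)))))))))
      where
      half : 1 * (n * (m * 3 + 7) + 4) + 2 ≤ 1 * (n * (M * 3 + 7) + 4) + 2
      half = +-monoˡ-≤ 2 (*-monoʳ-≤ 1 (+-monoˡ-≤ 4 (*-monoʳ-≤ n (+-monoˡ-≤ 7 (*-monoˡ-≤ 3 m≤M)))))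

  -- Opaque, since κ (program B) must never be unfolded to a numeral.
  opaque

    product₃ : ℕ → ℕ → ℕ → ℕ
    product₃ a b c = a * (b * c)

    ≤-product₃ : ∀ {x} a b c → x ≤ a * (b * c) → x ≤ product₃ a b c
    ≤-product₃ a b c p = p

    product₃-polynomial : ∀ {f g h} → IsPolynomial f → IsPolynomial g → IsPolynomial h → IsPolynomial (λ x → product₃ (f x) (g x) (h x))
    product₃-polynomial f g h = f ⟨*⟩ (g ⟨*⟩ h)

    product₃-chain : ∀ {x S S₁ S′ k W W′ Λ} → x ≤ product₃ S k W → S ≤ Λ * S₁ → S₁ ≤ S′ → W ≤ W′ → x ≤ product₃ S′ k W′ * Λ
    product₃-chain {x} {S} {S₁} {S′} {k} {W} {W′} {Λ} t S≤ S₁≤ W≤ = begin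
      x                   ≤⟨ t ⟩
      S * (k * W)         ≤⟨ *-mono-≤ (≤-trans S≤ (*-monoʳ-≤ Λ S₁≤)) (*-monoʳ-≤ k W≤) ⟩
      Λ * S′ * (k * W′)   ≡⟨ trans (*-assoc Λ S′ (k * W′)) (*-comm Λ (S′ * (k * W′))) ⟩
      S′ * (k * W′) * Λ   ∎
      where open ≤-Reasoning

  timeBound : (B : ℕ) → Polynomial → ℕ → ℕ
  timeBound B q n = product₃ (Bounds.steps B n (eval q n) n 1) (κ (program B)) (Bounds.word′ B n (eval q n))

  timeBound-isPolynomial : ∀ B q → IsPolynomial (λ n → timeBound B q n * Counting.slack n)
  timeBound-isPolynomial B q = product₃-polynomial 𝕤 (constant (κ (program B))) 𝕨 ⟨*⟩ (c 2 ⟨*⟩ (c 1 ⟨+⟩ 𝕟) ⟨*⟩ (c 1 ⟨+⟩ 𝕟))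
    where
    c = constant
    𝕟 = identity
    𝕞 : IsPolynomial (eval q)
    𝕞 = q , λ _ → refl
    𝕕 = 𝕞 ⟨*⟩ 𝕟 ⟨+⟩ c 1
    𝕫 = 𝕕 ⟨*⟩ (c B ⟨*⟩ 𝕟 ⟨+⟩ c 1) ⟨+⟩ 𝕟
    𝕨 = 𝕫 ⟨+⟩ 𝕞 ⟨+⟩ c 4 ⟨*⟩ 𝕟 ⟨+⟩ c 2 ⟨*⟩ ((𝕞 ⟨+⟩ 𝕕 ⟨*⟩ c B) ⟨*⟩ 𝕟) ⟨+⟩ c 2
    𝕙 = c 1 ⟨*⟩ (𝕟 ⟨*⟩ (𝕞 ⟨*⟩ c 3 ⟨+⟩ c 7) ⟨+⟩ c 4) ⟨+⟩ c 2
    𝕤 = c 1 ⟨+⟩ (𝕫 ⟨*⟩ c 3 ⟨+⟩ c 2) ⟨+⟩ (c 1 ⟨+⟩ (𝕟 ⟨*⟩ (c 1 ⟨*⟩ c 6 ⟨+⟩ c 5) ⟨+⟩ c 2) ⟨+⟩ (𝕙 ⟨+⟩ 𝕙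
      ⟨+⟩ (𝕟 ⟨*⟩ (c 1 ⟨*⟩ ((𝕟 ⟨+⟩ 𝕟) ⟨*⟩ c 3 ⟨+⟩ c 4) ⟨+⟩ c 4) ⟨+⟩ c 2 ⟨+⟩ (c 1 ⟨*⟩ (𝕟 ⟨*⟩ c 3 ⟨+⟩ c 4) ⟨+⟩ c 2 ⟨+⟩ ((c B ⟨*⟩ 𝕟 ⟨+⟩ c 1) ⟨*⟩ c 3 ⟨+⟩ c 2 ⟨+⟩ c 1)))))

  opaque

    -- An opaque copy, which keeps the coefficients from being unfolded where the theorem refers to
    -- them.
    timeBound-polynomial : ∀ B q → IsPolynomial (λ n → timeBound B q n * Counting.slack n)
    timeBound-polynomial = timeBound-isPolynomial

  -- Verification of the phases on a given input.

  module Execution (ι : Input) where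

    open Input ι
    module L = Logic word (≤-trans (s≤s z≤n) (m≤n+m 2 (max-power + m + 4 * n + 2 * growth)))
    open L

    ≤word⇒≤2^ : ∀ {k} → k ≤ word → k ≤ 2 ^ word
    ≤word⇒≤2^ p = ≤-trans p (n≤2^n word)

    2^-≤ : ∀ {k} → k ≤ word → 2 ^ k ≤ 2 ^ word
    2^-≤ = ^-monoʳ-≤ 2

    max-power≤ : max-power ≤ word
    max-power≤ = ≤-trans (m≤m+n max-power m) (≤-trans (m≤m+n _ (4 * n)) (≤-trans (m≤m+n _ (2 * growth)) (m≤m+n _ 2)))

    m≤ : m ≤ word
    m≤ = ≤-trans (m≤n+m m max-power) (≤-trans (m≤m+n _ (4 * n)) (≤-trans (m≤m+n _ (2 * growth)) (m≤m+n _ 2)))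

    4n+2g≤ : 4 * n + 2 * growth ≤ word
    4n+2g≤ = ≤-trans (m≤n+m _ (max-power + m)) (≤-trans (≤-reflexive (sym (+-assoc (max-power + m) (4 * n) (2 * growth)))) (m≤m+n _ 2))

    4n≤ : 4 * n ≤ word
    4n≤ = ≤-trans (m≤m+n (4 * n) (2 * growth)) 4n+2g≤

    n≤ : n ≤ word
    n≤ = ≤-trans (m≤m+n n (3 * n)) 4n≤

    record Inputs (σ : Store) : Set where
      field
        n-cell : σ 0 0 ≡ n
        m-cell : σ 0 1 ≡ m
        s-cell : σ 0 2 ≡ toℕ s
        t-cell : σ 0 3 ≡ toℕ t
        ℓ-cell : σ 0 4 ≡ ℓ
        starts-cells : ∀ e → σ 1 (toℕ e) ≡ toℕ (start D e)
        ends-cells   : ∀ e → σ 2 (toℕ e) ≡ toℕ (end D e)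
        weights-cells : ∀ e → σ 3 (toℕ e) ≡ w e

    open Inputs

    keep-inputs : ∀ {σ τ} → (∀ a → a < 4 → ∀ j → τ a j ≡ σ a j) → Inputs σ → Inputs τ
    keep-inputs f x = record
      { n-cell = trans (f 0 (s≤s z≤n) _) (n-cell x) ; m-cell = trans (f 0 (s≤s z≤n) _) (m-cell x)
      ; s-cell = trans (f 0 (s≤s z≤n) _) (s-cell x) ; t-cell = trans (f 0 (s≤s z≤n) _) (t-cell x)
      ; ℓ-cell = trans (f 0 (s≤s z≤n) _) (ℓ-cell x)
      ; starts-cells = λ e → trans (f 1 (s≤s (s≤s z≤n)) _) (starts-cells x e)
      ; ends-cells = λ e → trans (f 2 (s≤s (s≤s (s≤s z≤n))) _) (ends-cells x e)
      ; weights-cells = λ e → trans (f 3 (s≤s (s≤s (s≤s (s≤s z≤n)))) _) (weights-cells x e) }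

    frame-inputs : ∀ {c σ τ} → Frame c σ τ → {_ : T (keeps 4 c)} → Inputs σ → Inputs τ
    frame-inputs f {h} = keep-inputs (unchanged-below f 4 {h})

    Powers : Store → Set
    Powers σ = ∀ j → j ≤ max-power → σ pow j ≡ 2 ^ j

    powers-limit : ∀ {σ} → Inputs σ → ⟦ powerLimit B ⟧ σ ≡ max-power
    powers-limit x = cong₂ (λ a b → (b * a + 1) * (B * a + 1) + a) (n-cell x) (m-cell x)

    run-powers : ∀ {σ} → Bnd σ → Inputs σ → Run (powers B) σ (1 + (max-power * 3 + 2)) Powers
    run-powers {σ} β x = run-seq {write pow (lit 0) (lit 1)} {for 𝕚 (powerLimit B) double} {σ} {R = λ τ → τ pow 0 ≡ 1}
      (run-write {pow} {lit 0} {lit 1} {σ} β (m^n>0 2 word) refl)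
      λ τ β′ f q → subst (λ k → Run (for 𝕚 (powerLimit B) double) τ (k * 3 + 2) Powers) len-Z
        (run-post (λ υ _ _ r j j≤ → r j (subst (j ≤_) (sym len-Z) j≤))
          (run-for {𝕚} {powerLimit B} {double} {τ} {1} (allFin max-power) I refl
            (λ υ g → trans (powers-limit (frame-inputs g (frame-inputs f x))) (sym len-Z)) β′ (≤-trans (≤-reflexive len-Z) (≤word⇒≤2^ max-power≤))
            (λ { zero _ → q })
            (λ xs a ys υ eq βυ g i≡ inv → run-write {pow} {var 𝕚 ⊕ lit 1} {lit 2 ⊗ read pow (var 𝕚)} {υ} βυ
              (≤-trans (≤-reflexive (cong (2 *_) (trans (cong (υ pow) i≡) (inv (length xs) ≤-refl)))) (2^-≤ (≤-trans (bound xs eq) max-power≤)))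
              (step xs a υ i≡ inv))))
      where
      I : List (Fin max-power) → Store → Set
      I xs τ = ∀ j → j ≤ length xs → τ pow j ≡ 2 ^ j
      len-Z : length (allFin max-power) ≡ max-power
      len-Z = length-tabulate {n = max-power} id
      bound : ∀ xs {a ys} → allFin max-power ≡ xs ++ a ∷ ys → suc (length xs) ≤ max-power
      bound xs {a} eq = subst (λ k → suc k ≤ max-power) (sym (allFin-split xs eq)) (toℕ<n a)
      step : ∀ xs (a : Fin max-power) υ → υ 𝕚 0 ≡ length xs → (∀ j → j ≤ length xs → υ pow j ≡ 2 ^ j) →
        ∀ j → j ≤ length (xs ++ [ a ]) → (υ [ pow , υ 𝕚 0 + 1 ≔ 2 * υ pow (υ 𝕚 0) ]) pow j ≡ 2 ^ j
      step xs a υ i≡ inv j j≤ rewrite i≡ with length xs + 1 ≡ᵇ j in eq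
      ... | true  = trans (cong (2 *_) (inv (length xs) ≤-refl)) (cong (2 ^_) (trans (+-comm 1 (length xs)) (≡ᵇ⇒≡ _ _ (subst T (sym eq) _))))
      ... | false = inv j (≤-pred (≤∧≢⇒< (≤-trans j≤ (≤-reflexive (trans (length-++ xs) (+-comm (length xs) 1))))
              λ { refl → contradiction (trans (sym eq) (trans (cong (_≡ᵇ suc (length xs)) (+-comm (length xs) 1)) (≡ᵇ-refl (length xs)))) λ () }))

    -- Describes every cell, including the zeros beyond the list, so that appending is one update of
    -- the description.
    Listed : ∀ {k} → List (Subset k) → Store → Set
    Listed zs τ = τ len 0 ≡ length zs × (∀ j → τ lst j ≡ contents (map mask zs) j) × (∀ j → τ crd j ≡ contents (map card zs) j)

    K≤n : K ≤ n
    K≤n = ≤-trans (m∸n≤m ℓ (ℓ / 2)) (<⇒≤ ℓ<n)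

    Λ : ℕ
    Λ = length (small K n)

    K-value : ∀ {σ} → Inputs σ → ⟦ halfLength true ⟧ σ ≡ K
    K-value x = cong (λ z → z ∸ z / 2) (ℓ-cell x)

    private
      isSmall : ∀ {k} → Subset k → Bool
      isSmall X = card X <ᵇ K

      -- The list in the middle of the inner loop: all old sets, then the enlarged copies made from
      -- the prefix `xs`.
      appended : ∀ {k} → List (Subset k) → List (Subset k) → List (Subset (suc k))
      appended all xs = map (false ∷_) all ++ map (true ∷_) (filterᵇ isSmall xs)

      appended-at : ∀ {k} (g : Subset (suc k) → ℕ) xs (X : Subset k) ys zs →
        contents (map g (appended (xs ++ X ∷ ys) zs)) (length xs) ≡ g (false ∷ X)
      appended-at g xs X ys zs = trans (cong₂ (λ l → contents (map g l)) (trans (cong (_++ _) (map-++ (false ∷_) xs (X ∷ ys))) (++-assoc (map (false ∷_) xs) _ _))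
        (sym (length-map (false ∷_) xs))) (contents-map-at g (map (false ∷_) xs) (false ∷ X) _)

      filterᵇ-single : ∀ {k} (X : Subset k) {b} → isSmall X ≡ b → filterᵇ isSmall [ X ] ≡ (if b then [ X ] else [])
      filterᵇ-single X eq rewrite eq with isSmall X | eq
      ... | true  | refl = refl
      ... | false | refl = refl

      appended-snoc : ∀ {k} all xs (X : Subset k) b → isSmall X ≡ b →
        appended all (xs ++ [ X ]) ≡ appended all xs ++ map (true ∷_) (if b then [ X ] else [])
      appended-snoc all xs X b eq = trans (cong (λ l → map (false ∷_) all ++ map (true ∷_) l) (trans (filter-++ (λ X → T? (isSmall X)) xs [ X ]) (cong (filterᵇ isSmall xs ++_) (filterᵇ-single X eq))))
        (trans (cong (map (false ∷_) all ++_) (map-++ (true ∷_) (filterᵇ isSmall xs) _)) (sym (++-assoc (map (false ∷_) all) _ _)))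

      length-appended : ∀ {k} all xs (X : Subset k) ys → all ≡ xs ++ X ∷ ys → length (appended all xs) < length all + length all
      length-appended all xs X ys refl = begin-strict
        length (appended all xs) ≡⟨ trans (length-++ (map (false ∷_) all)) (cong₂ _+_ (length-map (false ∷_) all) (length-map (true ∷_) (filterᵇ isSmall xs))) ⟩
        length all + length (filterᵇ isSmall xs) ≤⟨ +-monoʳ-≤ (length all) (length-filter (λ X → T? (isSmall X)) xs) ⟩
        length all + length xs <⟨ +-monoʳ-< (length all) (subst (length xs <_) (sym (length-++ xs)) (m<m+n (length xs) z<s)) ⟩
        length all + length all ∎
        where open ≤-Reasoning

      snoc-cell : ∀ {A : Set} (g : A → ℕ) zs z (τ : Store) (a : Array) (k v : ℕ) → τ len 0 ≡ length zs → k ≡ τ len 0 → v ≡ g z → (∀ j → τ a j ≡ contents (map g zs) j) →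
        ∀ j → (if k ≡ᵇ j then v else τ a j) ≡ contents (map g (zs ++ [ z ])) j
      snoc-cell g zs z τ a k v l refl refl f j = sym (trans (cong (λ l → contents l j) (map-++ g zs [ z ]))
        (trans (contents-snoc (map g zs) (g z) j) (cong₂ (λ c d → if c ≡ᵇ j then g z else d) (trans (length-map g zs) (sym l)) (sym (f j)))))

    run-append : ∀ {k} all xs (X : Subset k) ys τ → all ≡ xs ++ X ∷ ys → Bnd τ → τ 𝕚 0 ≡ k → τ pow k ≡ 2 ^ k → suc k ≤ n → τ 𝕡 0 ≡ length xs →
      card X < K → length all ≤ 2 ^ k → Listed (appended all xs) τ → Run append τ 3 (Listed (appended all xs ++ [ true ∷ X ]))
    run-append {k} all xs X ys τ refl β i≡ pow≡ k<n p≡ <K all≤ (len≡ , lst≡ , crd≡) =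
      run-seq {write lst (var len) (current ⊕ read pow (var 𝕚))} {σ = τ} {R = λ υ → ∀ j → υ lst j ≡ contents (map mask (zs ++ [ true ∷ X ])) j}
        (run-write {lst} {var len} {current ⊕ read pow (var 𝕚)} {τ} β
          (≤-trans (≤-reflexive new-mask) (≤-trans (<⇒≤ (mask-< (true ∷ X))) (2^-≤ (≤-trans k<n n≤))))
          (snoc-cell mask zs (true ∷ X) τ lst (τ len 0) _ len≡ refl new-mask lst≡))
        λ τ₁ β₁ f₁ lst₁ → run-seq {write crd (var len) (read crd (var 𝕡) ⊕ lit 1)} {σ = τ₁}
          {R = λ υ → ∀ j → υ crd j ≡ contents (map card (zs ++ [ true ∷ X ])) j}
          (run-write {crd} {var len} {read crd (var 𝕡) ⊕ lit 1} {τ₁} β₁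
            (≤-trans (≤-reflexive (new-card τ₁ f₁)) (≤-trans <K (≤-trans K≤n (≤word⇒≤2^ n≤))))
            (snoc-cell card zs (true ∷ X) τ₁ crd (τ₁ len 0) _ (trans (unchanged f₁ len 0) len≡) refl (new-card τ₁ f₁)
              (λ j → trans (unchanged f₁ crd j) (crd≡ j))))
          λ τ₂ β₂ f₂ crd₂ → run-write {len} {lit 0} {var len ⊕ lit 1} {τ₂} β₂
            (≤-trans (≤-reflexive (new-len τ₁ f₁ τ₂ f₂)) (≤-trans (length-appended all xs X ys refl)
              (≤-trans (≤-trans (+-mono-≤ all≤ all≤) (≤-reflexive (cong (2 ^ k +_) (sym (+-identityʳ (2 ^ k)))))) (2^-≤ (≤-trans k<n n≤)))))
            (trans (new-len τ₁ f₁ τ₂ f₂) (sym (trans (length-++ zs) (+-comm (length zs) 1))) , (λ j → trans (unchanged f₂ lst j) (lst₁ j)) , crd₂)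
      where
      zs = appended all xs
      new-mask : τ lst (τ 𝕡 0) + τ pow (τ 𝕚 0) ≡ mask (true ∷ X)
      new-mask = trans (cong₂ _+_ (trans (cong (τ lst) p≡) (trans (lst≡ (length xs)) (appended-at mask xs X ys xs))) (trans (cong (τ pow) i≡) pow≡))
        (trans (+-comm (mask X) (2 ^ k)) (cong (_+ mask X) (sym (*-identityˡ (2 ^ k)))))
      new-card : ∀ τ₁ → Frame (write lst (var len) (current ⊕ read pow (var 𝕚))) τ τ₁ → τ₁ crd (τ₁ 𝕡 0) + 1 ≡ card (true ∷ X)
      new-card τ₁ f = trans (+-comm _ 1) (cong suc (trans (cong (τ₁ crd) (trans (unchanged f 𝕡 0) p≡))
        (trans (unchanged f crd (length xs)) (trans (crd≡ (length xs)) (appended-at card xs X ys xs)))))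
      new-len : ∀ τ₁ → Frame (write lst (var len) (current ⊕ read pow (var 𝕚))) τ τ₁ →
        ∀ τ₂ → Frame (write crd (var len) (read crd (var 𝕡) ⊕ lit 1)) τ₁ τ₂ → τ₂ len 0 + 1 ≡ suc (length zs)
      new-len τ₁ f τ₂ g = trans (+-comm _ 1) (cong suc (trans (unchanged g len 0) (trans (unchanged f len 0) len≡)))

    run-addVertex : ∀ {k} τ → Bnd τ → Inputs τ → Powers τ → τ 𝕚 0 ≡ k → suc k ≤ n → Listed (small K k) τ →
      Run addVertex τ (1 + (Λ * 6 + 2)) (Listed (small K (suc k)))
    run-addVertex {k} τ β x P i≡ k<n (len≡ , lst≡ , crd≡) =
      run-seq {write cur (lit 0) (var len)} {for 𝕡 (var cur) appendIfSmall} {τ} {R = λ υ → υ cur 0 ≡ length all}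
        (run-write {cur} {lit 0} {var len} {τ} β (β len 0) len≡)
        λ τ₁ β₁ f₁ cur≡ → run-mono (+-monoˡ-≤ 2 (*-monoˡ-≤ 6 (length-small-mono K (≤-trans (n≤1+n k) k<n))))
          (run-for {𝕡} {var cur} {appendIfSmall} {τ₁} {4} all (λ xs υ → Listed (appended all xs) υ) refl
            (λ υ g → trans (unchanged g cur 0) cur≡) β₁ (≤-trans all≤ (2^-≤ (≤-trans (n≤1+n k) (≤-trans k<n n≤))))
            (trans (unchanged f₁ len 0) (trans len≡ (sym (trans (cong length (++-identityʳ (map (false ∷_) all))) (length-map (false ∷_) all))))
            , (λ j → trans (unchanged f₁ lst j) (trans (lst≡ j) (cong (λ l → contents l j) (initial mask (λ _ → refl)))))
            , (λ j → trans (unchanged f₁ crd j) (trans (crd≡ j) (cong (λ l → contents l j) (initial card (λ _ → refl))))))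
            (body τ₁ f₁))
      where
      all = small K k
      all≤ = length-small-≤ K k
      initial : ∀ {g : Subset k → ℕ} (g′ : Subset (suc k) → ℕ) → (∀ X → g X ≡ g′ (false ∷ X)) → map g all ≡ map g′ (appended all [])
      initial g′ h = trans (trans (map-cong h all) (map-∘ all)) (cong (map g′) (sym (++-identityʳ (map (false ∷_) all))))
      body : ∀ τ₁ → Frame (write cur (lit 0) (var len)) τ τ₁ → ∀ xs X ys υ → all ≡ xs ++ X ∷ ys → Bnd υ → Frame (for 𝕡 (var cur) appendIfSmall) τ₁ υ →
        υ 𝕡 0 ≡ length xs → Listed (appended all xs) υ → Run appendIfSmall υ 4 (Listed (appended all (xs ++ [ X ])))
      body τ₁ f₁ xs X ys υ eq βυ g p≡ L@(_ , _ , crdυ) with isSmall X in is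
      ... | true = subst (λ l → Run appendIfSmall υ 4 (Listed l)) (sym (appended-snoc all xs X true is))
          (run-then {halfLength true ⊝ read crd (var 𝕡)} {append} {skip} {υ} {3} βυ
            (>-nonZero (subst (0 <_) (sym guard) (m<n⇒0<n∸m {card X} {K} (true-<ᵇ {card X} {K} is))))
            (run-append all xs X ys υ eq βυ (trans (unchanged g 𝕚 0) (trans (unchanged f₁ 𝕚 0) i≡))
              (trans (unchanged g pow k) (trans (unchanged f₁ pow k) (P k (≤-trans (≤-trans (n≤1+n k) k<n) (m≤n+m n _)))))
              k<n p≡ (true-<ᵇ {card X} {K} is) all≤ L))
        where
        guard : ⟦ halfLength true ⊝ read crd (var 𝕡) ⟧ υ ≡ K ∸ card X
        guard = cong₂ _∸_ (K-value (frame-inputs g (frame-inputs f₁ x)))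
          (trans (cong (υ crd) p≡) (trans (crdυ (length xs)) (trans (cong (λ l → contents (map card (appended l xs)) (length xs)) eq) (appended-at card xs X ys xs))))
      ... | false = run-mono (s≤s (s≤s z≤n)) (subst (λ l → Run appendIfSmall υ 2 (Listed l)) (sym (trans (appended-snoc all xs X false is) (++-identityʳ _)))
          (run-else {halfLength true ⊝ read crd (var 𝕡)} {append} {skip} {υ} {1} βυ
            (trans guard (m≤n⇒m∸n≡0 {K} {card X} (≮⇒≥ λ lt → contradiction (trans (sym is) (<ᵇ-true lt)) λ ())))
            (run-skip βυ L)))
        where
        guard : ⟦ halfLength true ⊝ read crd (var 𝕡) ⟧ υ ≡ K ∸ card X
        guard = cong₂ _∸_ (K-value (frame-inputs g (frame-inputs f₁ x)))
          (trans (cong (υ crd) p≡) (trans (crdυ (length xs)) (trans (cong (λ l → contents (map card (appended l xs)) (length xs)) eq) (appended-at card xs X ys xs))))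

    run-smallSubsets : ∀ {σ} → Bnd σ → Inputs σ → Powers σ → (∀ j → σ lst j ≡ 0) → (∀ j → σ crd j ≡ 0) →
      Run smallSubsets σ (1 + (n * (Λ * 6 + 5) + 2)) (Listed (small K n))
    run-smallSubsets {σ} β x P lst≡0 crd≡0 =
      run-seq {write len (lit 0) (lit 1)} {for 𝕚 vertexCount addVertex} {σ} {R = λ τ → τ len 0 ≡ 1}
        (run-write {len} {lit 0} {lit 1} {σ} β (m^n>0 2 word) refl)
        λ τ β₁ f len≡ → run-post (λ υ _ _ L → subst (λ k → Listed (small K k) υ) len-n L)
         (run-mono (+-monoˡ-≤ 2 (≤-reflexive (cong₂ _*_ len-n (steps Λ))))
          (run-for {𝕚} {vertexCount} {addVertex} {τ} {1 + (Λ * 6 + 2)} (allFin n) (λ is υ → Listed (small K (length is)) υ) refl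
            (λ υ g → trans (n-cell (frame-inputs g (frame-inputs f x))) (sym len-n)) β₁ (≤-trans (≤-reflexive len-n) (≤word⇒≤2^ n≤))
            (len≡ , (λ j → trans (unchanged f lst j) (trans (lst≡0 j) (zero-cell j))) , (λ j → trans (unchanged f crd j) (trans (crd≡0 j) (zero-cell j))))
            (λ is v ys υ eq βυ g i≡ L → run-post (λ υ′ _ _ L′ → subst (λ k → Listed (small K k) υ′) (sym (trans (length-++ is) (+-comm (length is) 1))) L′)
              (run-addVertex υ βυ (frame-inputs g (frame-inputs f x))
                (λ j j≤ → trans (unchanged g pow j) (trans (unchanged f pow j) (P j j≤))) i≡
                (subst (λ k → suc k ≤ n) (sym (allFin-split is eq)) (toℕ<n v)) L))))
      where
      len-n : length (allFin n) ≡ n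
      len-n = length-tabulate {n = n} id
      steps : ∀ Λ → 1 + (Λ * 6 + 2) + 2 ≡ Λ * 6 + 5
      steps = solve-∀
      zero-cell : ∀ j → 0 ≡ contents (0 ∷ []) j
      zero-cell zero    = refl
      zero-cell (suc j) = refl

    record Ready (τ : Store) : Set where
      field
        inputs : Inputs τ
        powered : Powers τ
        listed : Listed (small K n) τ
    open Ready

    frame-ready : ∀ {c σ τ} → Frame c σ τ → {_ : T (keeps 10 c)} → Ready σ → Ready τ
    frame-ready {c} {σ} {τ} f {h} r = record
      { inputs  = keep-inputs (λ a a<4 → same a (≤-trans a<4 (m≤m+n 4 6))) (inputs r)
      ; powered = λ j j≤ → trans (same pow (m≤m+n 7 3) j) (powered r j j≤)
      ; listed  = let (l , xs , cs) = listed r in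
          trans (same len (m≤m+n 10 0) 0) l , (λ j → trans (same lst (m≤m+n 8 2) j) (xs j)) , (λ j → trans (same crd (m≤m+n 9 1) j) (cs j)) }
      where
      same : ∀ a → a < 10 → ∀ j → τ a j ≡ σ a j
      same = unchanged-below f 10 {h}

    b : ℕ
    b = 2 ^ digit-bits

    val : Fin m → ℕ
    val e = b ^ w e

    open Half {n} val public

    tails heads : Bool → Fin m → Fin n
    tails d = if d then end D else start D
    heads d = if d then start D else end D

    rootOf : Bool → Fin n
    rootOf d = if d then t else s

    lengthOf : Bool → ℕ
    lengthOf d = if d then K else ℓ / 2

    -- For a given set only one length yields a nonzero count, so `dp` reads it off the cardinality
    -- and one row per set is enough.
    dp base : Bool → Fin n → Subset n → ℕ
    dp d v X   = half (tails d) (heads d) (rootOf d) (card X) v X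
    base d v X = half (tails d) (heads d) (rootOf d) (lengthOf d) v X

    col : Bool → Fin n → Fin (n + n)
    col d v = if d then n ↑ʳ v else v ↑ˡ n

    col-injective : ∀ d {u v} → col d u ≡ col d v → u ≡ v
    col-injective false = ↑ˡ-injective n _ _
    col-injective true  = ↑ʳ-injective n _ _

    addr : Subset n → Fin (n + n) → ℕ
    addr X c = mask X * (n + n) + toℕ c

    addr-injective : ∀ {X Y c d} → addr X c ≡ addr Y d → X ≡ Y × c ≡ d
    addr-injective {X} {Y} {c} {d} eq with address-injective {mask X} {mask Y} (toℕ<n c) (toℕ<n d) eq
    ... | p , q = mask-injective p , Data.Fin.Properties.toℕ-injective q

    term : Bool → Fin n → Subset n → Fin m → ℕ
    term d v X e = ⌞ heads d e == v ⌟ * (⌞ lookup X (tails d e) ⌟ * (⌞ not (lookup X v) ⌟ * (val e * dp d (tails d e) (delete (tails d e) X))))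

    -- Base case and recursion in one equation, as the program evaluates them: for empty X no tail
    -- lies in X, otherwise the first summand vanishes.
    dp-rec : ∀ d v X → dp d v X ≡ ⌞ v == rootOf d ⌟ * ⌞ empty X ⌟ + ∑ 𝔼 (term d v X)
    dp-rec d v X with card X in c
    ... | zero = trans (sym (+-identityʳ _)) (cong (⌞ v == rootOf d ⌟ * ⌞ empty X ⌟ +_) (sym (∑-zero 𝔼 vanish)))
      where
      vanish : ∀ e → term d v X e ≡ 0
      vanish e with lookup X (tails d e) in eq
      ... | true  = contradiction (trans (sym (card⇒empty X c)) (empty-lookup (tails d e) X eq)) λ ()
      ... | false = *-zeroʳ ⌞ heads d e == v ⌟
    ... | suc k = trans (∑-cong 𝔼 same) (cong (_+ ∑ 𝔼 (term d v X)) (sym (trans (cong (λ z → ⌞ v == rootOf d ⌟ * ⌞ z ⌟) nonempty) (*-zeroʳ ⌞ v == rootOf d ⌟))))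
      where
      nonempty : empty X ≡ false
      nonempty with empty X in eq
      ... | true  = contradiction (trans (sym (empty⇒card X eq)) c) λ ()
      ... | false = refl
      same : ∀ e → ⌞ heads d e == v ⌟ * (⌞ lookup X (tails d e) ⌟ * (⌞ not (lookup X v) ⌟ * (val e * half (tails d) (heads d) (rootOf d) k (tails d e) (delete (tails d e) X))))
        ≡ term d v X e
      same e with lookup X (tails d e) in eq
      ... | false = refl
      ... | true  = cong (λ j → ⌞ heads d e == v ⌟ * (1 * (⌞ not (lookup X v) ⌟ * (val e * half (tails d) (heads d) (rootOf d) j (tails d e) (delete (tails d e) X)))))
          (sym (suc-injective (trans (card-delete (tails d e) X eq) c)))

    dp-base : ∀ d v X → ⌞ card X ≡ᵇ lengthOf d ⌟ * dp d v X ≡ base d v X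
    dp-base d v X with card X ≡ᵇ lengthOf d in eq
    ... | true  = trans (*-identityˡ _) (cong (λ j → half (tails d) (heads d) (rootOf d) j v X) (≡ᵇ⇒≡ (card X) (lengthOf d) (subst T (sym eq) _)))
    ... | false = sym (half-card (tails d) (heads d) (rootOf d) (lengthOf d) v X
        λ p → contradiction (trans (sym (trans (cong (_≡ᵇ lengthOf d) p) (≡ᵇ-refl (lengthOf d)))) eq) λ ())

    val-≤ : ∀ e → val e ≤ 2 ^ (digit-bits * B)
    val-≤ e = ≤-trans (^-monoʳ-≤ b {{m^n≢0 2 digit-bits}} (w≤B e)) (≤-reflexive (^-*-assoc 2 digit-bits B))

    half-growth : ∀ S E r j v X → j ≤ n → half S E r j v X ≤ 2 ^ growth
    half-growth S E r j v X j≤n = begin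
      half S E r j v X                     ≤⟨ half-≤ S E r j v X val-≤ ⟩
      (m * 2 ^ (digit-bits * B)) ^ j       ≤⟨ ^-monoˡ-≤ j (*-monoˡ-≤ (2 ^ (digit-bits * B)) (n≤2^n m)) ⟩
      (2 ^ m * 2 ^ (digit-bits * B)) ^ j   ≡⟨ cong (_^ j) (sym (^-distribˡ-+-* 2 m (digit-bits * B))) ⟩
      (2 ^ (m + digit-bits * B)) ^ j       ≡⟨ ^-*-assoc 2 (m + digit-bits * B) j ⟩
      2 ^ ((m + digit-bits * B) * j)       ≤⟨ ^-monoʳ-≤ 2 (*-monoʳ-≤ (m + digit-bits * B) j≤n) ⟩
      2 ^ growth ∎
      where open ≤-Reasoning

    lengthOf≤K : ∀ d → lengthOf d ≤ K
    lengthOf≤K true  = ≤-refl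
    lengthOf≤K false = m+n≤o⇒m≤o∸n (ℓ / 2) (≤-trans (≤-reflexive (twice (ℓ / 2))) (m/n*n≤m ℓ 2))
      where
      twice : ∀ k → k + k ≡ k * 2
      twice = solve-∀

    dp-≤ : ∀ d v X → dp d v X ≤ 2 ^ growth
    dp-≤ d v X = half-growth (tails d) (heads d) (rootOf d) (card X) v X (card-≤ 1 1 X)

    base-≤ : ∀ d v X → base d v X ≤ 2 ^ growth
    base-≤ d v X = half-growth (tails d) (heads d) (rootOf d) (lengthOf d) v X (≤-trans (lengthOf≤K d) K≤n)

    growth≤ : growth ≤ word
    growth≤ = ≤-trans (≤-trans (m≤m+n growth _) (m≤n+m (2 * growth) (4 * n))) 4n+2g≤

    module At {τ : Store} (r : Ready τ) where

      private
        x = inputs r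

      weight-value : ∀ (ue : Expr) u → ⟦ ue ⟧ τ ≡ toℕ u → ⟦ weightOf ue ⟧ τ ≡ 2 ^ place u
      weight-value ue u p = trans (cong₂ (λ a c → τ pow (a ∸ 1 ∸ c)) (n-cell x) p)
        (powered r (place u) (≤-trans (<⇒≤ (place-< u)) (m≤n+m n _)))

      contains-value : ∀ (Xe ue : Expr) X u → ⟦ Xe ⟧ τ ≡ mask X → ⟦ ue ⟧ τ ≡ toℕ u → ⟦ contains Xe ue ⟧ τ ≡ ⌞ lookup X u ⌟
      contains-value Xe ue X u p q = trans (cong (λ a → a ∸ a / 2 * 2) quotient)
        (trans (modulo-value ((mask X / 2 ^ place u) {{m^n≢0 2 (place u)}}) 2) (mask-bit u X))
        where
        quotient : apply div (⟦ Xe ⟧ τ) (⟦ weightOf ue ⟧ τ) ≡ (mask X / 2 ^ place u) {{m^n≢0 2 (place u)}}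
        quotient = trans (cong₂ (apply div) p (weight-value ue u q)) (div-value (mask X) (2 ^ place u) {{m^n≢0 2 (place u)}})

      edge-power : ∀ (ee : Expr) e → ⟦ ee ⟧ τ ≡ toℕ e → ⟦ read pow (digitBits ⊗ read 3 ee) ⟧ τ ≡ val e
      edge-power ee e p = trans (cong (τ pow) (cong₂ _*_ (cong₂ (λ a c → c * a + 1) (n-cell x) (m-cell x)) (trans (cong (τ 3) p) (weights-cells x e))))
        (trans (powered r (digit-bits * w e) (≤-trans (*-monoʳ-≤ digit-bits (≤-trans (w≤B e) (≤-trans (m≤m*n B n {{>-nonZero n>0}}) (m≤m+n (B * n) 1)))) (m≤m+n _ n)))
          (sym (^-*-assoc 2 digit-bits (w e))))

      tail-value : ∀ d e → τ 𝕖 0 ≡ toℕ e → ⟦ tail d ⟧ τ ≡ toℕ (tails d e)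
      tail-value false e p = trans (cong (τ 1) p) (starts-cells x e)
      tail-value true  e p = trans (cong (τ 2) p) (ends-cells x e)

      head-value : ∀ d e → τ 𝕖 0 ≡ toℕ e → ⟦ head d ⟧ τ ≡ toℕ (heads d e)
      head-value false e p = trans (cong (τ 2) p) (ends-cells x e)
      head-value true  e p = trans (cong (τ 1) p) (starts-cells x e)

      root-value : ∀ d → ⟦ root d ⟧ τ ≡ toℕ (rootOf d)
      root-value false = s-cell x
      root-value true  = t-cell x

      length-value : ∀ d → ⟦ halfLength d ⟧ τ ≡ lengthOf d
      length-value false = cong (_/ 2) (ℓ-cell x)
      length-value true  = K-value x

      column-value : ∀ d (ue : Expr) u → ⟦ ue ⟧ τ ≡ toℕ u → ⟦ column d ue ⟧ τ ≡ toℕ (col d u)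
      column-value false ue u p = trans p (sym (toℕ-↑ˡ u n))
      column-value true  ue u p = trans (cong₂ _+_ (n-cell x) p) (sym (toℕ-↑ʳ n u))

      address-value : ∀ (Xe ce : Expr) X c → ⟦ Xe ⟧ τ ≡ mask X → ⟦ ce ⟧ τ ≡ toℕ c → ⟦ address Xe ce ⟧ τ ≡ addr X c
      address-value Xe ce X c p q = cong₂ _+_ (cong₂ _*_ p (cong₂ _+_ (n-cell x) (n-cell x))) q

      current-value : ∀ xs {X ys} → small K n ≡ xs ++ X ∷ ys → τ 𝕡 0 ≡ length xs → ⟦ current ⟧ τ ≡ mask X
      current-value xs {X} {ys} eq p = trans (cong (τ lst) p) (trans (proj₁ (proj₂ (listed r)) (length xs))
        (trans (cong (λ l → contents (map mask l) (length xs)) eq) (contents-map-at mask xs X ys)))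

      card-value : ∀ xs {X ys} → small K n ≡ xs ++ X ∷ ys → τ 𝕡 0 ≡ length xs → ⟦ read crd (var 𝕡) ⟧ τ ≡ card X
      card-value xs {X} {ys} eq p = trans (cong (τ crd) p) (trans (proj₂ (proj₂ (listed r)) (length xs))
        (trans (cong (λ l → contents (map card l) (length xs)) eq) (contents-map-at card xs X ys)))

      equal-expr : ∀ (a c : Expr) {k l} → ⟦ a ⟧ τ ≡ k → ⟦ c ⟧ τ ≡ l → ⟦ equals a c ⟧ τ ≡ ⌞ k ≡ᵇ l ⌟
      equal-expr a c refl refl = equal-value (⟦ a ⟧ τ) (⟦ c ⟧ τ)

    length-allFin : ∀ k → length (allFin k) ≡ k
    length-allFin k = length-tabulate {n = k} id

    Λ≤ : Λ ≤ 2 ^ word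
    Λ≤ = ≤-trans (length-small-≤ K n) (2^-≤ n≤)

    module _ (d : Bool) where

      cell : Subset n → Fin n → ℕ
      cell X v = addr X (col d v)

      cell-injective : ∀ {X Y u v} → cell X u ≡ cell Y v → X ≡ Y × u ≡ v
      cell-injective {X} {Y} eq with addr-injective {X} {Y} eq
      ... | p , q = p , col-injective d q

      module _ (xs : List (Subset n)) (X : Subset n) (ys : List (Subset n)) (split : small K n ≡ xs ++ X ∷ ys) where

        -- The entries on which row X depends, all in rows with a smaller mask.
        Predecessors : Store → Set
        Predecessors τ = ∀ u → lookup X u ≡ true → τ tab (cell (delete u X) u) ≡ dp d u (delete u X)

        run-extend : ∀ v es e rest τ → 𝔼 ≡ es ++ e ∷ rest → Bnd τ → Ready τ → τ 𝕡 0 ≡ length xs → τ 𝕧 0 ≡ toℕ v → τ 𝕖 0 ≡ length es → Predecessors τ →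
          τ acc 0 ≡ ⌞ v == rootOf d ⌟ * ⌞ empty X ⌟ + ∑ es (term d v X) →
          Run (extend d) τ 1 (λ υ → υ acc 0 ≡ ⌞ v == rootOf d ⌟ * ⌞ empty X ⌟ + ∑ (es ++ [ e ]) (term d v X))
        run-extend v es e rest τ eq β r p≡ v≡ e≡ pre acc≡ = run-write {acc} {lit 0} {_} {τ} β
          -- A partial sum is at most the complete one, which is a value of `dp`.
          (≤-trans (≤-reflexive value) (≤-trans (+-monoʳ-≤ _ (∑-prefix-≤ es e rest (term d v X) eq))
            (≤-trans (≤-reflexive (sym (dp-rec d v X))) (≤-trans (dp-≤ d v X) (2^-≤ growth≤)))))
          value
          where
          open At r
          e≡′ : τ 𝕖 0 ≡ toℕ e
          e≡′ = trans e≡ (allFin-split es eq)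
          cur≡ = current-value xs split p≡
          u = tails d e
          table : lookup X u ≡ true → ⟦ read tab (address (current ⊝ weightOf (tail d)) (column d (tail d))) ⟧ τ ≡ dp d u (delete u X)
          table q = trans (cong (τ tab) (address-value (current ⊝ weightOf (tail d)) (column d (tail d)) (delete u X) (col d u)
              (trans (cong₂ _∸_ cur≡ (weight-value (tail d) u (tail-value d e e≡′))) (trans (cong (_∸ 2 ^ place u) (sym (mask-delete u X q))) (m+n∸n≡m (mask (delete u X)) (2 ^ place u))))
              (column-value d (tail d) u (tail-value d e e≡′))))
            (pre u q)
          guarded : ∀ c y z → (c ≡ true → y ≡ z) → ⌞ c ⌟ * (⌞ not (lookup X v) ⌟ * (val e * y)) ≡ ⌞ c ⌟ * (⌞ not (lookup X v) ⌟ * (val e * z))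
          guarded false y z h = refl
          guarded true  y z h = cong (λ y → 1 * (⌞ not (lookup X v) ⌟ * (val e * y))) (h refl)
          value : _ ≡ ⌞ v == rootOf d ⌟ * ⌞ empty X ⌟ + ∑ (es ++ [ e ]) (term d v X)
          value = trans (cong₂ _+_ acc≡ (trans
            (cong₂ _*_ (equal-expr (head d) (var 𝕧) (head-value d e e≡′) v≡)
              (cong₂ _*_ (contains-value current (tail d) X u cur≡ (tail-value d e e≡′))
                (cong₂ _*_ (trans (cong (1 ∸_) (contains-value current (var 𝕧) X v cur≡ v≡)) (negate-value (lookup X v)))
                  (cong (_* ⟦ read tab (address (current ⊝ weightOf (tail d)) (column d (tail d))) ⟧ τ) (edge-power (var 𝕖) e e≡′)))))
            (cong (⌞ heads d e == v ⌟ *_) (guarded (lookup X u) _ _ table))))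
            (trans (+-assoc (⌞ v == rootOf d ⌟ * ⌞ empty X ⌟) _ _) (cong (⌞ v == rootOf d ⌟ * ⌞ empty X ⌟ +_) (sym (∑-snoc es e (term d v X)))))

        card-≡ᵇ-0 : ∀ {k} (Y : Subset k) → ⌞ card Y ≡ᵇ 0 ⌟ ≡ ⌞ empty Y ⌟
        card-≡ᵇ-0 []          = refl
        card-≡ᵇ-0 (false ∷ Y) = card-≡ᵇ-0 Y
        card-≡ᵇ-0 (true ∷ Y)  = refl

        Visited : Store → Fin n → Store → Set
        Visited τ v υ = (∀ j → υ tab j ≡ (if cell X v ≡ᵇ j then dp d v X else τ tab j))
                      × (∀ j → υ fam j ≡ (if cell X v ≡ᵇ j then base d v X else τ fam j))

        run-visit : ∀ v τ → Bnd τ → Ready τ → τ 𝕡 0 ≡ length xs → τ 𝕧 0 ≡ toℕ v → Predecessors τ →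
          Run (visit d) τ (1 + (m * 3 + 2 + 2)) (Visited τ v)
        run-visit v τ β r p≡ v≡ pre = run-seq {c₁} {_} {τ} {R = λ υ → υ acc 0 ≡ ⌞ v == rootOf d ⌟ * ⌞ empty X ⌟}
          (run-write {acc} {lit 0} {_} {τ} β (≤-trans (≤-reflexive init) (≤-trans (*-mono-≤ (⌞⌟≤1 (v == rootOf d)) (⌞⌟≤1 (empty X))) (m^n>0 2 word))) init)
          λ τ₁ β₁ f₁ acc₁ → run-seq {for 𝕖 edgeCount (extend d)} {_} {τ₁} {R = λ υ → υ acc 0 ≡ dp d v X}
            (run-post (λ υ _ _ q → trans q (sym (dp-rec d v X)))
              (run-mono (≤-reflexive (cong (λ k → k * 3 + 2) (length-allFin m)))
                (run-for {𝕖} {edgeCount} {extend d} {τ₁} {1} 𝔼 (λ es υ → υ acc 0 ≡ ⌞ v == rootOf d ⌟ * ⌞ empty X ⌟ + ∑ es (term d v X)) refl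
                  (λ υ g → trans (m-cell (frame-inputs g (frame-inputs f₁ (inputs r)))) (sym (length-allFin m))) β₁
                  (≤-trans (≤-reflexive (length-allFin m)) (≤word⇒≤2^ m≤))
                  (trans acc₁ (sym (+-identityʳ _)))
                  (λ es e rest υ eq βυ g e≡ inv → run-extend v es e rest υ eq βυ (frame-ready g (frame-ready f₁ r))
                    (trans (unchanged g 𝕡 0) (trans (unchanged f₁ 𝕡 0) p≡)) (trans (unchanged g 𝕧 0) (trans (unchanged f₁ 𝕧 0) v≡)) e≡
                    (λ u q → trans (unchanged g tab _) (trans (unchanged f₁ tab _) (pre u q))) inv))))
            λ τ₂ β₂ f₂ acc₂ → store τ₁ f₁ τ₂ β₂ f₂ acc₂
          where
          open At r
          c₁ = write acc (lit 0) (equals (var 𝕧) (root d) ⊗ equals (read crd (var 𝕡)) (lit 0))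
          c₃ = write tab (address current (column d (var 𝕧))) (var acc)
          c₄ = write fam (address current (column d (var 𝕧))) (equals (read crd (var 𝕡)) (halfLength d) ⊗ var acc)
          init : ⟦ equals (var 𝕧) (root d) ⊗ equals (read crd (var 𝕡)) (lit 0) ⟧ τ ≡ ⌞ v == rootOf d ⌟ * ⌞ empty X ⌟
          init = cong₂ _*_ (equal-expr (var 𝕧) (root d) v≡ (root-value d))
            (trans (equal-expr (read crd (var 𝕡)) (lit 0) (card-value xs split p≡) refl) (card-≡ᵇ-0 X))
          store : ∀ τ₁ → Frame c₁ τ τ₁ → ∀ τ₂ → Bnd τ₂ → Frame (for 𝕖 edgeCount (extend d)) τ₁ τ₂ → τ₂ acc 0 ≡ dp d v X → Run (c₃ ⨾ c₄) τ₂ 2 (Visited τ v)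
          store τ₁ f₁ τ₂ β₂ f₂ acc₂ = run-seq {c₃} {c₄} {τ₂} {R = λ υ → ∀ j → υ tab j ≡ (if cell X v ≡ᵇ j then dp d v X else τ tab j)}
              (run-write {tab} {address current (column d (var 𝕧))} {var acc} {τ₂} β₂ (β₂ acc 0)
                (λ j → trans (cong₂ (λ a y → if a ≡ᵇ j then y else τ₂ tab j) (place₂ (frame-ready f₂ (frame-ready f₁ r)) p₂ v₂) acc₂)
                  (cong (λ y → if cell X v ≡ᵇ j then dp d v X else y) (trans (unchanged f₂ tab j) (unchanged f₁ tab j)))))
              λ τ₃ β₃ f₃ tab₃ → let r₃ = frame-ready f₃ (frame-ready f₂ (frame-ready f₁ r))
                                    p₃ = trans (unchanged f₃ 𝕡 0) p₂
                                    v₃ = trans (unchanged f₃ 𝕧 0) v₂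
                                    value = trans (cong₂ _*_ (At.equal-expr r₃ (read crd (var 𝕡)) (halfLength d) (At.card-value r₃ xs split p₃) (At.length-value r₃ d))
                                              (trans (unchanged f₃ acc 0) acc₂)) (dp-base d v X)
                in run-write {fam} {address current (column d (var 𝕧))} {_} {τ₃} β₃ (≤-trans (≤-reflexive value) (≤-trans (base-≤ d v X) (2^-≤ growth≤)))
                  (tab₃ , λ j → trans (cong₂ (λ a y → if a ≡ᵇ j then y else τ₃ fam j) (place₂ r₃ p₃ v₃) value)
                     (cong (λ y → if cell X v ≡ᵇ j then base d v X else y) (trans (unchanged f₃ fam j) (trans (unchanged f₂ fam j) (unchanged f₁ fam j)))))
            where
            p₂ : τ₂ 𝕡 0 ≡ length xs
            p₂ = trans (unchanged f₂ 𝕡 0) (trans (unchanged f₁ 𝕡 0) p≡)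
            v₂ : τ₂ 𝕧 0 ≡ toℕ v
            v₂ = trans (unchanged f₂ 𝕧 0) (trans (unchanged f₁ 𝕧 0) v≡)
            place₂ : ∀ {υ} (r : Ready υ) → υ 𝕡 0 ≡ length xs → υ 𝕧 0 ≡ toℕ v → ⟦ address current (column d (var 𝕧)) ⟧ υ ≡ cell X v
            place₂ r p v = At.address-value r current (column d (var 𝕧)) X (col d _) (At.current-value r xs split p) (At.column-value r d (var 𝕧) _ v)

        VisitedAll : Store → List (Fin n) → Store → Set
        VisitedAll τ vs υ = (∀ v → v ∈ vs → υ tab (cell X v) ≡ dp d v X × υ fam (cell X v) ≡ base d v X)
                          × (∀ j → (∀ v → j ≢ cell X v) → υ tab j ≡ τ tab j × υ fam j ≡ τ fam j)

        run-visits : ∀ τ → Bnd τ → Ready τ → τ 𝕡 0 ≡ length xs → Predecessors τ →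
          Run (for 𝕧 vertexCount (visit d)) τ (n * (m * 3 + 7) + 2) (VisitedAll τ V)
        run-visits τ β r p≡ pre = run-mono (≤-reflexive (cong₂ (λ a b → a * b + 2) (length-allFin n) (steps m)))
          (run-for {𝕧} {vertexCount} {visit d} {τ} {1 + (m * 3 + 2 + 2)} V (VisitedAll τ) refl
            (λ υ g → trans (n-cell (frame-inputs g (inputs r))) (sym (length-allFin n))) β
            (≤-trans (≤-reflexive (length-allFin n)) (≤word⇒≤2^ n≤))
            ((λ v ()) , λ j _ → refl , refl)
            (λ vs v rest υ eq βυ g v≡ (done , other) → run-post (λ υ′ _ _ (tab≡ , fam≡) →
                (λ u u∈ → update υ υ′ vs v done tab≡ fam≡ u (∈-++⁻ vs u∈))
                , λ j j≢ → trans (tab≡ j) (trans (if-≢ (j≢ v)) (proj₁ (other j j≢))) , trans (fam≡ j) (trans (if-≢ (j≢ v)) (proj₂ (other j j≢))))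
              (run-visit v υ βυ (frame-ready g r) (trans (unchanged g 𝕡 0) p≡) (trans v≡ (allFin-split vs eq))
                -- Writing row X does not touch the row of `delete u X`, whose mask is smaller.
                (λ u q → trans (proj₁ (other (cell (delete u X) u) (λ u′ eq′ → <-irrefl (cong mask (proj₁ (cell-injective {delete u X} {X} eq′))) (delete-<ᴹ u X q)))) (pre u q)))))
          where
          steps : ∀ m → 1 + (m * 3 + 2 + 2) + 2 ≡ m * 3 + 7
          steps = solve-∀
          update : ∀ υ υ′ vs v → (∀ u → u ∈ vs → υ tab (cell X u) ≡ dp d u X × υ fam (cell X u) ≡ base d u X) →
            (∀ j → υ′ tab j ≡ (if cell X v ≡ᵇ j then dp d v X else υ tab j)) → (∀ j → υ′ fam j ≡ (if cell X v ≡ᵇ j then base d v X else υ fam j)) →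
            ∀ u → u ∈ vs ⊎ u ∈ [ v ] → υ′ tab (cell X u) ≡ dp d u X × υ′ fam (cell X u) ≡ base d u X
          update υ υ′ vs v done tab≡ fam≡ u (inj₂ (here refl)) = trans (tab≡ (cell X v)) (if-≡ {a = cell X v} refl) , trans (fam≡ (cell X v)) (if-≡ {a = cell X v} refl)
          update υ υ′ vs v done tab≡ fam≡ u (inj₁ u∈) with u Data.Fin.Properties.≟ v
          ... | yes refl = trans (tab≡ (cell X v)) (if-≡ {a = cell X v} refl) , trans (fam≡ (cell X v)) (if-≡ {a = cell X v} refl)
          ... | no u≢v   = trans (tab≡ (cell X u)) (trans (if-≢ {a = cell X v} {cell X u} (λ q → u≢v (proj₂ (cell-injective {X} {X} q)))) (proj₁ (done u u∈)))
                         , trans (fam≡ (cell X u)) (trans (if-≢ {a = cell X v} {cell X u} (λ q → u≢v (proj₂ (cell-injective {X} {X} q)))) (proj₂ (done u u∈)))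

      -- The last clause lets the passes for the two directions, which use different columns, be
      -- composed, and preserves the zeros in the rows of large sets.
      HalfDone : Store → List (Subset n) → Store → Set
      HalfDone σ xs υ = (∀ Y → Y ∈ xs → ∀ v → υ tab (cell Y v) ≡ dp d v Y)
                      × (∀ Y → Y ∈ xs → ∀ v → υ fam (cell Y v) ≡ base d v Y)
                      × (∀ j → (∀ Y v → Y ∈ small K n → j ≢ cell Y v) → υ fam j ≡ σ fam j)

      run-halfPaths : ∀ σ → Bnd σ → Ready σ → Run (halfPaths d) σ (Λ * (n * (m * 3 + 7) + 4) + 2) (HalfDone σ (small K n))
      run-halfPaths σ β r = run-mono (≤-reflexive (cong (λ k → Λ * k + 2) (+-assoc (n * (m * 3 + 7)) 2 2)))
        (run-for {𝕡} {var len} {for 𝕧 vertexCount (visit d)} {σ} {n * (m * 3 + 7) + 2} (small K n) (HalfDone σ) refl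
          (λ υ g → trans (unchanged g len 0) (proj₁ (listed r))) β Λ≤
          ((λ Y ()) , (λ Y ()) , λ j _ → refl)
          (λ xs X ys υ eq βυ g p≡ (tab≡ , fam≡ , other) → run-post (λ υ′ _ _ (done , rest) →
              (λ Y Y∈ v → proj₁ (finish xs X ys υ υ′ eq tab≡ fam≡ done rest Y (∈-++⁻ xs Y∈) v))
              , (λ Y Y∈ v → proj₂ (finish xs X ys υ υ′ eq tab≡ fam≡ done rest Y (∈-++⁻ xs Y∈) v))
              , (λ j j≢ → trans (proj₂ (rest j (λ v → j≢ X v (subst (X ∈_) (sym eq) (∈-++⁺ʳ xs (here refl)))))) (other j j≢)))
            (run-visits xs X ys eq υ βυ (frame-ready g r) p≡
              (λ u q → tab≡ (delete u X) (earlier-small K n xs eq (delete u X)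
                (≤-trans (n≤1+n _) (≤-trans (≤-reflexive (card-delete u X q)) (All.lookup (small-card K n) (subst (X ∈_) (sym eq) (∈-++⁺ʳ xs (here refl))))))
                (delete-<ᴹ u X q)) u))))
        where
        finish : ∀ xs X ys υ υ′ (eq : small K n ≡ xs ++ X ∷ ys) → (∀ Y → Y ∈ xs → ∀ v → υ tab (cell Y v) ≡ dp d v Y) → (∀ Y → Y ∈ xs → ∀ v → υ fam (cell Y v) ≡ base d v Y) →
          (∀ v → v ∈ V → υ′ tab (cell X v) ≡ dp d v X × υ′ fam (cell X v) ≡ base d v X) →
          (∀ j → (∀ v → j ≢ cell X v) → υ′ tab j ≡ υ tab j × υ′ fam j ≡ υ fam j) →
          ∀ Y → Y ∈ xs ⊎ Y ∈ [ X ] → ∀ v → υ′ tab (cell Y v) ≡ dp d v Y × υ′ fam (cell Y v) ≡ base d v Y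
        finish xs X ys υ υ′ eq tab≡ fam≡ done rest Y (inj₂ (here refl)) v = done v (∈-allFin v)
        finish xs X ys υ υ′ eq tab≡ fam≡ done rest Y (inj₁ Y∈) v =
          let (p , q) = rest (cell Y v) (λ u e → earlier-≢ K n xs eq Y∈ (proj₁ (cell-injective e)))
          in trans p (tab≡ Y Y∈ v) , trans q (fam≡ Y Y∈ v)

    family : Fin (n + n) → Subset n → ℕ
    family c X with Fin.splitAt n c
    ... | inj₁ v = base false v X
    ... | inj₂ v = base true v X

    Family : (Fin (n + n) → Subset n → ℕ) → Store → Set
    Family φ τ = ∀ c X → τ fam (addr X c) ≡ φ c X

    base-vanish : ∀ d v X → K < card X → base d v X ≡ 0
    base-vanish d v X lt = half-card (tails d) (heads d) (rootOf d) (lengthOf d) v X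
      λ eq → <-irrefl refl (<-≤-trans lt (≤-trans (≤-reflexive eq) (lengthOf≤K d)))

    family-vanish : ∀ c X → K < card X → family c X ≡ 0
    family-vanish c X lt with Fin.splitAt n c
    ... | inj₁ v = base-vanish false v X lt
    ... | inj₂ v = base-vanish true v X lt

    family-≤ : ∀ c X → family c X ≤ 2 ^ growth
    family-≤ c X with Fin.splitAt n c
    ... | inj₁ v = base-≤ false v X
    ... | inj₂ v = base-≤ true v X

    run-halves : ∀ {σ} → Bnd σ → Ready σ → (∀ j → σ fam j ≡ 0) →
      Run (halfPaths false ⨾ halfPaths true) σ (Λ * (n * (m * 3 + 7) + 4) + 2 + (Λ * (n * (m * 3 + 7) + 4) + 2)) (Family family)
    run-halves {σ} β r fam≡0 = run-seq {halfPaths false} {halfPaths true} {σ} (run-halfPaths false σ β r)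
      λ τ β₁ f (_ , one , other) → run-post (λ υ _ _ (_ , two , other′) → combined τ υ one other two other′)
        (run-halfPaths true τ β₁ (frame-ready f r))
      where
      Untouched : Bool → Store → Store → Set
      Untouched d σ υ = ∀ j → (∀ Y v → Y ∈ small K n → j ≢ cell d Y v) → υ fam j ≡ σ fam j
      Filled : Bool → Store → Set
      Filled d υ = ∀ Y → Y ∈ small K n → ∀ v → υ fam (cell d Y v) ≡ base d v Y
      -- For a small set the column tells which pass filled the cell; for a large one neither pass
      -- wrote there, and the initial 0 agrees with `base-vanish`.
      combined : ∀ τ υ → Filled false τ → Untouched false σ τ → Filled true υ → Untouched true τ υ → Family family υ
      combined τ υ one other two other′ c X with Fin.splitAt n c in eq | card X ≤? K
      ... | inj₁ v | yes le rewrite sym (Data.Fin.Properties.splitAt⁻¹-↑ˡ eq) = trans (other′ (cell false X v) (λ Y u _ q → sides (proj₂ (addr-injective {X} {Y} q)))) (one X (∈-small K X le) v)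
        where
        sides : ∀ {u} → v ↑ˡ n ≢ n ↑ʳ u
        sides {u} q = <-irrefl (trans (sym (toℕ-↑ˡ v n)) (trans (cong toℕ q) (toℕ-↑ʳ n u))) (<-≤-trans (toℕ<n v) (m≤m+n n (toℕ u)))
      ... | inj₂ v | yes le rewrite sym (Data.Fin.Properties.splitAt⁻¹-↑ʳ {n} eq) = two X (∈-small K X le) v
      ... | inj₁ v | no gt = trans (other′ (addr X c) (missing true)) (trans (other (addr X c) (missing false)) (trans (fam≡0 _) (sym (base-vanish false v X (≰⇒> gt)))))
        where
        missing : ∀ d Y u → Y ∈ small K n → addr X c ≢ cell d Y u
        missing d Y u Y∈ q = gt (subst (λ Z → card Z ≤ K) (sym (proj₁ (addr-injective {X} {Y} q))) (All.lookup (small-card K n) Y∈))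
      ... | inj₂ v | no gt = trans (other′ (addr X c) (missing true)) (trans (other (addr X c) (missing false)) (trans (fam≡0 _) (sym (base-vanish true v X (≰⇒> gt)))))
        where
        missing : ∀ d Y u → Y ∈ small K n → addr X c ≢ cell d Y u
        missing d Y u Y∈ q = gt (subst (λ Z → card Z ≤ K) (sym (proj₁ (addr-injective {X} {Y} q))) (All.lookup (small-card K n) Y∈))

    -- The zeta transform, computed in place.

    Table : Set
    Table = Fin (n + n) → Subset n → ℕ

    module _ (i : Fin n) (ψ : Table) (vanish : ∀ c X → K < card X → ψ c X ≡ 0) (ψ≤ : ∀ c X → fold₁ i (ψ c) X ≤ 2 ^ word) where

      -- The transform halfway through: finished cells hold the new function, all others still the
      -- old one.
      Partial : (Fin (n + n) → Subset n → Set) → Store → Set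
      Partial Done υ = ∀ c Y → (Done c Y → υ fam (addr Y c) ≡ fold₁ i (ψ c) Y) × (¬ Done c Y → υ fam (addr Y c) ≡ ψ c Y)

      module _ (xs : List (Subset n)) (X : Subset n) (ys : List (Subset n)) (split : small K n ≡ xs ++ X ∷ ys) where

        Within : List (Fin (n + n)) → Fin (n + n) → Subset n → Set
        Within cs c Y = Y ∈ xs ⊎ (Y ≡ X × c ∈ cs)

        run-foldColumn : ∀ cs c rest υ → allFin (n + n) ≡ cs ++ c ∷ rest → Bnd υ → Ready υ → υ 𝕚 0 ≡ toℕ i → υ 𝕡 0 ≡ length xs → υ 𝕧 0 ≡ length cs →
          Partial (Within cs) υ → Run foldColumn υ 1 (Partial (Within (cs ++ [ c ])))
        run-foldColumn cs c rest υ eq β r i≡ p≡ v≡ inv = run-write {fam} {address current (var 𝕧)} {_} {υ} β (≤-trans (≤-reflexive value) (ψ≤ c X))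
          λ c′ Y → (λ q → trans (stored c′ Y) (done c′ Y q)) , (λ q → trans (stored c′ Y) (undone c′ Y q))
          where
          open At r
          cur≡ = current-value xs split p≡
          c≡ : υ 𝕧 0 ≡ toℕ c
          c≡ = trans v≡ (allFin-split cs eq)
          place≡ : ⟦ address current (var 𝕧) ⟧ υ ≡ addr X c
          place≡ = address-value current (var 𝕧) X c cur≡ c≡
          fresh : ¬ Within cs c X
          fresh (inj₁ X∈) = earlier-≢ K n xs split X∈ refl
          fresh (inj₂ (_ , c∈)) = allFin-fresh cs eq c∈
          other : lookup X i ≡ false → ⟦ read fam (address (current ⊕ weightOf (var 𝕚)) (var 𝕧)) ⟧ υ ≡ ψ c (insert i X)
          other q = trans (cong (υ fam) (address-value (current ⊕ weightOf (var 𝕚)) (var 𝕧) (insert i X) c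
              (trans (cong₂ _+_ cur≡ (weight-value (var 𝕚) i i≡)) (sym (mask-insert i X q))) c≡))
            (proj₂ (inv c (insert i X)) above)
            where
            larger : mask X < mask (insert i X)
            larger = subst (mask X <_) (sym (mask-insert i X q)) (m<m+n (mask X) (m^n>0 2 (place i)))
            -- The superset has a larger mask than X, whereas the finished sets do not.
            above : ¬ Within cs c (insert i X)
            above (inj₁ Y∈) = <-asym larger (distinct-earlier xs (subst (AllPairs _<ᴹ_) split (small-sorted K n)) Y∈)
            above (inj₂ (Y≡X , _)) = <-irrefl (cong mask (sym Y≡X)) larger
          guarded : ∀ a {y z} → (a ≡ false → y ≡ z) → ⌞ not a ⌟ * y ≡ ⌞ not a ⌟ * z
          guarded false h = cong (1 *_) (h refl)
          guarded true  h = refl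
          value : ⟦ read fam (address current (var 𝕧)) ⊕ negate (contains current (var 𝕚)) ⊗ read fam (address (current ⊕ weightOf (var 𝕚)) (var 𝕧)) ⟧ υ ≡ fold₁ i (ψ c) X
          value = cong₂ _+_ (trans (cong (υ fam) place≡) (proj₂ (inv c X) fresh))
            (trans (cong (_* ⟦ read fam (address (current ⊕ weightOf (var 𝕚)) (var 𝕧)) ⟧ υ) (trans (cong (1 ∸_) (contains-value current (var 𝕚) X i cur≡ i≡)) (negate-value (lookup X i))))
              (guarded (lookup X i) other))
          stored : ∀ c′ Y → (υ [ fam , ⟦ address current (var 𝕧) ⟧ υ ≔ _ ]) fam (addr Y c′) ≡ (if addr X c ≡ᵇ addr Y c′ then fold₁ i (ψ c) X else υ fam (addr Y c′))
          stored c′ Y = cong₂ (λ a y → if a ≡ᵇ addr Y c′ then y else υ fam (addr Y c′)) place≡ value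
          done : ∀ c′ Y → Within (cs ++ [ c ]) c′ Y → (if addr X c ≡ᵇ addr Y c′ then fold₁ i (ψ c) X else υ fam (addr Y c′)) ≡ fold₁ i (ψ c′) Y
          done c′ Y q with addr X c ≟ addr Y c′
          ... | yes same with addr-injective {X} {Y} same
          ...   | refl , refl = if-≡ {a = addr X c} refl
          done c′ Y (inj₁ Y∈) | no differ = trans (if-≢ {a = addr X c} (λ e → differ (sym e))) (proj₁ (inv c′ Y) (inj₁ Y∈))
          done c′ Y (inj₂ (refl , c∈)) | no differ with ∈-++⁻ cs c∈
          ... | inj₁ c∈cs = trans (if-≢ {a = addr X c} (λ e → differ (sym e))) (proj₁ (inv c′ Y) (inj₂ (refl , c∈cs)))
          ... | inj₂ (here refl) = contradiction refl differ
          undone : ∀ c′ Y → ¬ Within (cs ++ [ c ]) c′ Y → (if addr X c ≡ᵇ addr Y c′ then fold₁ i (ψ c) X else υ fam (addr Y c′)) ≡ ψ c′ Y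
          undone c′ Y q with addr X c ≟ addr Y c′
          ... | yes same with addr-injective {X} {Y} same
          ...   | refl , refl = contradiction (inj₂ (refl , ∈-++⁺ʳ cs (here refl))) q
          undone c′ Y q | no differ = trans (if-≢ {a = addr X c} (λ e → differ (sym e)))
            (proj₂ (inv c′ Y) λ { (inj₁ Y∈) → q (inj₁ Y∈) ; (inj₂ (Y≡X , c∈)) → q (inj₂ (Y≡X , ∈-++⁺ˡ c∈)) })

        run-foldColumns : ∀ υ → Bnd υ → Ready υ → υ 𝕚 0 ≡ toℕ i → υ 𝕡 0 ≡ length xs → Partial (λ _ Y → Y ∈ xs) υ →
          Run (for 𝕧 (vertexCount ⊕ vertexCount) foldColumn) υ ((n + n) * 3 + 2) (Partial (λ _ Y → Y ∈ xs ++ [ X ]))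
        run-foldColumns υ β r i≡ p≡ inv = run-post (λ υ′ _ _ q c Y → (λ Y∈ → proj₁ (q c Y) (toWithin c Y (∈-++⁻ xs Y∈))) , (λ Y∉ → proj₂ (q c Y) λ { (inj₁ Y∈) → Y∉ (∈-++⁺ˡ Y∈) ; (inj₂ (refl , _)) → Y∉ (∈-++⁺ʳ xs (here refl)) }))
          (run-mono (≤-reflexive (cong (λ k → k * 3 + 2) (length-allFin (n + n))))
            (run-for {𝕧} {vertexCount ⊕ vertexCount} {foldColumn} {υ} {1} (allFin (n + n)) (λ cs τ → Partial (Within cs) τ) refl
              (λ τ g → trans (cong₂ _+_ (n-cell (frame-inputs g (inputs r))) (n-cell (frame-inputs g (inputs r)))) (sym (length-allFin (n + n)))) β
              (≤-trans (≤-reflexive (length-allFin (n + n))) (≤word⇒≤2^ (≤-trans (+-monoʳ-≤ n (m≤m+n n (n + (n + 0)))) 4n≤)))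
              (λ c Y → (λ { (inj₁ Y∈) → proj₁ (inv c Y) Y∈ }) , λ q → proj₂ (inv c Y) (λ Y∈ → q (inj₁ Y∈)))
              (λ cs c rest τ eq βτ g v≡ q → run-foldColumn cs c rest τ eq βτ (frame-ready g r) (trans (unchanged g 𝕚 0) i≡) (trans (unchanged g 𝕡 0) p≡) v≡ q)))
          where
          toWithin : ∀ c Y → Y ∈ xs ⊎ Y ∈ [ X ] → Within (allFin (n + n)) c Y
          toWithin c Y (inj₁ Y∈) = inj₁ Y∈
          toWithin c Y (inj₂ (here refl)) = inj₂ (refl , ∈-allFin c)

      run-foldVertex : ∀ υ → Bnd υ → Ready υ → υ 𝕚 0 ≡ toℕ i → Family ψ υ →
        Run (for 𝕡 (var len) (for 𝕧 (vertexCount ⊕ vertexCount) foldColumn)) υ (Λ * ((n + n) * 3 + 4) + 2) (Family (λ c → fold₁ i (ψ c)))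
      run-foldVertex υ β r i≡ inv = run-post (λ υ′ _ _ q c Y → finish υ′ q c Y)
        (run-mono (≤-reflexive (cong (λ k → Λ * k + 2) (+-assoc ((n + n) * 3) 2 2)))
          (run-for {𝕡} {var len} {for 𝕧 (vertexCount ⊕ vertexCount) foldColumn} {υ} {(n + n) * 3 + 2} (small K n) (λ xs τ → Partial (λ _ Y → Y ∈ xs) τ) refl
            (λ τ g → trans (unchanged g len 0) (proj₁ (listed r))) β Λ≤
            (λ c Y → (λ ()) , λ _ → inv c Y)
            (λ xs X ys τ eq βτ g p≡ q → run-foldColumns xs X ys eq τ βτ (frame-ready g r) (trans (unchanged g 𝕚 0) i≡) p≡ q)))
        where
        finish : ∀ υ′ → Partial (λ _ Y → Y ∈ small K n) υ′ → ∀ c Y → υ′ fam (addr Y c) ≡ fold₁ i (ψ c) Y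
        finish υ′ q c Y with card Y ≤? K
        ... | yes le = proj₁ (q c Y) (∈-small K Y le)
        -- No cell of a large set is written; the old and the new function are both 0 there.
        ... | no gt  = trans (proj₂ (q c Y) (λ Y∈ → gt (All.lookup (small-card K n) Y∈)))
          (trans (vanish c Y (≰⇒> gt)) (sym (ζ-vanish (i ∷ []) (vanish c) Y (≰⇒> gt))))

    bound : ℕ
    bound = 2 ^ n * 2 ^ growth

    ζ-family-≤ : ∀ is → length is ≤ n → ∀ c X → ζ is (family c) X ≤ bound
    ζ-family-≤ is le c X = ≤-trans (ζ-≤ is (family-≤ c) X) (*-monoˡ-≤ (2 ^ growth) (^-monoʳ-≤ 2 le))

    -- At most 2^n sets, n middle vertices, and a product of two transforms.
    totalBound : ℕ
    totalBound = 2 ^ n * (n * (bound * bound))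

    totalBound≤ : totalBound ≤ 2 ^ word
    totalBound≤ = begin
      2 ^ n * (n * (bound * bound))       ≤⟨ *-monoʳ-≤ (2 ^ n) (*-monoˡ-≤ (bound * bound) (n≤2^n n)) ⟩
      2 ^ n * (2 ^ n * (bound * bound))   ≡⟨ cong (λ z → 2 ^ n * (2 ^ n * (z * z))) (sym (^-distribˡ-+-* 2 n growth)) ⟩
      2 ^ n * (2 ^ n * (2 ^ (n + growth) * 2 ^ (n + growth))) ≡⟨ cong (λ z → 2 ^ n * (2 ^ n * z)) (sym (^-distribˡ-+-* 2 (n + growth) (n + growth))) ⟩
      2 ^ n * (2 ^ n * 2 ^ (n + growth + (n + growth))) ≡⟨ cong (2 ^ n *_) (sym (^-distribˡ-+-* 2 n _)) ⟩
      2 ^ n * 2 ^ (n + (n + growth + (n + growth))) ≡⟨ sym (^-distribˡ-+-* 2 n _) ⟩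
      2 ^ (n + (n + (n + growth + (n + growth)))) ≡⟨ cong (2 ^_) (shuffle n growth) ⟩
      2 ^ (4 * n + 2 * growth)            ≤⟨ 2^-≤ 4n+2g≤ ⟩
      2 ^ word ∎
      where
      open ≤-Reasoning
      shuffle : ∀ n g → n + (n + (n + g + (n + g))) ≡ 4 * n + 2 * g
      shuffle = solve-∀

    bound≤ : bound ≤ 2 ^ word
    bound≤ = ≤-trans (≤-reflexive (sym (^-distribˡ-+-* 2 n growth))) (2^-≤ (≤-trans (+-mono-≤ (m≤m+n n (3 * n)) (m≤m+n growth (growth + 0))) 4n+2g≤))

    run-zeta : ∀ {σ} → Bnd σ → Ready σ → Family family σ → Run zeta σ (n * (Λ * ((n + n) * 3 + 4) + 4) + 2) (Family (λ c → ζ V (family c)))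
    run-zeta {σ} β r inv = run-mono (≤-reflexive (cong₂ (λ a b → a * b + 2) (length-allFin n) (+-assoc (Λ * ((n + n) * 3 + 4)) 2 2)))
      (run-for {𝕚} {vertexCount} {for 𝕡 (var len) (for 𝕧 (vertexCount ⊕ vertexCount) foldColumn)} {σ} {Λ * ((n + n) * 3 + 4) + 2} V (λ is τ → Family (λ c → ζ is (family c)) τ) refl
        (λ υ g → trans (n-cell (frame-inputs g (inputs r))) (sym (length-allFin n))) β (≤-trans (≤-reflexive (length-allFin n)) (≤word⇒≤2^ n≤))
        inv
        (λ is i rest υ eq βυ g i≡ q → run-post (λ υ′ _ _ q′ c X → trans (q′ c X) (sym (ζ-++ is [ i ] (family c) X)))
          (run-foldVertex i (λ c → ζ is (family c)) (λ c → ζ-vanish is (family-vanish c))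
            (λ c X → ≤-trans (≤-reflexive (sym (ζ-++ is [ i ] (family c) X))) (≤-trans (ζ-family-≤ (is ++ [ i ]) (prefix is eq) c X) bound≤))
            υ βυ (frame-ready g r) (trans i≡ (allFin-split is eq)) q)))
      where
      prefix : ∀ is {i : Fin n} {rest} → V ≡ is ++ i ∷ rest → length (is ++ [ i ]) ≤ n
      prefix is {i} eq = ≤-trans (≤-reflexive (trans (length-++ is) (+-comm (length is) 1))) (subst (λ k → suc k ≤ n) (sym (allFin-split is eq)) (toℕ<n i))

    -- Parity sums.

    product : Fin n → Subset n → ℕ
    product v X = ζ V (family (v ↑ˡ n)) X * ζ V (family (n ↑ʳ v)) X

    paritySums : Bool → ℕ
    paritySums q = ∑ (small K n) (λ X → sameParity q X * ∑ V (λ v → product v X))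

    paritySums-≤ : ∀ q → paritySums q ≤ 2 ^ word
    paritySums-≤ q = ≤-trans (∑-const-≤ (small K n) λ X → ≤-trans (⌞⌟*-≤ (not (q xor odd X)) _)
        (≤-trans (∑-const-≤ V λ v → *-mono-≤ (ζ-family-≤ V (≤-reflexive (length-allFin n)) (v ↑ˡ n) X) (ζ-family-≤ V (≤-reflexive (length-allFin n)) (n ↑ʳ v) X))
          (*-monoˡ-≤ (bound * bound) (≤-reflexive (length-allFin n)))))
      (≤-trans (*-monoˡ-≤ (n * (bound * bound)) (length-small-≤ K n)) totalBound≤)

    Summed : List (Subset n) → Store → Set
    Summed xs υ = ∀ q → υ sums ⌞ q ⌟ ≡ ∑ xs (λ X → sameParity q X * ∑ V (λ v → product v X))

    run-addProducts : ∀ xs X ys → small K n ≡ xs ++ X ∷ ys → ∀ τ → Bnd τ → Ready τ → τ 𝕡 0 ≡ length xs → Family (λ c → ζ V (family c)) τ → Summed xs τ →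
      Run (for 𝕧 vertexCount addProduct) τ (n * 3 + 2) (Summed (xs ++ [ X ]))
    run-addProducts xs X ys split τ β r p≡ F inv =
      run-post (λ υ _ _ q o → trans (q o) (sym (∑-snoc xs X (λ X → sameParity o X * ∑ V (λ v → product v X)))))
        (run-mono (≤-reflexive (cong (λ k → k * 3 + 2) (length-allFin n)))
          (run-for {𝕧} {vertexCount} {addProduct} {τ} {1} V SummedTo refl
            (λ υ g → trans (n-cell (frame-inputs g (inputs r))) (sym (length-allFin n))) β (≤-trans (≤-reflexive (length-allFin n)) (≤word⇒≤2^ n≤))
            (λ q → trans (inv q) (sym (trans (cong (S q +_) (*-zeroʳ (sameParity q X))) (+-identityʳ _))))
            step))
      where
      S : Bool → ℕ
      S q = ∑ xs (λ X → sameParity q X * ∑ V (λ v → product v X))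
      -- The factor `sameParity` is 0 for the cell of the other parity, which therefore stays as it
      -- was.
      SummedTo : List (Fin n) → Store → Set
      SummedTo vs υ = ∀ q → υ sums ⌞ q ⌟ ≡ S q + sameParity q X * ∑ vs (λ v → product v X)
      step : ∀ vs v rest υ → V ≡ vs ++ v ∷ rest → Bnd υ → Frame (for 𝕧 vertexCount addProduct) τ υ → υ 𝕧 0 ≡ length vs → SummedTo vs υ → Run addProduct υ 1 (SummedTo (vs ++ [ v ]))
      step vs v rest υ eq βυ g v≡ j = run-write {sums} {cardParity} {_} {υ} βυ
        (≤-trans (≤-reflexive value) small≤)
        (λ q → trans (cong₂ (λ a y → if a ≡ᵇ ⌞ q ⌟ then y else υ sums ⌞ q ⌟) cardParity≡ value) (select q (odd X) refl))
        where
        open At (frame-ready g r)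
        v≡′ : υ 𝕧 0 ≡ toℕ v
        v≡′ = trans v≡ (allFin-split vs eq)
        p≡′ = trans (unchanged g 𝕡 0) p≡
        cur≡ = current-value xs split p≡′
        cardParity≡ : ⟦ cardParity ⟧ υ ≡ ⌞ odd X ⌟
        cardParity≡ = trans (modulo-value (υ crd (υ 𝕡 0)) 2) (trans (cong (_% 2) (card-value xs split p≡′)) (card-odd X))
        sum′ : Bool → ℕ
        sum′ q = S q + sameParity q X * ∑ (vs ++ [ v ]) (λ v → product v X)
        own : sameParity (odd X) X ≡ 1
        own with odd X
        ... | true  = refl
        ... | false = refl
        value : ⟦ read sums cardParity ⊕ read fam (address current (var 𝕧)) ⊗ read fam (address current (vertexCount ⊕ var 𝕧)) ⟧ υ ≡ sum′ (odd X)
        value = trans (cong₂ _+_ (trans (cong (υ sums) cardParity≡) (j (odd X)))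
            (cong₂ _*_ (trans (cong (υ fam) (address-value current (var 𝕧) X (v ↑ˡ n) cur≡ (column-value false (var 𝕧) v v≡′))) (trans (unchanged g fam _) (F (v ↑ˡ n) X)))
                       (trans (cong (υ fam) (address-value current (vertexCount ⊕ var 𝕧) X (n ↑ʳ v) cur≡ (column-value true (var 𝕧) v v≡′))) (trans (unchanged g fam _) (F (n ↑ʳ v) X)))))
          (trans (+-assoc (S (odd X)) _ _) (cong (S (odd X) +_) (trans (cong (λ o → o * ∑ vs (λ v → product v X) + product v X) own)
            (trans (cong (_+ product v X) (*-identityˡ _)) (trans (sym (∑-snoc vs v (λ v → product v X))) (sym (trans (cong (_* ∑ (vs ++ [ v ]) (λ v → product v X)) own) (*-identityˡ _))))))))
        small≤ : sum′ (odd X) ≤ 2 ^ word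
        small≤ = ≤-trans (+-monoʳ-≤ (S (odd X)) (*-monoʳ-≤ (sameParity (odd X) X) (∑-prefix-≤ vs v rest (λ v → product v X) eq)))
          (≤-trans (≤-reflexive (sym (∑-snoc xs X (λ Z → sameParity (odd X) Z * ∑ V (λ v → product v Z)))))
            (≤-trans (∑-prefix-≤ xs X ys (λ Z → sameParity (odd X) Z * ∑ V (λ v → product v Z)) split) (paritySums-≤ (odd X))))
        select : ∀ q o → odd X ≡ o → (if ⌞ odd X ⌟ ≡ᵇ ⌞ q ⌟ then sum′ (odd X) else υ sums ⌞ q ⌟) ≡ sum′ q
        select false false eq rewrite eq = refl
        select true  true  eq rewrite eq = refl
        select false true  eq rewrite eq = j false
        select true  false eq rewrite eq = j true

    run-combine : ∀ {σ} → Bnd σ → Ready σ → Family (λ c → ζ V (family c)) σ → (∀ j → σ sums j ≡ 0) → Run combine σ (Λ * (n * 3 + 4) + 2) (λ τ → ∀ q → τ sums ⌞ q ⌟ ≡ paritySums q)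
    run-combine {σ} β r F zeros = run-mono (≤-reflexive (cong (λ k → Λ * k + 2) (+-assoc (n * 3) 2 2)))
      (run-for {𝕡} {var len} {for 𝕧 vertexCount addProduct} {σ} {n * 3 + 2} (small K n) Summed refl
        (λ υ g → trans (unchanged g len 0) (proj₁ (listed r))) β Λ≤
        (λ q → zeros ⌞ q ⌟)
        (λ xs X ys υ eq βυ g p≡ inv → run-addProducts xs X ys eq υ βυ (frame-ready g r) p≡ (λ c Y → trans (unchanged g fam _) (F c Y)) inv))

    family-false : ∀ v X → family (v ↑ˡ n) X ≡ base false v X
    family-false v X rewrite Data.Fin.Properties.splitAt-↑ˡ n v n = refl

    family-true : ∀ v X → family (n ↑ʳ v) X ≡ base true v X
    family-true v X rewrite Data.Fin.Properties.splitAt-↑ʳ n n v = refl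

    -- The sum over small sets may be extended to all sets, since the transforms vanish on large
    -- ones.
    paritySums≡ : ∀ q → paritySums q ≡ ∑ V (λ v → paritySum q (base false v) (base true v))
    paritySums≡ q = begin
      ∑ (small K n) (λ X → sameParity q X * ∑ V (λ v → product v X))
        ≡⟨ ∑-small K n _ (λ X lt → trans (cong (sameParity q X *_) (∑-zero V λ v → cong (_* ζ V (family (n ↑ʳ v)) X) (ζ-vanish V (family-vanish (v ↑ˡ n)) X lt))) (*-zeroʳ (sameParity q X))) ⟩
      ∑ 𝕊 (λ X → sameParity q X * ∑ V (λ v → product v X)) ≡⟨ ∑-cong 𝕊 (λ X → sym (∑-*ˡ V (sameParity q X) _)) ⟩
      ∑ 𝕊 (λ X → ∑ V (λ v → sameParity q X * product v X)) ≡⟨ ∑-swap 𝕊 V _ ⟩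
      ∑ V (λ v → ∑ 𝕊 (λ X → sameParity q X * product v X))
        ≡⟨ ∑-cong V (λ v → ∑-cong 𝕊 λ X → cong (sameParity q X *_) (cong₂ _*_ (ζ-cong V (family-false v) X) (ζ-cong V (family-true v) X))) ⟩
      ∑ V (λ v → paritySum q (base false v) (base true v)) ∎
      where open ≡-Reasoning

    -- From the parity sums to the numbers of paths.

    open Enumeration D w t

    halves-length : ℓ / 2 + K ≡ ℓ
    halves-length = m+[n∸m]≡n (m/n≤m ℓ 2)

    -- The truncated subtraction is exact, as inclusion-exclusion presents the even sum as the odd
    -- sum plus the disjoint pairs; by `avoiding-half` and `split` the latter make up whole paths.
    difference : paritySums false ∸ paritySums true ≡ ∑ (paths ℓ s ∅) (λ π → b ^ totalWeight D w π)
    difference = begin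
      paritySums false ∸ paritySums true ≡⟨ cong₂ _∸_ (paritySums≡ false) (paritySums≡ true) ⟩
      ∑ V (λ v → paritySum false (base false v) (base true v)) ∸ o
        ≡⟨ cong (_∸ o) (trans (∑-cong V λ v → inclusion-exclusion (base false v) (base true v)) (∑-+ V _ _)) ⟩
      o + ∑ V (λ v → disjointPairs (base false v) (base true v)) ∸ o ≡⟨ m+n∸m≡n o _ ⟩
      ∑ V (λ v → disjointPairs (base false v) (base true v))
        ≡⟨ ∑-cong V (λ v → ∑-cong 𝕊 λ X → cong (base false v X *_) (sym (avoiding-half (start D) (end D) t K v X))) ⟩
      ∑ V (λ v → ∑ 𝕊 λ X → base false v X * avoiding (start D) (end D) t K v X) ≡⟨ split (start D) (end D) t s (ℓ / 2) K ⟩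
      avoiding (start D) (end D) t (ℓ / 2 + K) s ∅ ≡⟨ cong (λ k → avoiding (start D) (end D) t k s ∅) halves-length ⟩
      avoiding (start D) (end D) t ℓ s ∅ ≡⟨ sym (∑-paths b ℓ s ∅) ⟩
      ∑ (paths ℓ s ∅) (λ π → b ^ totalWeight D w π) ∎
      where
      open ≡-Reasoning
      o = ∑ V (λ v → paritySum true (base false v) (base true v))

    number : ℕ → ℕ
    number k = length (filter (λ π → totalWeight D w π ≟ k) (paths ℓ s ∅))

    -- There are at most m choices for each edge; the 1 in `digit-bits` makes the inequality strict.
    paths-<b : length (paths ℓ s ∅) < b
    paths-<b = begin-strict
      length (paths ℓ s ∅)   ≤⟨ length-paths ℓ s ∅ ⟩
      m ^ ℓ                  ≤⟨ ^-monoˡ-≤ ℓ (n≤2^n m) ⟩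
      (2 ^ m) ^ ℓ            ≡⟨ ^-*-assoc 2 m ℓ ⟩
      2 ^ (m * ℓ)            ≤⟨ ^-monoʳ-≤ 2 (*-monoʳ-≤ m (<⇒≤ ℓ<n)) ⟩
      2 ^ (m * n)            <⟨ ^-monoʳ-< 2 (s≤s (s≤s z≤n)) (subst (m * n <_) (+-comm 1 (m * n)) ≤-refl) ⟩
      b ∎
      where open ≤-Reasoning

    instance
      b≢0 : NonZero b
      b≢0 = m^n≢0 2 digit-bits

    number≡ : ∀ k → (∑ (paths ℓ s ∅) (λ π → b ^ totalWeight D w π) / b ^ k) {{m^n≢0 b k}} % b ≡ number k
    number≡ k = digit (totalWeight D w) b k (paths ℓ s ∅) paths-<b

    weightLimit≤ : B * ℓ + 1 ≤ B * n + 1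
    weightLimit≤ = +-monoˡ-≤ 1 (*-monoʳ-≤ B (<⇒≤ ℓ<n))

    digit-power≤ : ∀ k → k ≤ B * n + 1 → digit-bits * k ≤ max-power
    digit-power≤ k le = ≤-trans (*-monoʳ-≤ digit-bits le) (m≤m+n _ n)

    digit-bits≤ : digit-bits ≤ max-power
    digit-bits≤ = ≤-trans (≤-reflexive (sym (*-identityʳ digit-bits))) (digit-power≤ 1 (m≤n+m 1 (B * n)))

    limit≤word : B * ℓ + 1 ≤ word
    limit≤word = ≤-trans weightLimit≤ (≤-trans (≤-trans (m≤n*m (B * n + 1) digit-bits {{>-nonZero (m≤n+m 1 (m * n))}}) (m≤m+n _ n)) max-power≤)

    Output : ℕ → Store → Set
    Output k τ = ∀ j → j < k → τ 5 j ≡ number j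

    run-digits : ∀ {σ} → Bnd σ → Ready σ → (∀ q → σ sums ⌞ q ⌟ ≡ paritySums q) →
      Run (digits B) σ ((B * ℓ + 1) * 3 + 2 + 1) (λ τ → τ 4 0 ≡ B * ℓ + 1 × Output (B * ℓ + 1) τ)
    run-digits {σ} β r sums≡ = run-seq {for 𝕚 (weightLimit B) digitAt} {write 4 (lit 0) (weightLimit B)} {σ}
      (run-mono (≤-reflexive (cong (λ k → k * 3 + 2) (length-allFin (B * ℓ + 1))))
        (run-for {𝕚} {weightLimit B} {digitAt} {σ} {1} (allFin (B * ℓ + 1)) (λ ks τ → Output (length ks) τ) refl
          (λ υ g → trans (limit-value (frame-inputs g (inputs r))) (sym (length-allFin (B * ℓ + 1)))) β
          (≤-trans (≤-reflexive (length-allFin (B * ℓ + 1))) (≤word⇒≤2^ limit≤word))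
          (λ j ())
          step))
      λ τ β₁ f out → run-write {4} {lit 0} {weightLimit B} {τ} β₁
        (≤-trans (≤-reflexive (limit-value (frame-inputs f (inputs r)))) (≤word⇒≤2^ limit≤word))
        (limit-value (frame-inputs f (inputs r)) , λ j j< → out j (≤-trans j< (≤-reflexive (sym (length-allFin (B * ℓ + 1))))))
      where
      limit-value : ∀ {υ} → Inputs υ → ⟦ weightLimit B ⟧ υ ≡ B * ℓ + 1
      limit-value x = cong (λ l → B * l + 1) (ℓ-cell x)
      step : ∀ ks (k : Fin (B * ℓ + 1)) rest υ → allFin (B * ℓ + 1) ≡ ks ++ k ∷ rest → Bnd υ → Frame (for 𝕚 (weightLimit B) digitAt) σ υ →
        υ 𝕚 0 ≡ length ks → Output (length ks) υ → Run digitAt υ 1 (λ τ → Output (length (ks ++ [ k ])) (τ [ 𝕚 , 0 ≔ suc (length ks) ]))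
      step ks k rest υ eq βυ g i≡ out = run-write {5} {var 𝕚} {_} {υ} βυ
        (≤-trans (≤-reflexive value) (≤-trans (length-filter (λ π → totalWeight D w π ≟ length ks) (paths ℓ s ∅))
          (≤-trans (<⇒≤ paths-<b) (2^-≤ (≤-trans digit-bits≤ max-power≤)))))
        λ j j< → trans (cong₂ (λ a y → if a ≡ᵇ j then y else υ 5 j) i≡ value) (extend-output j j<)
        where
        x = frame-inputs g (inputs r)
        P : Powers υ
        P j j≤ = trans (unchanged g pow j) (powered r j j≤)
        k< : length ks < B * ℓ + 1
        k< = subst (_< B * ℓ + 1) (sym (allFin-split ks eq)) (toℕ<n k)
        bits-value : ⟦ digitBits ⟧ υ ≡ digit-bits
        bits-value = cong₂ (λ a c → c * a + 1) (n-cell x) (m-cell x)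
        N = ∑ (paths ℓ s ∅) (λ π → b ^ totalWeight D w π)
        base≢0 : NonZero (b ^ length ks)
        base≢0 = m^n≢0 b (length ks) {{b≢0}}
        quotient : ⟦ (read sums (lit 0) ⊝ read sums (lit 1)) ⊘ read pow (digitBits ⊗ var 𝕚) ⟧ υ ≡ (N / b ^ length ks) {{base≢0}}
        quotient = trans (cong₂ (apply div)
            (trans (cong₂ _∸_ (trans (unchanged g sums 0) (sums≡ false)) (trans (unchanged g sums 1) (sums≡ true))) difference)
            (trans (cong (υ pow) (cong₂ _*_ bits-value i≡)) (trans (P (digit-bits * length ks) (digit-power≤ _ (≤-trans (<⇒≤ k<) weightLimit≤))) (sym (^-*-assoc 2 digit-bits (length ks))))))
          (div-value N (b ^ length ks) {{base≢0}})
        value : ⟦ modulo ((read sums (lit 0) ⊝ read sums (lit 1)) ⊘ read pow (digitBits ⊗ var 𝕚)) (read pow digitBits) ⟧ υ ≡ number (length ks)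
        value = trans (cong₂ (λ a c → a ∸ apply div a c * c) quotient (trans (cong (υ pow) bits-value) (P digit-bits digit-bits≤)))
          (trans (modulo-value ((N / b ^ length ks) {{base≢0}}) b {{b≢0}}) (number≡ (length ks)))
        extend-output : ∀ j → j < length (ks ++ [ k ]) → (if length ks ≡ᵇ j then number (length ks) else υ 5 j) ≡ number j
        extend-output j j< with length ks ≟ j
        ... | yes refl = if-≡ {a = length ks} refl
        ... | no ≢j    = trans (if-≢ {a = length ks} (λ e → ≢j (sym e))) (out j (≤∧≢⇒< (≤-pred (≤-trans j< (≤-reflexive (trans (length-++ ks) (+-comm (length ks) 1))))) (λ e → ≢j (sym e))))

    totalWeight-≤ : ∀ {k} (π : Walk D k) → totalWeight D w π ≤ B * k
    totalWeight-≤ (vs , es) = go es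
      where
      go : ∀ {k} (es : Data.Vec.Vec (Edge D) k) → Data.Vec.sum (Data.Vec.map w es) ≤ B * k
      go []       = z≤n
      go (e ∷ es) = ≤-trans (+-mono-≤ (w≤B e) (go es)) (≤-reflexive (sym (*-suc B _)))

    -- Justifies ending the output list after the weight B ℓ.
    number-vanish : ∀ k → B * ℓ < k → number k ≡ 0
    number-vanish k lt = cong length (filter-none (λ π → totalWeight D w π ≟ k)
      (All.universal (λ π eq → <-irrefl refl (<-≤-trans lt (≤-trans (≤-reflexive (sym eq)) (totalWeight-≤ π)))) (paths ℓ s ∅)))

    -- The complete run, its output and its time.

    open Bounds B n m

    σ₀ : Store
    σ₀ = input D w s t ℓ

    initial-inputs : Inputs σ₀
    initial-inputs = record
      { n-cell = refl ; m-cell = refl ; s-cell = refl ; t-cell = refl ; ℓ-cell = refl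
      ; starts-cells = contents-tabulate (toℕ ∘ start D)
      ; ends-cells = contents-tabulate (toℕ ∘ end D)
      ; weights-cells = contents-tabulate w }

    initial-bnd : Bnd σ₀
    initial-bnd a j = ≤word⇒≤2^ (go a j)
      where
      vertex≤ : ∀ (v : Fin n) → toℕ v ≤ word
      vertex≤ v = ≤-trans (<⇒≤ (toℕ<n v)) n≤
      go : ∀ a j → σ₀ a j ≤ word
      go 0 j = contents-≤ (n ∷ m ∷ toℕ s ∷ toℕ t ∷ ℓ ∷ []) (n≤ ∷ m≤ ∷ vertex≤ s ∷ vertex≤ t ∷ ≤-trans (<⇒≤ ℓ<n) n≤ ∷ []) j
      go 1 j = contents-≤ (tabulate (toℕ ∘ start D)) (Allₚ.tabulate⁺ (λ e → vertex≤ (start D e))) j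
      go 2 j = contents-≤ (tabulate (toℕ ∘ end D)) (Allₚ.tabulate⁺ (λ e → vertex≤ (end D e))) j
      go 3 j = contents-≤ (tabulate w) (Allₚ.tabulate⁺ (λ e → ≤-trans (w≤B e) B≤)) j
        where
        B≤ : B ≤ word
        B≤ = ≤-trans (m≤m*n B n {{>-nonZero n>0}}) (≤-trans (m≤m+n (B * n) 1)
          (≤-trans (≤-trans (m≤n*m (B * n + 1) digit-bits {{>-nonZero (m≤n+m 1 (m * n))}}) (m≤m+n _ n)) max-power≤))
      go (suc (suc (suc (suc a)))) j = z≤n

    opaque

      -- Opaque, so that the derivation and its running time are never evaluated.
      run-program : Run (program B) σ₀ (steps ℓ Λ) (λ τ → τ 4 0 ≡ B * ℓ + 1 × Output (B * ℓ + 1) τ)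
      run-program = run-seq {powers B} {_} {σ₀} (run-powers initial-bnd initial-inputs) λ τ₁ β₁ f₁ P₁ →
        let x₁ = frame-inputs f₁ initial-inputs in
        run-seq {smallSubsets} {_} {τ₁} (run-smallSubsets β₁ x₁ P₁ (unchanged f₁ lst) (unchanged f₁ crd)) λ τ₂ β₂ f₂ L₂ →
        let r₂ = record { inputs = frame-inputs f₂ x₁ ; powered = λ j j≤ → trans (unchanged f₂ pow j) (P₁ j j≤) ; listed = L₂ } in
        run-seq {halfPaths false ⨾ halfPaths true} {_} {τ₂} (run-halves β₂ r₂ (λ j → trans (unchanged f₂ fam j) (unchanged f₁ fam j))) λ τ₃ β₃ f₃ F₃ →
        let r₃ = frame-ready f₃ r₂ in
        run-seq {zeta} {_} {τ₃} (run-zeta β₃ r₃ F₃) λ τ₄ β₄ f₄ F₄ →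
        let r₄ = frame-ready f₄ r₃ in
        run-seq {combine} {_} {τ₄} (run-combine β₄ r₄ F₄ (λ j → trans (unchanged f₄ sums j) (trans (unchanged f₃ sums j) (trans (unchanged f₂ sums j) (unchanged f₁ sums j))))) λ τ₅ β₅ f₅ S₅ →
        run-digits β₅ (frame-ready f₅ r₄) S₅

    output≡ : ∀ {τ} → τ 4 0 ≡ B * ℓ + 1 × Output (B * ℓ + 1) τ → ∀ k → number k ≡ output τ k
    output≡ {τ} (len≡ , out) k with k <ᵇ τ 4 0 in eq
    ... | true  = sym (out k (≤-trans (true-<ᵇ eq) (≤-reflexive len≡)))
    ... | false = number-vanish k (≮⇒≥ λ lt → contradiction (trans (sym eq) (<ᵇ-true (≤-trans lt (≤-trans (≤-reflexive (+-comm 1 (B * ℓ))) (≤-reflexive (sym len≡)))))) λ ())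

    Λ>0 : 0 < Λ
    Λ>0 with small K n | ∈-small K (∅ {n}) (≤-trans (≤-reflexive (card-∅ n)) z≤n)
      where
      card-∅ : ∀ n → card (∅ {n}) ≡ 0
      card-∅ zero    = refl
      card-∅ (suc n) = card-∅ n
    ... | _ ∷ _ | _ = z<s

    other-length : ℕ
    other-length = 2 * n ∸ ℓ

    ℓ≤2n : ℓ ≤ 2 * n
    ℓ≤2n = ≤-trans (<⇒≤ ℓ<n) (m≤m+n n (n + 0))

    2K≤ : K + K ≤ suc ℓ
    2K≤ = ≤-trans (+-monoˡ-≤ K K≤′) (≤-reflexive (cong suc halves-length))
      where
      K≤′ : K ≤ suc (ℓ / 2)
      K≤′ = m≤n+o⇒m∸n≤o ℓ (ℓ / 2) (begin
        ℓ ≡⟨ m≡m%n+[m/n]*n ℓ 2 ⟩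
        ℓ % 2 + ℓ / 2 * 2 ≤⟨ +-monoˡ-≤ (ℓ / 2 * 2) (≤-pred (m%n<n ℓ 2)) ⟩
        1 + ℓ / 2 * 2 ≡⟨ twice (ℓ / 2) ⟩
        ℓ / 2 + suc (ℓ / 2) ∎)
        where
        open ≤-Reasoning
        twice : ∀ k → 1 + k * 2 ≡ k + suc k
        twice = solve-∀

    entropy : .{{_ : NonZero n}} → ∀ time P → time ≤ P * Λ → _
    entropy = Analysis.entropy-bound n ℓ other-length K Λ (m+[n∸m]≡n ℓ≤2n) K≤n
      (≤-trans (≤-reflexive (sym halves-length)) (+-monoˡ-≤ K (lengthOf≤K false))) 2K≤
      -- The condition x ≤ y amounts to ℓ ≤ 2n - ℓ, which follows from ℓ < n.
      (length-small (2 + ℓ) (2 + other-length) (+-monoʳ-≤ 2 (m+n≤o⇒m≤o∸n ℓ (≤-trans (+-mono-≤ (<⇒≤ ℓ<n) (<⇒≤ ℓ<n)) (≤-reflexive (cong (n +_) (sym (+-identityʳ n))))))) K n K≤n)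

    -- Pulls Λ out of the step count and replaces m by `eval q n` and ℓ by n, after which the
    -- remaining factor depends on n alone.
    time-≤-timeBound : ∀ q → m ≤ eval q n → L.Run.time run-program ≤ timeBound B q n * Λ
    time-≤-timeBound q m≤ = product₃-chain (≤-product₃ (steps ℓ Λ) (κ (program B)) word (L.Run.time-≤ run-program))
      (steps-≤ ℓ Λ Λ>0) (steps-mono B n m≤ (<⇒≤ ℓ<n)) (word-mono B n m≤)

-- The theorem, assembled from correctness, the entropy bound and the polynomial.

open import Defs
open import Data.Fin using (Fin)
open import Data.Integer using (+_)
open import Data.Nat using (ℕ; NonZero; _*_; _≤_; _<_)
open import Data.Nat.Properties using (m*n≢0)
open import Data.Product using (_×_; ∃-syntax)
open import Data.Rational using (_/_)
open import Relation.Binary.PropositionalEquality using (_≡_)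
open import Data.Nat using (s≤s; z≤n)
open import Data.Nat.Properties using (≤-trans)
open import Data.Product using (_,_; proj₁; proj₂)
open import Relation.Binary.PropositionalEquality using (subst; sym)

theorem2 : (B : ℕ) →
    ∃[ prog ] ((q : Polynomial) →
    ∃[ p ] ((n : ℕ) .{{_ : NonZero n}} →
    (D : Digraph n) → size D ≤ eval q n →
    (w : Weighting D) → (∀ e → w e ≤ B) →
    (s t : Fin n) →
    (ℓ : ℕ) → ℓ < n →
    ∃[ σ ] ∃[ time ]
    (⟨ prog , input D w s t ℓ ⟩⇓⟨ σ , time ⟩
    × (∀ k → (λ (π : Walk D ℓ) → IsPath D s t π × totalWeight D w π ≡ k) HasCardinality output σ k)
    × fromℕ time ≤ᴸ fromℕ (eval p n) · exp (fromℕ n · H ((+ ℓ / (2 * n)) {{m*n≢0 2 n}})))))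
theorem2 B = program B , λ q → proj₁ (timeBound-polynomial B q) , λ n D m≤ w w≤B s t ℓ ℓ<n →
  let
    open Execution (mkInput D w s t ℓ B (≤-trans (s≤s z≤n) ℓ<n) w≤B ℓ<n)
      using (module L; run-program; output≡; entropy; time-≤-timeBound)
    open L.Run run-program
  in final , time , exec
    , (λ k → subst ((λ π → IsPath D s t π × totalWeight D w π ≡ k) HasCardinality_) (output≡ {final} post k) (cardinality D w t s ℓ k))
    , subst (λ z → fromℕ time ≤ᴸ fromℕ z · exp (fromℕ n · H ((+ ℓ / (2 * n)) {{m*n≢0 2 n}})))
        (sym (proj₂ (timeBound-polynomial B q) n)) (entropy time (timeBound B q n) (time-≤-timeBound q m≤))
  where
  open Program using (program)
  open Paths.Enumeration using (cardinality)
  open Correctness
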